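{- Let $d$ be a graphic list. The following are equivalent, and each is equivalent to $d$ being decisive: (1) No realization of $d$ contains a $(3,3)$-blossom. (2) Every realization of $d$ is $\mathcal{B}$-free. (3) $d$ has a $\mathcal{B}$-free realization. (4) $d$ has a realization $G$ for which there is a partition $V_1,V_2,V_3$ of $V(G)$ such that (i) $V_1$ is an independent set and $V_2$ is a clique; (ii) each vertex of $V_3$ is adjacent to every vertex of $V_2$ and to no vertex of $V_1$; and (iii) $G[V_3]$ is split, or has fewer than six vertices, or is isomorphic to one of $U$, $\overline{U}$, $K_2+K_{1,m}$, or $(K_m+K_1)\vee 2K_1$ for some integer $m\ge3$. (5) Every realization of $d$ has a partition $V_1,V_2,V_3$ of its vertex set as described in (4).
   Context: A realization of a graphic list $d=(d_1,\dots,d_n)$ is a simple graph on $[n]$ in which vertex $i$ has degree $d_i$. The list $d$ is decisive if every vertex of the polytope $P(d)=\{x\in\mathbb{R}^{\binom n2}: \sum_{i\ne j}x_{ij}=d_j \ \forall j,\ 0\le x_{ij}\le1\ \forall i<j\}$ (coordinates indexed by unordered pairs of distinct elements of $[n]$) has all coordinates in $\{0,1\}$. A $(3,3)$-blossom in a simple graph $G$ is a set of six distinct vertices $v_1,v_2,v_3,w_1,w_2,w_3$ such that in the sequence of pairs $v_1v_2, v_2v_3, v_3v_1, v_1w_1, w_1w_2, w_2w_3, w_3w_1$ consecutive pairs alternate between non-edges and edges of $G$ ($v_1w_1$ may be either); other pairs are unrestricted. $\mathcal{B}$ is the set of all (six-vertex) graphs whose degree sequence is one of $(1,1,1,1,1,1)$,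 $(2,2,1,1,1,1)$, $(2,2,2,2,1,1)$, $(2,2,2,2,2,2)$, $(3,2,2,1,1,1)$, $(3,2,2,2,2,1)$, $(3,3,2,2,1,1)$, $(3,3,2,2,2,2)$, $(3,3,3,2,2,1)$, $(3,3,3,3,1,1)$, $(3,3,3,3,2,2)$, $(3,3,3,3,3,3)$, $(4,2,2,2,1,1)$, $(4,3,2,2,2,1)$, $(4,3,3,2,2,2)$, $(4,3,3,3,2,1)$, $(4,3,3,3,3,2)$, $(4,4,2,2,2,2)$, $(4,4,3,3,2,2)$, $(4,4,3,3,3,1)$, $(4,4,3,3,3,3)$, $(4,4,4,3,3,2)$, $(4,4,4,4,3,3)$, $(4,4,4,4,4,4)$. A graph is $\mathcal{B}$-free if it has no induced subgraph isomorphic to a member of $\mathcal{B}$. A graph is split if its vertex set can be partitioned into an independent set and a clique. $U$ is the unique graph with degree sequence $(4,2,2,2,2,2)$ (a triangle and a 4-cycle sharing exactly one vertex), and $\overline{U}$ is its complement. $+$ denotes disjoint union, $\vee$ denotes join, $K_m$ is the complete graph, $K_{1,m}$ the star, and $2K_1$ two nonadjacent vertices.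
   Formalization: The polytope P(d) is taken over the rationals, so decisive means that every rational point of P(d) that is extreme among its rational points has all coordinates in {0,1}; real vertices of this rational polytope are always rational, so the notions agree. -}

module Defs where

open import Data.Bool using (Bool; true; false; not; _∧_; _∨_; if_then_else_)
open import Data.Nat as ℕ using (ℕ; zero; suc; _≡ᵇ_; _<ᵇ_; _≤ᵇ_)
open import Data.Fin using (Fin; toℕ; _≟_)
open import Data.Fin.Patterns using (0F; 1F; 2F; 3F; 4F; 5F)
open import Data.List using (List; []; _∷_; map; allFin; filter; length; foldr)
open import Data.List.Membership.Propositional using (_∈_)
open import Data.List.Relation.Binary.Permutation.Propositional using (_↭_)
open import Data.Integer using (+_)
open import Data.Rational as ℚ using (ℚ; 0ℚ; 1ℚ; _/_)
open import Data.Product using (Σ; ∃; ∃-syntax; _×_)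
open import Data.Sum using (_⊎_)
open import Function.Definitions using (Injective)
open import Relation.Nullary using (¬_)
open import Relation.Binary.PropositionalEquality using (_≡_; _≢_)

Graph : ℕ → Set
Graph n = Fin n → Fin n → Bool

IsSimple : ∀ {n} → Graph n → Set
IsSimple {n} G = (∀ (i j : Fin n) → G i j ≡ G j i) × (∀ (i : Fin n) → G i i ≡ false)

deg : ∀ {n} → Graph n → Fin n → ℕ
deg {n} G i = foldr ℕ._+_ 0 (map (λ j → if G i j then 1 else 0) (allFin n))

Realization : ∀ {n} → (Fin n → ℕ) → Graph n → Set
Realization d G = IsSimple G × (∀ i → deg G i ≡ d i)

Graphic : ∀ {n} → (Fin n → ℕ) → Set
Graphic {n} d = ∃[ G ] Realization {n} d G

-- The polytope P(d) and decisiveness.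
-- A point of R^(n choose 2) is represented by x : Fin n → Fin n → ℚ which is
-- symmetric with zero diagonal; the coordinate x_{ij} (i ≠ j) is x i j.

Point : ℕ → Set
Point n = Fin n → Fin n → ℚ

sumℚ : ∀ {n} → (Fin n → ℚ) → ℚ
sumℚ {n} f = foldr ℚ._+_ 0ℚ (map f (allFin n))

ℕtoℚ : ℕ → ℚ
ℕtoℚ k = (+ k) / 1

InP : ∀ {n} → (Fin n → ℕ) → Point n → Set
InP {n} d x =
  (∀ i j → x i j ≡ x j i) ×
  (∀ i → x i i ≡ 0ℚ) ×
  (∀ j → sumℚ (λ i → x i j) ≡ ℕtoℚ (d j)) ×
  (∀ i j → i ≢ j → (0ℚ ℚ.≤ x i j) × (x i j ℚ.≤ 1ℚ))

IsVertex : ∀ {n} → (Fin n → ℕ) → Point n → Set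
IsVertex {n} d x =
  InP d x ×
  (∀ (y z : Point n) (λ′ : ℚ) → InP d y → InP d z →
     0ℚ ℚ.< λ′ → λ′ ℚ.< 1ℚ →
     (∀ i j → x i j ≡ λ′ ℚ.* y i j ℚ.+ (1ℚ ℚ.- λ′) ℚ.* z i j) →
     ∀ i j → y i j ≡ z i j)

Decisive : ∀ {n} → (Fin n → ℕ) → Set
Decisive {n} d = ∀ (x : Point n) → IsVertex d x → ∀ i j → (x i j ≡ 0ℚ) ⊎ (x i j ≡ 1ℚ)

-- (3,3)-blossoms.  The six distinct vertices are f 0F,…,f 5F =
-- v₁,v₂,v₃,w₁,w₂,w₃.  The sequence v₁v₂,v₂v₃,v₃v₁,v₁w₁,w₁w₂,w₂w₃,w₃w₁
-- alternates; b is the status of the first pair (so v₁w₁ is either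
-- an edge or a non-edge, depending on b).

HasBlossom : ∀ {n} → Graph n → Set
HasBlossom {n} G = Σ (Fin 6 → Fin n) λ f → Injective _≡_ _≡_ f × ∃[ b ] Pat f b
  where
  Pat : (Fin 6 → Fin n) → Bool → Set
  Pat f b =
    (G (f 0F) (f 1F) ≡ b) × (G (f 1F) (f 2F) ≡ not b) × (G (f 2F) (f 0F) ≡ b) ×
    (G (f 0F) (f 3F) ≡ not b) × (G (f 3F) (f 4F) ≡ b) × (G (f 4F) (f 5F) ≡ not b) ×
    (G (f 5F) (f 3F) ≡ b)

𝓑-degseqs : List (List ℕ)
𝓑-degseqs =
  (1 ∷ 1 ∷ 1 ∷ 1 ∷ 1 ∷ 1 ∷ []) ∷
  (2 ∷ 2 ∷ 1 ∷ 1 ∷ 1 ∷ 1 ∷ []) ∷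
  (2 ∷ 2 ∷ 2 ∷ 2 ∷ 1 ∷ 1 ∷ []) ∷
  (2 ∷ 2 ∷ 2 ∷ 2 ∷ 2 ∷ 2 ∷ []) ∷
  (3 ∷ 2 ∷ 2 ∷ 1 ∷ 1 ∷ 1 ∷ []) ∷
  (3 ∷ 2 ∷ 2 ∷ 2 ∷ 2 ∷ 1 ∷ []) ∷
  (3 ∷ 3 ∷ 2 ∷ 2 ∷ 1 ∷ 1 ∷ []) ∷
  (3 ∷ 3 ∷ 2 ∷ 2 ∷ 2 ∷ 2 ∷ []) ∷
  (3 ∷ 3 ∷ 3 ∷ 2 ∷ 2 ∷ 1 ∷ []) ∷
  (3 ∷ 3 ∷ 3 ∷ 3 ∷ 1 ∷ 1 ∷ []) ∷
  (3 ∷ 3 ∷ 3 ∷ 3 ∷ 2 ∷ 2 ∷ []) ∷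
  (3 ∷ 3 ∷ 3 ∷ 3 ∷ 3 ∷ 3 ∷ []) ∷
  (4 ∷ 2 ∷ 2 ∷ 2 ∷ 1 ∷ 1 ∷ []) ∷
  (4 ∷ 3 ∷ 2 ∷ 2 ∷ 2 ∷ 1 ∷ []) ∷
  (4 ∷ 3 ∷ 3 ∷ 2 ∷ 2 ∷ 2 ∷ []) ∷
  (4 ∷ 3 ∷ 3 ∷ 3 ∷ 2 ∷ 1 ∷ []) ∷
  (4 ∷ 3 ∷ 3 ∷ 3 ∷ 3 ∷ 2 ∷ []) ∷
  (4 ∷ 4 ∷ 2 ∷ 2 ∷ 2 ∷ 2 ∷ []) ∷
  (4 ∷ 4 ∷ 3 ∷ 3 ∷ 2 ∷ 2 ∷ []) ∷
  (4 ∷ 4 ∷ 3 ∷ 3 ∷ 3 ∷ 1 ∷ []) ∷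
  (4 ∷ 4 ∷ 3 ∷ 3 ∷ 3 ∷ 3 ∷ []) ∷
  (4 ∷ 4 ∷ 4 ∷ 3 ∷ 3 ∷ 2 ∷ []) ∷
  (4 ∷ 4 ∷ 4 ∷ 4 ∷ 3 ∷ 3 ∷ []) ∷
  (4 ∷ 4 ∷ 4 ∷ 4 ∷ 4 ∷ 4 ∷ []) ∷
  []

In𝓑 : Graph 6 → Set
In𝓑 H = IsSimple H × ∃[ L ] (L ∈ 𝓑-degseqs) × (map (deg H) (allFin 6) ↭ L)

InducedCopy : ∀ {n k} → Graph n → Graph k → Set
InducedCopy {n} {k} G H =
  Σ (Fin k → Fin n) λ g → Injective _≡_ _≡_ g × (∀ (a b : Fin k) → H a b ≡ G (g a) (g b))

𝓑-free : ∀ {n} → Graph n → Set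
𝓑-free G = ¬ (∃[ H ] In𝓑 H × InducedCopy G H)

fromRel : ∀ k → (ℕ → ℕ → Bool) → Graph k
fromRel k e i j = not (toℕ i ≡ᵇ toℕ j) ∧ (e (toℕ i) (toℕ j) ∨ e (toℕ j) (toℕ i))

-- U: triangle 0,1,2 and 4-cycle 0,3,4,5 sharing vertex 0
U : Graph 6
U = fromRel 6 e
  where
  e : ℕ → ℕ → Bool
  e 0 1 = true
  e 1 2 = true
  e 0 2 = true
  e 0 3 = true
  e 3 4 = true
  e 4 5 = true
  e 5 0 = true
  e _ _ = false

Ū : Graph 6
Ū i j = not (toℕ i ≡ᵇ toℕ j) ∧ not (U i j)

-- K₂ + K_{1,m}: edge 0–1, star with centre 2 and leaves 3,…,m+2
K₂+K₁ₘ : ∀ m → Graph (m ℕ.+ 3)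
K₂+K₁ₘ m = fromRel (m ℕ.+ 3) e
  where
  e : ℕ → ℕ → Bool
  e a b = ((a ≡ᵇ 0) ∧ (b ≡ᵇ 1)) ∨ ((a ≡ᵇ 2) ∧ (3 ≤ᵇ b))

-- (K_m + K₁) ∨ 2K₁: clique 0,…,m-1, isolated vertex m, and the two
-- non-adjacent vertices m+1, m+2 joined to all of 0,…,m
Kₘ+K₁∨2K₁ : ∀ m → Graph (m ℕ.+ 3)
Kₘ+K₁∨2K₁ m = fromRel (m ℕ.+ 3) e
  where
  e : ℕ → ℕ → Bool
  e a b = ((a <ᵇ m) ∧ (b <ᵇ m)) ∨ ((a ≤ᵇ m) ∧ (m <ᵇ b))

-- Partitions V₁,V₂,V₃ given by a labelling p : Fin n → Fin 3
-- (0F ↦ V₁, 1F ↦ V₂, 2F ↦ V₃); parts may be empty.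

InducedIso : ∀ {n k} → Graph n → (Fin n → Set) → Graph k → Set
InducedIso {n} {k} G S H =
  Σ (Fin k → Fin n) λ g → Injective _≡_ _≡_ g × (∀ a → S (g a)) × (∀ v → S v → ∃[ a ] g a ≡ v) ×
    (∀ (a b : Fin k) → H a b ≡ G (g a) (g b))

SplitOn : ∀ {n} → Graph n → (Fin n → Set) → Set
SplitOn {n} G S =
  Σ (Fin n → Bool) λ q → ∀ (u v : Fin n) → S u → S v → u ≢ v →
    ((q u ≡ false) → (q v ≡ false) → G u v ≡ false) ×
    ((q u ≡ true) → (q v ≡ true) → G u v ≡ true)

GoodPartition : ∀ {n} → Graph n → (Fin n → Fin 3) → Set
GoodPartition {n} G p =
  (∀ u v → p u ≡ 0F → p v ≡ 0F → G u v ≡ false) ×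
  (∀ u v → u ≢ v → p u ≡ 1F → p v ≡ 1F → G u v ≡ true) ×
  (∀ u v → p u ≡ 2F → p v ≡ 1F → G u v ≡ true) ×
  (∀ u v → p u ≡ 2F → p v ≡ 0F → G u v ≡ false) ×
  (SplitOn G V₃
   ⊎ length (filter (λ v → p v ≟ 2F) (allFin n)) ℕ.< 6
   ⊎ InducedIso G V₃ U
   ⊎ InducedIso G V₃ Ū
   ⊎ (∃[ m ] 3 ℕ.≤ m × InducedIso G V₃ (K₂+K₁ₘ m))
   ⊎ (∃[ m ] 3 ℕ.≤ m × InducedIso G V₃ (Kₘ+K₁∨2K₁ m)))
  where
  V₃ : Fin n → Set
  V₃ v = p v ≡ 2F

HasGoodPartition : ∀ {n} → Graph n → Set
HasGoodPartition {n} G = ∃[ p ] GoodPartition {n} G p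

{-# OPTIONS --safe #-}
-- The conditions are linked in a cycle.
--
-- Good partition ⇒ decisive.  Let x be a vertex of P(d) and F the graph of its fractional coordinates.
-- Any symmetric perturbation supported on F with zero row sums vanishes, so F has at most as many edges
-- as non-isolated vertices; as the degrees are integers no vertex has F-degree 1, hence F is 2-regular,
-- x = 1/2 on F and F has an even number of vertices.  Moreover a function π with π u + π v = 0 along F
-- vanishes on F, since one of the row equations would be redundant.  The equality case of the
-- Erdős–Gallai inequalities shows that x agrees with the given realization except on V₁ × V₂ and inside
-- V₃, and π = 1, -1, 0 on V₁, V₂, V₃ confines F to V₃.  A nonempty F then has six vertices forming two
-- triangles or too many vertices for a star, and degree sums exclude both.
--
-- Decisive ⇒ no blossom.  Put 1/2 on the two triangles of a blossom and flip the edge joining them.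
--
-- No blossom ⇒ 𝓑-free.  Every sequence defining 𝓑 is realized by a six-vertex graph with a blossom, which
-- can be substituted for an induced member of 𝓑.
--
-- 𝓑-free ⇒ good partition.  A graph that is not split contains an induced 2K₂, C₄ or C₅.  Adding vertices
-- that are adjacent to some but not all of the vertices collected so far, one stops at once or reaches
-- U, Ū, K₂ + K₁,₃ or the complement of the latter.  Every further vertex is uniform to U and Ū, while to
-- K₂ + K₁,₃ it is uniform or one more leaf.  The remaining vertices form V₁ and V₂.
module Submission where

open import Defs
open import Data.Bool using (Bool; true; false; not; _∧_; _∨_; if_then_else_)
import Data.Bool.Properties as Bool
open import Data.Nat as ℕ using (ℕ; zero; suc; z≤n; s≤s)
import Data.Nat.Properties as ℕ
open import Data.Integer as ℤ using (ℤ)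
import Data.Integer.Properties as ℤ
open import Data.Rational as ℚ using (ℚ; 0ℚ; 1ℚ; ½; _+_; _*_; _-_; -_; _≤_; _<_; _/_)
import Data.Rational.Properties as ℚ
import Data.Rational.Unnormalised as ℚᵘ
import Data.Rational.Unnormalised.Properties as ℚᵘ
open import Data.Rational.Solver using (module +-*-Solver)
open +-*-Solver using (solve; _:+_; _:*_; _:-_; :-_; _:=_; con)
open import Data.Fin.Patterns using (0F; 1F; 2F; 3F; 4F; 5F)
open import Data.Fin as Fin using (Fin; zero; suc; toℕ; _≟_)
import Data.Fin.Properties as Fin
open import Data.List as List using (List; []; _∷_; map; allFin; filter; length; foldr; tabulate)
import Data.List.Properties as List
open import Data.List.Membership.Propositional using (_∈_)
import Data.List.Membership.Propositional.Properties as List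
import Data.List.Membership.DecPropositional as DecMembership
open import Data.List.Relation.Unary.Any as Any using (here; there)
import Data.List.Relation.Unary.Any.Properties as Any
open import Data.List.Relation.Unary.All as All using (All; []; _∷_)
open import Data.List.Relation.Unary.AllPairs as AllPairs using ([]; _∷_)
open import Data.List.Relation.Binary.Permutation.Propositional using (_↭_; ↭-sym; ↭-trans; ↭⇒↭ₛ)
import Data.List.Relation.Binary.Permutation.Propositional.Properties as ↭
import Data.List.Relation.Binary.Permutation.Homogeneous as Homogeneous
import Data.List.Relation.Binary.Permutation.Setoid.Properties as PermutationSetoid
import Data.List.Sort.InsertionSort as InsertionSort
open import Data.List.Sort.Base using (module SortingAlgorithm)
import Relation.Binary.Construct.Flip.EqAndOrd as Flip
open import Data.Vec as Vec using (Vec; []; _∷_)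
import Data.Vec.Properties as Vec
open import Data.List.Relation.Unary.Unique.Propositional using (Unique)
import Data.List.Relation.Unary.Unique.Propositional.Properties as Unique
open import Data.Product using (Σ-syntax; ∃-syntax; _×_; _,_; proj₁; proj₂)
open import Data.Sum using (_⊎_; inj₁; inj₂; [_,_]′)
open import Data.Empty using (⊥; ⊥-elim)
open import Function using (_∘_; id; case_of_)
open import Function.Bundles using (Inverse; _⇔_; mk⇔)
open import Function.Definitions using (Injective)
open import Relation.Nullary.Decidable using (True; toWitness; map′; decidable-stable; _×-dec_; _→-dec_; _⊎-dec_; dec-true; dec-false)
open import Relation.Binary.Definitions using (Tri; tri<; tri≈; tri>)
open import Relation.Nullary using (¬_; ¬?; Dec; yes; no; does; contradiction)
open import Relation.Binary.PropositionalEquality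
  using (_≡_; _≢_; refl; sym; trans; cong; cong₂; subst; subst₂; setoid; module ≡-Reasoning)
open import Algebra.Bundles using (CommutativeRing)
open import Algebra.Properties.Semiring.Sum (CommutativeRing.semiring ℚ.+-*-commutativeRing)
  using (sum; sum-remove; *-distribˡ-sum; ∑-distrib-+; ∑-comm; sum-cong-≗; sum-replicate-zero)
open InsertionSort (Flip.decTotalOrder ℕ.≤-decTotalOrder) using (insertionSort)
open SortingAlgorithm insertionSort using (sort; sort-↭)

-- Sums of rationals and integrality

-- Conditions (3) and (4) concern one realization, (2) and (5) all of them. What carries the
-- structure from one realization to another is the polytope, which depends on `d` alone; hence the
-- detour through decisiveness even between purely combinatorial conditions. In terms of cycles,
-- every component of F is an odd cycle, because an even one would carry the potential 1, -1, 1, -1,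
-- ..., and parity makes the number of these cycles even. No theory of cycles is developed: a few
-- steps from one covered vertex already produce six covered vertices, and the exceptional graphs
-- leave no room for them. Since membership in 𝓑 depends on degrees only, an induced member can be
-- traded for any six-vertex graph with the same degrees without changing `d`. The list of sequences
-- is closed under complementation, so an induced C₄ is treated as an induced 2K₂ of the complement.

foldr-tabulate : ∀ {n m} (f : Fin m → ℚ) (g : Fin n → Fin m) →
  foldr _+_ 0ℚ (map f (tabulate g)) ≡ sum (f ∘ g)
foldr-tabulate {zero}  f g = refl
foldr-tabulate {suc n} f g = cong (f (g zero) +_) (foldr-tabulate f (g ∘ suc))

sumℚ≡sum : ∀ {n} (f : Fin n → ℚ) → sumℚ f ≡ sum f
sumℚ≡sum f = foldr-tabulate f id

sum-zero : ∀ {n} (f : Fin n → ℚ) → (∀ i → f i ≡ 0ℚ) → sum f ≡ 0ℚ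
sum-zero {n} f f≡0 = trans (sum-cong-≗ f≡0) (sum-replicate-zero n)

sum-neg : ∀ {n} (f : Fin n → ℚ) → sum (λ i → - f i) ≡ - sum f
sum-neg {zero}  f = refl
sum-neg {suc n} f = trans (cong (- f zero +_) (sum-neg (f ∘ suc))) (sym (ℚ.neg-distrib-+ (f zero) _))

sum-minus : ∀ {n} (f g : Fin n → ℚ) → sum (λ i → f i - g i) ≡ sum f - sum g
sum-minus f g = trans (∑-distrib-+ f (λ i → - g i)) (cong (sum f +_) (sum-neg g))

sum-mono : ∀ {n} {f g : Fin n → ℚ} → (∀ i → f i ≤ g i) → sum f ≤ sum g
sum-mono {zero}  f≤g = ℚ.≤-refl
sum-mono {suc n} f≤g = ℚ.+-mono-≤ (f≤g zero) (sum-mono (f≤g ∘ suc))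

sum-nonneg : ∀ {n} {f : Fin n → ℚ} → (∀ i → 0ℚ ≤ f i) → 0ℚ ≤ sum f
sum-nonneg {n} {f} 0≤f = subst (_≤ sum f) (sum-replicate-zero n) (sum-mono 0≤f)

≤-by : ∀ {p q} r → 0ℚ ≤ r → q ≡ p + r → p ≤ q
≤-by {p} r 0≤r refl = subst (_≤ p + r) (ℚ.+-identityʳ p) (ℚ.+-monoʳ-≤ p 0≤r)

0≤- : ∀ {p q} → p ≤ q → 0ℚ ≤ q - p
0≤- {p} {q} p≤q = subst (_≤ q - p) (ℚ.+-inverseʳ p) (ℚ.+-monoˡ-≤ (- p) p≤q)

nonneg-+-zero : ∀ {p q} → 0ℚ ≤ p → 0ℚ ≤ q → p + q ≡ 0ℚ → p ≡ 0ℚ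
nonneg-+-zero {p} {q} 0≤p 0≤q p+q≡0 = ℚ.≤-antisym (≤-by q 0≤q (sym p+q≡0)) 0≤p

sum-nonneg-zero : ∀ {n} {f : Fin n → ℚ} → (∀ i → 0ℚ ≤ f i) → sum f ≡ 0ℚ → ∀ i → f i ≡ 0ℚ
sum-nonneg-zero {suc n} {f} 0≤f s≡0 zero = nonneg-+-zero (0≤f zero) (sum-nonneg (0≤f ∘ suc)) s≡0
sum-nonneg-zero {suc n} {f} 0≤f s≡0 (suc i) = sum-nonneg-zero (0≤f ∘ suc)
  (nonneg-+-zero (sum-nonneg (0≤f ∘ suc)) (0≤f zero) (trans (ℚ.+-comm _ (f zero)) s≡0)) i

⟦_⟧ : Bool → ℚ
⟦ b ⟧ = if b then 1ℚ else 0ℚ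

⟦⟧-nonneg : ∀ b → 0ℚ ≤ ⟦ b ⟧
⟦⟧-nonneg true  = ℚ.nonNegative⁻¹ 1ℚ
⟦⟧-nonneg false = ℚ.≤-refl

⟦⟧≤1 : ∀ b → ⟦ b ⟧ ≤ 1ℚ
⟦⟧≤1 true  = ℚ.≤-refl
⟦⟧≤1 false = ℚ.nonNegative⁻¹ 1ℚ

[_≐_] : ∀ {n} → Fin n → Fin n → ℚ
[ i ≐ j ] = ⟦ does (i ≟ j) ⟧

≐-refl : ∀ {n} (i : Fin n) → [ i ≐ i ] ≡ 1ℚ
≐-refl i with i ≟ i
... | yes _  = refl
... | no i≢i = contradiction refl i≢i

≐-≢ : ∀ {n} {i j : Fin n} → i ≢ j → [ i ≐ j ] ≡ 0ℚ
≐-≢ {i = i} {j} i≢j with i ≟ j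
... | yes i≡j = contradiction i≡j i≢j
... | no _    = refl

sum-single : ∀ {n} (f : Fin n → ℚ) i → (∀ j → j ≢ i → f j ≡ 0ℚ) → sum f ≡ f i
sum-single {suc n} f zero f≡0 =
  trans (cong (f zero +_) (sum-zero (f ∘ suc) (λ j → f≡0 (suc j) (λ ())))) (ℚ.+-identityʳ _)
sum-single {suc n} f (suc i) f≡0 =
  trans (cong₂ _+_ (f≡0 zero (λ ())) (sum-single (f ∘ suc) i (λ j j≢i → f≡0 (suc j) (j≢i ∘ Fin.suc-injective))))
        (ℚ.+-identityˡ _)

sum-≐ : ∀ {n} (i : Fin n) → sum (λ j → [ j ≐ i ]) ≡ 1ℚ
sum-≐ i = trans (sum-single (λ j → [ j ≐ i ]) i (λ j → ≐-≢)) (≐-refl i)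

sum-≐-* : ∀ {n} (f : Fin n → ℚ) i → sum (λ j → [ j ≐ i ] * f j) ≡ f i
sum-≐-* f i = trans
  (sum-single (λ j → [ j ≐ i ] * f j) i (λ j j≢i → trans (cong (_* f j) (≐-≢ j≢i)) (ℚ.*-zeroˡ (f j))))
  (trans (cong (_* f i) (≐-refl i)) (ℚ.*-identityˡ (f i)))

-- Each value `f j` is expanded over the indices `a` with `g a ≡ j`, and the two sums are exchanged;
-- injectivity of `g` makes every image point count once.
sum-image : ∀ {k n} (g : Fin k → Fin n) → Injective _≡_ _≡_ g → (f : Fin n → ℚ) →
  (∀ j → (∀ a → g a ≢ j) → f j ≡ 0ℚ) → sum f ≡ sum (f ∘ g)
sum-image {k} g g-inj f f≡0 = begin
  sum f                                           ≡⟨ sum-cong-≗ at ⟩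
  sum (λ j → sum (λ a → [ j ≐ g a ] * f j))       ≡⟨ ∑-comm (λ j a → [ j ≐ g a ] * f j) ⟩
  sum (λ a → sum (λ j → [ j ≐ g a ] * f j))       ≡⟨ sum-cong-≗ (λ a → sum-≐-* f (g a)) ⟩
  sum (f ∘ g)                                     ∎
  where
  open ≡-Reasoning
  at : ∀ j → f j ≡ sum (λ a → [ j ≐ g a ] * f j)
  at j with Fin.any? (λ a → g a ≟ j)
  ... | yes (a , refl) = sym (trans
    (sum-single (λ b → [ g a ≐ g b ] * f (g a)) a
      (λ b b≢a → trans (cong (_* f (g a)) (≐-≢ (λ e → b≢a (g-inj (sym e))))) (ℚ.*-zeroˡ (f (g a)))))
    (trans (cong (_* f (g a)) (≐-refl (g a))) (ℚ.*-identityˡ _)))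
  ... | no ∄ = let fj≡0 = f≡0 j (λ a e → ∄ (a , e)) in
    trans fj≡0 (sym (sum-zero {k} _ (λ a → trans (cong ([ j ≐ g a ] *_) fj≡0) (ℚ.*-zeroʳ [ j ≐ g a ]))))

fromℤ : ℤ → ℚ
fromℤ z = z / 1

toℚᵘ-fromℤ : ∀ z → ℚ.toℚᵘ (fromℤ z) ℚᵘ.≃ ℚᵘ.mkℚᵘ z 0
toℚᵘ-fromℤ z = ℚ.toℚᵘ-fromℚᵘ (ℚᵘ.mkℚᵘ z 0)

fromℤ-+ : ∀ a b → fromℤ (a ℤ.+ b) ≡ fromℤ a + fromℤ b
fromℤ-+ a b = ℚ.toℚᵘ-injective (begin
  ℚ.toℚᵘ (fromℤ (a ℤ.+ b))                      ≈⟨ toℚᵘ-fromℤ (a ℤ.+ b) ⟩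
  ℚᵘ.mkℚᵘ (a ℤ.+ b) 0                           ≈⟨ ℚᵘ.*≡* (cong (ℤ._* (ℤ.+ 1)) (cong₂ ℤ._+_ (sym (ℤ.*-identityʳ a)) (sym (ℤ.*-identityʳ b)))) ⟩
  ℚᵘ.mkℚᵘ a 0 ℚᵘ.+ ℚᵘ.mkℚᵘ b 0                  ≈⟨ ℚᵘ.+-cong (toℚᵘ-fromℤ a) (toℚᵘ-fromℤ b) ⟨
  ℚ.toℚᵘ (fromℤ a) ℚᵘ.+ ℚ.toℚᵘ (fromℤ b)        ≈⟨ ℚ.toℚᵘ-homo-+ (fromℤ a) (fromℤ b) ⟨
  ℚ.toℚᵘ (fromℤ a + fromℤ b)                    ∎)
  where open ℚᵘ.≃-Reasoning

fromℤ-neg : ∀ a → fromℤ (ℤ.- a) ≡ - fromℤ a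
fromℤ-neg a = begin
  fromℤ (ℤ.- a)                        ≡⟨ solve 2 (λ x y → x := (x :+ y) :- y) refl (fromℤ (ℤ.- a)) (fromℤ a) ⟩
  (fromℤ (ℤ.- a) + fromℤ a) - fromℤ a  ≡⟨ cong (_- fromℤ a) (sym (fromℤ-+ (ℤ.- a) a)) ⟩
  fromℤ (ℤ.- a ℤ.+ a) - fromℤ a        ≡⟨ cong (λ z → fromℤ z - fromℤ a) (ℤ.+-inverseˡ a) ⟩
  0ℚ - fromℤ a                         ≡⟨ ℚ.+-identityˡ _ ⟩
  - fromℤ a                            ∎
  where open ≡-Reasoning

fromℤ-cancel-< : ∀ {a b} → fromℤ a < fromℤ b → a ℤ.< b
fromℤ-cancel-< {a} {b} a<b
  with ℚᵘ.<-respʳ-≃ (toℚᵘ-fromℤ b) (ℚᵘ.<-respˡ-≃ (toℚᵘ-fromℤ a) (ℚ.toℚᵘ-mono-< a<b))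
... | ℚᵘ.*<* a*1<b*1 = subst₂ ℤ._<_ (ℤ.*-identityʳ a) (ℤ.*-identityʳ b) a*1<b*1

Integral : ℚ → Set
Integral q = ∃[ z ] q ≡ fromℤ z

integral-0 : Integral 0ℚ
integral-0 = ℤ.+ 0 , refl

integral-1 : Integral 1ℚ
integral-1 = ℤ.+ 1 , refl

integral-+ : ∀ {p q} → Integral p → Integral q → Integral (p + q)
integral-+ (a , refl) (b , refl) = a ℤ.+ b , sym (fromℤ-+ a b)

integral-neg : ∀ {p} → Integral p → Integral (- p)
integral-neg (a , refl) = ℤ.- a , sym (fromℤ-neg a)

integral-sum : ∀ {n} {f : Fin n → ℚ} → (∀ i → Integral (f i)) → Integral (sum f)
integral-sum {zero}  h = integral-0
integral-sum {suc n} h = integral-+ (h zero) (integral-sum (h ∘ suc))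

-- Used with `a` equal to 0: two coordinates strictly between 0 and 1 with an integral sum add up to
-- 1.
integral-between : ∀ {q} a → Integral q → fromℤ a < q → q < fromℤ (a ℤ.+ ℤ.+ 2) → q ≡ fromℤ (a ℤ.+ ℤ.+ 1)
integral-between a (z , refl) a<q q<a+2 = cong fromℤ (ℤ.≤-antisym
  (subst (λ w → z ℤ.≤ w) (trans (cong ℤ.pred (shift a)) (ℤ.pred-suc (a ℤ.+ ℤ.+ 1))) (ℤ.i<j⇒i≤pred[j] (fromℤ-cancel-< {z} {a ℤ.+ ℤ.+ 2} q<a+2)))
  (subst (λ w → w ℤ.≤ z) (ℤ.+-comm (ℤ.+ 1) a) (ℤ.i<j⇒suc[i]≤j (fromℤ-cancel-< {a} {z} a<q))))
  where
  shift : ∀ a → a ℤ.+ ℤ.+ 2 ≡ ℤ.suc (a ℤ.+ ℤ.+ 1)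
  shift a = trans (refl) (trans (sym (ℤ.+-assoc a (ℤ.+ 1) (ℤ.+ 1))) (ℤ.+-comm (a ℤ.+ ℤ.+ 1) (ℤ.+ 1)))

integral-not-fraction : ∀ {q} → Integral q → 0ℚ < q → q < 1ℚ → ⊥
integral-not-fraction {q} (z , refl) 0<q q<1 = ℤ.<⇒≱ (fromℤ-cancel-< {z} {ℤ.+ 1} q<1)
  (ℤ.i<j⇒suc[i]≤j (fromℤ-cancel-< {ℤ.+ 0} {z} 0<q))

integral-⟦⟧ : ∀ b → Integral ⟦ b ⟧
integral-⟦⟧ true  = integral-1
integral-⟦⟧ false = integral-0

-- Gaussian elimination: the first row is used to eliminate a column in which it does not vanish.
kernel : ∀ k m (A : Fin k → Fin m → ℚ) → k ℕ.< m →
  (Σ[ c ∈ (Fin m → ℚ) ] (∃[ t ] c t ≢ 0ℚ) × (∀ i → sum (λ t → A i t * c t) ≡ 0ℚ))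
kernel zero (suc m) A _ = (λ _ → 1ℚ) , (zero , ℚ.1≢0) , λ ()
kernel (suc k) m A k<m with Fin.any? (λ t → ¬? (A zero t ℚ.≟ 0ℚ))
... | no ∄ = extend
  where
  extend : (Σ[ c ∈ (Fin m → ℚ) ] (∃[ t ] c t ≢ 0ℚ) × (∀ i → sum (λ t → A i t * c t) ≡ 0ℚ))
  extend = let c , nz , eq = kernel k m (A ∘ suc) (ℕ.<-trans (ℕ.n<1+n k) k<m) in
    c , nz , λ { zero → sum-zero (λ t → A zero t * c t) (λ t → trans (cong (_* c t) (A0≡0 t)) (ℚ.*-zeroˡ (c t))) ; (suc i) → eq i }
    where
    A0≡0 : ∀ t → A zero t ≡ 0ℚ
    A0≡0 t with A zero t ℚ.≟ 0ℚ
    ... | yes e = e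
    ... | no ne = contradiction (t , ne) ∄
kernel (suc k) (suc m) A (s≤s k<m) | yes (s , a≢0) = c , nonzero , equations
  where
  open ≡-Reasoning
  instance
    a-nonZero : ℚ.NonZero (A zero s)
    a-nonZero = ℚ.≢-nonZero a≢0
  r : ℚ
  r = ℚ.1/ A zero s
  col : Fin m → Fin (suc m)
  col = Fin.punchIn s
  A′ : Fin k → Fin m → ℚ
  A′ i t = A (suc i) (col t) - A (suc i) s * (r * A zero (col t))
  IH = kernel k m A′ k<m
  c′ = proj₁ IH
  S : ℚ
  S = sum (λ t → A zero (col t) * c′ t)
  c : Fin (suc m) → ℚ
  c t with s ≟ t
  ... | yes _ = - (r * S)
  ... | no s≢t = c′ (Fin.punchOut s≢t)
  c-s : c s ≡ - (r * S)
  c-s with s ≟ s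
  ... | yes _ = refl
  ... | no ne = contradiction refl ne
  c-col : ∀ t → c (col t) ≡ c′ t
  c-col t with s ≟ col t
  ... | yes e = contradiction (sym e) (Fin.punchInᵢ≢i s t)
  ... | no ne = cong c′ (trans (Fin.punchOut-cong s refl) (Fin.punchOut-punchIn s))
  nonzero : ∃[ t ] c t ≢ 0ℚ
  nonzero = let t , nz = proj₁ (proj₂ IH) in col t , λ e → nz (trans (sym (c-col t)) e)
  row : ∀ (f : Fin (suc m) → ℚ) → sum (λ t → f t * c t) ≡ f s * (- (r * S)) + sum (λ t → f (col t) * c′ t)
  row f = trans (sum-remove {i = s} (λ t → f t * c t))
    (cong₂ _+_ (cong (f s *_) c-s) (sum-cong-≗ (λ t → cong (f (col t) *_) (c-col t))))
  equations : ∀ i → sum (λ t → A i t * c t) ≡ 0ℚ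
  equations zero = begin
    sum (λ t → A zero t * c t)      ≡⟨ row (A zero) ⟩
    A zero s * (- (r * S)) + S      ≡⟨ solve 3 (λ a r S → a :* (:- (r :* S)) :+ S := S :- (a :* r) :* S) refl (A zero s) r S ⟩
    S - (A zero s * r) * S          ≡⟨ cong (λ z → S - z * S) (ℚ.*-inverseʳ (A zero s)) ⟩
    S - 1ℚ * S                      ≡⟨ solve 1 (λ S → S :- con 1ℚ :* S := con 0ℚ) refl S ⟩
    0ℚ                              ∎
  equations (suc i) = begin
    sum (λ t → A (suc i) t * c t)                    ≡⟨ row (A (suc i)) ⟩
    f s * (- (r * S)) + sum (λ t → f (col t) * c′ t) ≡⟨ cong (f s * (- (r * S)) +_) (sum-cong-≗ split) ⟩
    f s * (- (r * S)) + sum (λ t → A′ i t * c′ t + f s * r * (A zero (col t) * c′ t))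
      ≡⟨ cong (f s * (- (r * S)) +_) (∑-distrib-+ (λ t → A′ i t * c′ t) _) ⟩
    f s * (- (r * S)) + (sum (λ t → A′ i t * c′ t) + sum (λ t → f s * r * (A zero (col t) * c′ t)))
      ≡⟨ cong₂ (λ x y → f s * (- (r * S)) + (x + y)) (proj₂ (proj₂ IH) i) (sym (*-distribˡ-sum (f s * r) (λ t → A zero (col t) * c′ t))) ⟩
    f s * (- (r * S)) + (0ℚ + f s * r * S)
      ≡⟨ solve 3 (λ a r S → a :* (:- (r :* S)) :+ (con 0ℚ :+ a :* r :* S) := con 0ℚ) refl (f s) r S ⟩
    0ℚ ∎
    where
    f = A (suc i)
    split : ∀ t → f (col t) * c′ t ≡ A′ i t * c′ t + f s * r * (A zero (col t) * c′ t)
    split t = solve 5 (λ x c a r z → x :* c := (x :- a :* (r :* z)) :* c :+ a :* r :* (z :* c)) refl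
      (f (col t)) (c′ t) (f s) r (A zero (col t))

-- Perturbations and parity

sum-pair : ∀ {n} (f : Fin n → ℚ) {a b} → a ≢ b → (∀ j → j ≢ a → j ≢ b → f j ≡ 0ℚ) → sum f ≡ f a + f b
sum-pair f {a} {b} a≢b f≡0 = begin
  sum f                                                        ≡⟨ sum-cong-≗ at ⟩
  sum (λ j → [ j ≐ a ] * f j + [ j ≐ b ] * f j)                ≡⟨ ∑-distrib-+ (λ j → [ j ≐ a ] * f j) (λ j → [ j ≐ b ] * f j) ⟩
  sum (λ j → [ j ≐ a ] * f j) + sum (λ j → [ j ≐ b ] * f j)    ≡⟨ cong₂ _+_ (sum-≐-* f a) (sum-≐-* f b) ⟩
  f a + f b                                                    ∎
  where
  open ≡-Reasoning
  at : ∀ j → f j ≡ [ j ≐ a ] * f j + [ j ≐ b ] * f j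
  at j with j ≟ a | j ≟ b
  ... | yes refl | yes refl = contradiction refl a≢b
  ... | yes _ | no _ = solve 1 (λ x → x := con 1ℚ :* x :+ con 0ℚ :* x) refl (f j)
  ... | no _ | yes _ = solve 1 (λ x → x := con 0ℚ :* x :+ con 1ℚ :* x) refl (f j)
  ... | no j≢a | no j≢b = trans (f≡0 j j≢a j≢b) (solve 1 (λ x → con 0ℚ := con 0ℚ :* x :+ con 0ℚ :* x) refl (f j))

ℕtoℚ-suc : ∀ k → ℕtoℚ (suc k) ≡ 1ℚ + ℕtoℚ k
ℕtoℚ-suc k = fromℤ-+ (ℤ.+ 1) (ℤ.+ k)

ℕtoℚ-+ : ∀ k l → ℕtoℚ (k ℕ.+ l) ≡ ℕtoℚ k + ℕtoℚ l
ℕtoℚ-+ k l = fromℤ-+ (ℤ.+ k) (ℤ.+ l)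

ℕtoℚ-cancel-< : ∀ {k l} → ℕtoℚ k < ℕtoℚ l → k ℕ.< l
ℕtoℚ-cancel-< {k} {l} k<l = ℤ.drop‿+<+ (fromℤ-cancel-< {ℤ.+ k} {ℤ.+ l} k<l)

ℕtoℚ-mono-≤ : ∀ {k l} → k ℕ.≤ l → ℕtoℚ k ≤ ℕtoℚ l
ℕtoℚ-mono-≤ {k} {l} k≤l = ℚ.≮⇒≥ (λ l<k → ℕ.<⇒≱ (ℕtoℚ-cancel-< l<k) k≤l)

sum-one : ∀ m → sum {m} (λ _ → 1ℚ) ≡ ℕtoℚ m
sum-one zero    = refl
sum-one (suc m) = trans (cong (1ℚ +_) (sum-one m)) (sym (ℕtoℚ-suc m))

ℕtoℚ-bit : ∀ b k → ℕtoℚ ((if b then 1 else 0) ℕ.+ k) ≡ ⟦ b ⟧ + ℕtoℚ k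
ℕtoℚ-bit true  k = ℕtoℚ-suc k
ℕtoℚ-bit false k = sym (ℚ.+-identityˡ (ℕtoℚ k))

length-filter-∷ : ∀ {A : Set} {P : A → Set} (P? : ∀ x → Dec (P x)) x xs →
  length (filter P? (x ∷ xs)) ≡ (if does (P? x) then 1 else 0) ℕ.+ length (filter P? xs)
length-filter-∷ P? x xs with does (P? x)
... | true  = refl
... | false = refl

length-filter : ∀ {n} {P : Fin n → Set} (P? : ∀ i → Dec (P i)) →
  ℕtoℚ (length (filter P? (allFin n))) ≡ sum (λ i → ⟦ does (P? i) ⟧)
length-filter {n} P? = go id
  where
  go : ∀ {m} (g : Fin m → Fin n) → ℕtoℚ (length (filter P? (tabulate g))) ≡ sum (λ i → ⟦ does (P? (g i)) ⟧)
  go {zero} g = refl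
  go {suc m} g = trans (cong ℕtoℚ (length-filter-∷ P? (g zero) (tabulate (g ∘ suc))))
    (trans (ℕtoℚ-bit (does (P? (g zero))) (length (filter P? (tabulate (g ∘ suc))))) (cong (⟦ does (P? (g zero)) ⟧ +_) (go (g ∘ suc))))

ℕtoℚ-deg : ∀ {n} (G : Graph n) i → ℕtoℚ (deg G i) ≡ sum (λ j → ⟦ G i j ⟧)
ℕtoℚ-deg {n} G i = go id
  where
  degOn : List (Fin n) → ℕ
  degOn vs = foldr ℕ._+_ 0 (map (λ j → if G i j then 1 else 0) vs)
  go : ∀ {m} (g : Fin m → Fin n) → ℕtoℚ (degOn (tabulate g)) ≡ sum (λ j → ⟦ G i (g j) ⟧)
  go {zero} g = refl
  go {suc m} g = trans (ℕtoℚ-bit (G i (g zero)) (degOn (tabulate (g ∘ suc)))) (cong (⟦ G i (g zero) ⟧ +_) (go (g ∘ suc)))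

realization-row : ∀ {n} {d : Fin n → ℕ} {G} → Realization d G → ∀ j → sum (λ i → ⟦ G i j ⟧) ≡ ℕtoℚ (d j)
realization-row {G = G} ((G-sym , _) , deg≡d) j =
  trans (sum-cong-≗ (λ i → cong ⟦_⟧ (G-sym i j))) (trans (sym (ℕtoℚ-deg G j)) (cong ℕtoℚ (deg≡d j)))

p≡-p⇒p≡0 : ∀ p → p + p ≡ 0ℚ → p ≡ 0ℚ
p≡-p⇒p≡0 p eq = trans (solve 1 (λ p → p := con ½ :* (p :+ p)) refl p) (cong (½ *_) eq)

*-zero-cancelˡ : ∀ {p q} → p ≢ 0ℚ → p * q ≡ 0ℚ → q ≡ 0ℚ
*-zero-cancelˡ {p} {q} p≢0 pq≡0 = begin
  q                ≡⟨ ℚ.*-identityˡ q ⟨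
  1ℚ * q           ≡⟨ cong (_* q) (ℚ.*-inverseˡ p) ⟨
  ℚ.1/ p * p * q   ≡⟨ ℚ.*-assoc (ℚ.1/ p) p q ⟩
  ℚ.1/ p * (p * q) ≡⟨ cong (ℚ.1/ p *_) pq≡0 ⟩
  ℚ.1/ p * 0ℚ      ≡⟨ ℚ.*-zeroʳ (ℚ.1/ p) ⟩
  0ℚ               ∎
  where
  open ≡-Reasoning
  instance
    p-nonZero : ℚ.NonZero p
    p-nonZero = ℚ.≢-nonZero p≢0

-- "For all sufficiently small positive `e`". Finitely many such conditions share one step size,
-- which replaces a minimum over all coordinates.
Eventually : (ℚ → Set) → Set
Eventually P = ∃[ ε ] 0ℚ < ε × (∀ e → 0ℚ < e → e ≤ ε → P e)

eventually-× : ∀ {P Q} → Eventually P → Eventually Q → Eventually (λ e → P e × Q e)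
eventually-× (ε₁ , 0<ε₁ , P≤) (ε₂ , 0<ε₂ , Q≤) with ℚ.≤-total ε₁ ε₂
... | inj₁ ε₁≤ε₂ = ε₁ , 0<ε₁ , λ e 0<e e≤ → P≤ e 0<e e≤ , Q≤ e 0<e (ℚ.≤-trans e≤ ε₁≤ε₂)
... | inj₂ ε₂≤ε₁ = ε₂ , 0<ε₂ , λ e 0<e e≤ → P≤ e 0<e (ℚ.≤-trans e≤ ε₂≤ε₁) , Q≤ e 0<e e≤

eventually-∀ : ∀ {n} {P : Fin n → ℚ → Set} → (∀ i → Eventually (P i)) → Eventually (λ e → ∀ i → P i e)
eventually-∀ {zero}  h = 1ℚ , ℚ.positive⁻¹ 1ℚ , λ _ _ _ ()
eventually-∀ {suc n} h with eventually-× (h zero) (eventually-∀ (h ∘ suc))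
... | ε , 0<ε , P≤ = ε , 0<ε , λ { e 0<e e≤ zero → proj₁ (P≤ e 0<e e≤) ; e 0<e e≤ (suc i) → proj₂ (P≤ e 0<e e≤) i }

0<- : ∀ {p q} → p < q → 0ℚ < q - p
0<- {p} {q} p<q = subst (_< q - p) (ℚ.+-inverseʳ p) (ℚ.+-monoˡ-< (- p) p<q)

*-nonneg : ∀ {p q} → 0ℚ ≤ p → 0ℚ ≤ q → 0ℚ ≤ p * q
*-nonneg {p} {q} 0≤p 0≤q = subst (_≤ p * q) (ℚ.*-zeroˡ q) (ℚ.*-monoʳ-≤-nonNeg q {{ℚ.nonNegative 0≤q}} 0≤p)

*-pos : ∀ {p q} → 0ℚ < p → 0ℚ < q → 0ℚ < p * q
*-pos {p} {q} 0<p 0<q = subst (_< p * q) (ℚ.*-zeroˡ q) (ℚ.*-monoˡ-<-pos q {{ℚ.positive 0<q}} 0<p)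

eventually-nonneg : ∀ {a} b → 0ℚ < a → Eventually (λ e → 0ℚ ≤ a + e * b)
eventually-nonneg {a} b 0<a with 0ℚ ℚ.≤? b
... | yes 0≤b = 1ℚ , ℚ.positive⁻¹ 1ℚ , λ e 0<e _ →
  ℚ.+-mono-≤ {0ℚ} {a} {0ℚ} {e * b} (ℚ.<⇒≤ 0<a) (*-nonneg (ℚ.<⇒≤ 0<e) 0≤b)
-- For negative slope `b` the line `a + e * b` reaches zero at `e = a / (- b)`.
... | no 0≰b = a * ℚ.1/ c , *-pos 0<a (ℚ.positive⁻¹ (ℚ.1/ c) {{ℚ.1/pos⇒pos c}}) , below
  where
  c = - b
  instance
    c-pos : ℚ.Positive c
    c-pos = ℚ.positive (ℚ.neg-antimono-< (ℚ.≰⇒> 0≰b))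
    c-nonZero : ℚ.NonZero c
    c-nonZero = ℚ.pos⇒nonZero c
  below : ∀ e → 0ℚ < e → e ≤ a * ℚ.1/ c → 0ℚ ≤ a + e * b
  below e 0<e e≤ = subst (0ℚ ≤_) eq (0≤- (ℚ.*-monoʳ-≤-nonNeg c {{ℚ.pos⇒nonNeg c}} e≤))
    where
    eq : a * ℚ.1/ c * c - e * c ≡ a + e * b
    eq = trans (cong (_- e * c) (trans (ℚ.*-assoc a (ℚ.1/ c) c) (trans (cong (a *_) (ℚ.*-inverseˡ c)) (ℚ.*-identityʳ a))))
      (solve 3 (λ a e b → a :- e :* (:- b) := a :+ e :* b) refl a e b)

Symmetric : ∀ {n} → Point n → Set
Symmetric y = ∀ i j → y i j ≡ y j i

col : ∀ {n} → Point n → Fin n → ℚ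
col y v = sum (λ u → y u v)

sum-sum-transpose : ∀ {n} (y : Point n) → Symmetric y → (w : Fin n → ℚ) →
  sum (λ i → sum (λ j → w i * y i j)) ≡ sum (λ i → sum (λ j → w j * y i j))
sum-sum-transpose y y-sym w = trans (∑-comm (λ i j → w i * y i j))
  (sum-cong-≗ (λ j → sum-cong-≗ (λ i → cong (w i *_) (y-sym i j))))

weighted-rows-zero : ∀ {n} (y : Point n) (w : Fin n → ℚ) → (∀ i → w i * sum (y i) ≡ 0ℚ) →
  sum (λ i → sum (λ j → w i * y i j)) ≡ 0ℚ
weighted-rows-zero y w h = sum-zero (λ i → sum (λ j → w i * y i j))
  (λ i → trans (sym (*-distribˡ-sum (w i) (y i))) (h i))

Even : ℚ → Set
Even q = ∃[ r ] Integral r × q ≡ r + r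

-- The handshake lemma for integral matrices: by symmetry the first row and the first column
-- contribute equal amounts, and the diagonal contributes nothing.
even-sum-sum : ∀ {n} (y : Point n) → Symmetric y → (∀ i → y i i ≡ 0ℚ) → (∀ i j → Integral (y i j)) →
  Even (sum (λ i → sum (y i)))
even-sum-sum {zero} y _ _ _ = 0ℚ , integral-0 , refl
even-sum-sum {suc n} y y-sym y-diag y-int
  with even-sum-sum (λ i j → y (suc i) (suc j)) (λ i j → y-sym (suc i) (suc j)) (y-diag ∘ suc) (λ i j → y-int (suc i) (suc j))
... | r , r-int , eq = s + r , integral-+ (integral-sum (λ j → y-int zero (suc j))) r-int , (begin
  (y zero zero + s) + sum (λ i → y (suc i) zero + sum (λ j → y (suc i) (suc j)))
    ≡⟨ cong₂ (λ a b → (a + s) + b) (y-diag zero) (∑-distrib-+ (λ i → y (suc i) zero) (λ i → sum (λ j → y (suc i) (suc j)))) ⟩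
  (0ℚ + s) + (sum (λ i → y (suc i) zero) + sum (λ i → sum (λ j → y (suc i) (suc j))))
    ≡⟨ cong₂ (λ a b → (0ℚ + s) + (a + b)) (sum-cong-≗ (λ i → y-sym (suc i) zero)) eq ⟩
  (0ℚ + s) + (s + (r + r))
    ≡⟨ solve 2 (λ s r → (con 0ℚ :+ s) :+ (s :+ (r :+ r)) := (s :+ r) :+ (s :+ r)) refl s r ⟩
  (s + r) + (s + r) ∎)
  where
  open ≡-Reasoning
  s = sum (λ j → y zero (suc j))

even-difference : ∀ {p q} → Even p → Even (p - q) → Even q
even-difference {p} {q} (r , r-int , p≡) (s , s-int , p-q≡) = r - s , integral-+ r-int (integral-neg s-int) ,
  trans (solve 2 (λ p q → q := p :- (p :- q)) refl p q)
    (trans (cong₂ _-_ p≡ p-q≡) (solve 2 (λ r s → (r :+ r) :- (s :+ s) := (r :- s) :+ (r :- s)) refl r s))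

ℕtoℚ-suc-≰ : ∀ {k l} → ℕtoℚ k + 1ℚ ≡ ℕtoℚ l → ¬ (l ℕ.≤ k)
ℕtoℚ-suc-≰ {k} {l} eq l≤k = ℚ.<-irrefl refl (ℚ.<-≤-trans
  (subst₂ _<_ (ℚ.+-identityʳ (ℕtoℚ k)) eq (ℚ.+-monoʳ-< (ℕtoℚ k) (ℚ.positive⁻¹ 1ℚ))) (ℕtoℚ-mono-≤ l≤k))

-- Vertices of P(d) and their fractional coordinates

does-true : ∀ {P : Set} (P? : Dec P) → P → ⟦ does P? ⟧ ≡ 1ℚ
does-true P? p = cong ⟦_⟧ (dec-true P? p)

does-false : ∀ {P : Set} (P? : Dec P) → ¬ P → ⟦ does P? ⟧ ≡ 0ℚ
does-false P? ¬p = cong ⟦_⟧ (dec-false P? ¬p)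

unique-lookup-injective : ∀ {A : Set} {xs : List A} → Unique xs →
  ∀ {i j} → List.lookup xs i ≡ List.lookup xs j → i ≡ j
unique-lookup-injective (_ AllPairs.∷ _) {zero} {zero} _ = refl
unique-lookup-injective {xs = _ ∷ xs} (x∉xs AllPairs.∷ _) {zero} {suc j} e =
  contradiction e (All.lookup x∉xs (List.∈-lookup {xs = xs} j))
unique-lookup-injective {xs = _ ∷ xs} (x∉xs AllPairs.∷ _) {suc i} {zero} e =
  contradiction (sym e) (All.lookup x∉xs (List.∈-lookup {xs = xs} i))
unique-lookup-injective (_ AllPairs.∷ xs!) {suc i} {suc j} e = cong suc (unique-lookup-injective xs! e)

-- Records instead of the bare predicates, which every case distinction would unfold.
record VertexOf {n} (d : Fin n → ℕ) (x : Point n) : Set where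
  constructor vertexOf
  field
    isVertex : IsVertex d x

record Realizes {n} (d : Fin n → ℕ) (G : Graph n) : Set where
  constructor realizes
  field
    isRealization : Realization d G

module Vertex {n} {d : Fin n → ℕ} {G : Graph n} (real : Realizes d G) {x : Point n} (vertex : VertexOf d x) where
  open VertexOf vertex
  open Realizes real

  x-sym : Symmetric x
  x-sym = proj₁ (proj₁ isVertex)

  x-diag : ∀ i → x i i ≡ 0ℚ
  x-diag = proj₁ (proj₂ (proj₁ isVertex))

  x-row : ∀ j → col x j ≡ ℕtoℚ (d j)
  x-row j = trans (sym (sumℚ≡sum (λ u → x u j))) (proj₁ (proj₂ (proj₂ (proj₁ isVertex))) j)

  x-bounds : ∀ i j → (0ℚ ≤ x i j) × (x i j ≤ 1ℚ)
  x-bounds i j with i ≟ j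
  ... | yes refl = subst (λ q → (0ℚ ≤ q) × (q ≤ 1ℚ)) (sym (x-diag i)) (ℚ.≤-refl , ℚ.nonNegative⁻¹ 1ℚ)
  ... | no i≢j   = proj₂ (proj₂ (proj₂ (proj₁ isVertex))) i j i≢j

  Frac : Fin n → Fin n → Set
  Frac u v = 0ℚ < x u v × x u v < 1ℚ

  abstract
    frac? : ∀ u v → Dec (Frac u v)
    frac? u v = (0ℚ ℚ.<? x u v) ×-dec (x u v ℚ.<? 1ℚ)

  frac-sym : ∀ {u v} → Frac u v → Frac v u
  frac-sym {u} {v} = subst (λ q → 0ℚ < q × q < 1ℚ) (x-sym u v)

  frac-≢ : ∀ {u v} → Frac u v → u ≢ v
  frac-≢ {u} (0<x , _) refl = ℚ.<-irrefl (sym (x-diag u)) 0<x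

  not-frac : ∀ {u v} → ¬ Frac u v → (x u v ≡ 0ℚ) ⊎ (x u v ≡ 1ℚ)
  not-frac {u} {v} ¬f with 0ℚ ℚ.<? x u v | x u v ℚ.<? 1ℚ
  ... | no 0≮x  | _ = inj₁ (ℚ.≤-antisym (ℚ.≮⇒≥ 0≮x) (proj₁ (x-bounds u v)))
  ... | yes 0<x | no x≮1  = inj₂ (ℚ.≤-antisym (proj₂ (x-bounds u v)) (ℚ.≮⇒≥ x≮1))
  ... | yes 0<x | yes x<1 = contradiction (0<x , x<1) ¬f

  not-frac-integral : ∀ {u v} → ¬ Frac u v → Integral (x u v)
  not-frac-integral ¬f with not-frac ¬f
  ... | inj₁ eq = subst Integral (sym eq) integral-0
  ... | inj₂ eq = subst Integral (sym eq) integral-1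

  Perturbation : Point n → Set
  Perturbation δ = Symmetric δ × (∀ u v → ¬ Frac u v → δ u v ≡ 0ℚ)

  module _ (δ : Point n) (pert : Perturbation δ) (rows : ∀ v → col δ v ≡ 0ℚ) (e : ℚ)
    (bounds : ∀ u v → Frac u v → (0ℚ ≤ x u v + e * δ u v) × (0ℚ ≤ (1ℚ - x u v) + e * - δ u v)) where

    move-inP : InP d (λ u v → x u v + e * δ u v)
    move-inP = (λ u v → cong₂ (λ a b → a + e * b) (x-sym u v) (proj₁ pert u v))
      , (λ u → trans (cong₂ (λ a b → a + e * b) (x-diag u) (δ≡0 u u (λ f → frac-≢ f refl))) (solve 1 (λ e → con 0ℚ :+ e :* con 0ℚ := con 0ℚ) refl e))
      , (λ v → trans (sumℚ≡sum (λ u → x u v + e * δ u v)) (trans (∑-distrib-+ (λ u → x u v) (λ u → e * δ u v))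
          (trans (cong₂ _+_ (x-row v) (trans (sym (*-distribˡ-sum e (λ u → δ u v))) (trans (cong (e *_) (rows v)) (ℚ.*-zeroʳ e)))) (ℚ.+-identityʳ _))))
      , λ u v _ → within u v
      where
      δ≡0 = proj₂ pert
      within : ∀ u v → (0ℚ ≤ x u v + e * δ u v) × (x u v + e * δ u v ≤ 1ℚ)
      within u v with frac? u v
      ... | yes f = proj₁ (bounds u v f) , ≤-by _ (proj₂ (bounds u v f))
        (solve 3 (λ x e y → con 1ℚ := (x :+ e :* y) :+ ((con 1ℚ :- x) :+ e :* (:- y))) refl (x u v) e (δ u v))
      ... | no ¬f = subst (λ q → (0ℚ ≤ q) × (q ≤ 1ℚ))
        (sym (trans (cong (λ q → x u v + e * q) (δ≡0 u v ¬f)) (solve 2 (λ x e → x :+ e :* con 0ℚ := x) refl (x u v) e)))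
        (x-bounds u v)

  -- For small `ε` both `x + ε δ` and `x - ε δ` stay in P(d), because only coordinates strictly
  -- between the bounds move. As `x` is their midpoint and a vertex, they coincide, so `2 ε δ` is
  -- zero.
  rigid : ∀ δ → Perturbation δ → (∀ v → col δ v ≡ 0ℚ) → ∀ u v → δ u v ≡ 0ℚ
  rigid δ pert rows u v = *-zero-cancelˡ (λ e≡0 → ℚ.<-irrefl (sym e≡0) 0<ε) (p≡-p⇒p≡0 (ε * δ u v)
    (trans (solve 3 (λ x e y → e :* y :+ e :* y := (x :+ e :* y) :- (x :+ e :* (:- y))) refl (x u v) ε (δ u v))
      (trans (cong (_- (x u v + ε * - δ u v)) equal) (ℚ.+-inverseʳ (x u v + ε * - δ u v)))))
    where
    Bounds : Fin n → Fin n → ℚ → Set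
    Bounds u v e = Frac u v → ((0ℚ ≤ x u v + e * δ u v) × (0ℚ ≤ (1ℚ - x u v) + e * - δ u v))
      × ((0ℚ ≤ x u v + e * - δ u v) × (0ℚ ≤ (1ℚ - x u v) + e * δ u v))
    eventually : ∀ u v → Eventually (Bounds u v)
    eventually u v with frac? u v
    ... | no ¬f = 1ℚ , ℚ.positive⁻¹ 1ℚ , λ _ _ _ f → contradiction f ¬f
    ... | yes (0<x , x<1) =
      let ε , 0<ε , h = eventually-× (eventually-× (eventually-nonneg (δ u v) 0<x) (eventually-nonneg (- δ u v) (0<- x<1)))
                                     (eventually-× (eventually-nonneg (- δ u v) 0<x) (eventually-nonneg (δ u v) (0<- x<1)))
      in ε , 0<ε , λ e 0<e e≤ _ → h e 0<e e≤
    small = eventually-∀ {P = λ u e → ∀ v → Bounds u v e} (λ u → eventually-∀ (eventually u))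
    ε = proj₁ small
    0<ε = proj₁ (proj₂ small)
    bounds = proj₂ (proj₂ small) ε 0<ε ℚ.≤-refl
    equal : x u v + ε * δ u v ≡ x u v + ε * - δ u v
    equal = proj₂ isVertex (λ u v → x u v + ε * δ u v) (λ u v → x u v + ε * - δ u v) ½
      (move-inP δ pert rows ε (λ u v f → proj₁ (bounds u v f)))
      (move-inP (λ u v → - δ u v)
        ((λ u v → cong -_ (proj₁ pert u v)) , λ u v ¬f → cong -_ (proj₂ pert u v ¬f))
        (λ v → trans (sum-neg (λ u → δ u v)) (cong -_ (rows v))) ε
        (λ u v f → let a , b = proj₂ (bounds u v f) in
          a , subst (λ q → 0ℚ ≤ (1ℚ - x u v) + ε * q) (solve 1 (λ y → y := :- (:- y)) refl (δ u v)) b))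
      (ℚ.positive⁻¹ ½) (ℚ.*<* (ℤ.+<+ (s≤s (s≤s z≤n))))
      (λ i j → solve 3 (λ x e y → x := con ½ :* (x :+ e :* y) :+ (con 1ℚ :- con ½) :* (x :+ e :* (:- y))) refl (x i j) ε (δ i j))
      u v

  ⟦F⟧ : Point n
  ⟦F⟧ u v = ⟦ does (frac? u v) ⟧

  ⟦F⟧-sym : Symmetric ⟦F⟧
  ⟦F⟧-sym u v with frac? u v
  ... | yes f = sym (does-true (frac? v u) (frac-sym f))
  ... | no ¬f = sym (does-false (frac? v u) (λ f → ¬f (frac-sym f)))

  fdeg : Fin n → ℚ
  fdeg v = col ⟦F⟧ v

  Covered : Fin n → Set
  Covered v = ∃[ u ] Frac u v

  abstract
    covered? : ∀ v → Dec (Covered v)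
    covered? v = Fin.any? (λ u → frac? u v)

  ⟦W⟧ : Fin n → ℚ
  ⟦W⟧ v = ⟦ does (covered? v) ⟧

  uncovered-row : ∀ {δ} → Perturbation δ → ∀ {v} → ¬ Covered v → col δ v ≡ 0ℚ
  uncovered-row {δ} pert {v} ¬w = sum-zero (λ u → δ u v) (λ u → proj₂ pert u v (λ f → ¬w (u , f)))

  OrderedFrac : Fin n × Fin n → Set
  OrderedFrac (u , v) = u Fin.< v × Frac u v

  orderedFrac? : ∀ p → Dec (OrderedFrac p)
  orderedFrac? (u , v) = (u Fin.<? v) ×-dec frac? u v

  edges : List (Fin n × Fin n)
  edges = filter orderedFrac? (List.cartesianProduct (allFin n) (allFin n))

  m : ℕ
  m = length edges

  edge : Fin m → Fin n × Fin n
  edge = List.lookup edges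

  edge-frac : ∀ t → OrderedFrac (edge t)
  edge-frac t = proj₂ (List.∈-filter⁻ orderedFrac? {xs = List.cartesianProduct (allFin n) (allFin n)} (List.∈-lookup {xs = edges} t))

  edge-surjective : ∀ {u v} → u Fin.< v → Frac u v → ∃[ t ] edge t ≡ (u , v)
  edge-surjective {u} {v} u<v f = Any.index mem , sym (Any.lookup-index mem)
    where
    mem : (u , v) ∈ edges
    mem = List.∈-filter⁺ orderedFrac? (List.∈-cartesianProduct⁺ (List.∈-allFin u) (List.∈-allFin v)) (u<v , f)

  edge-injective : ∀ {s t} → edge s ≡ edge t → s ≡ t
  edge-injective = unique-lookup-injective (Unique.filter⁺ orderedFrac? (Unique.cartesianProduct⁺ (Unique.allFin⁺ n) (Unique.allFin⁺ n)))

  -- The adjacency matrix of the single edge `ab`. Perturbations are sought as combinations of these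
  -- matrices over the edges of F.
  pairPoint : Fin n × Fin n → Point n
  pairPoint (a , b) u v = [ u ≐ a ] * [ v ≐ b ] + [ u ≐ b ] * [ v ≐ a ]

  pairPoint-sym : ∀ p → Symmetric (pairPoint p)
  pairPoint-sym (a , b) u v = solve 4 (λ ua ub va vb → ua :* vb :+ ub :* va := va :* ub :+ vb :* ua) refl
    [ u ≐ a ] [ u ≐ b ] [ v ≐ a ] [ v ≐ b ]

  pairPoint-at : ∀ {a b} → a ≢ b → pairPoint (a , b) a b ≡ 1ℚ
  pairPoint-at {a} {b} a≢b = trans
    (cong₂ _+_ (cong₂ _*_ (≐-refl a) (≐-refl b)) (cong₂ _*_ (≐-≢ a≢b) (≐-≢ (λ e → a≢b (sym e))))) refl

  pairPoint-zero : ∀ {a b u v} → ¬ (u ≡ a × v ≡ b) → ¬ (u ≡ b × v ≡ a) → pairPoint (a , b) u v ≡ 0ℚ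
  pairPoint-zero {a} {b} {u} {v} ¬1 ¬2 = cong₂ _+_ (product ¬1) (product ¬2)
    where
    product : ∀ {a b} → ¬ (u ≡ a × v ≡ b) → [ u ≐ a ] * [ v ≐ b ] ≡ 0ℚ
    product {a} {b} ¬p with u ≟ a | v ≟ b
    ... | yes p | yes q = contradiction (p , q) ¬p
    ... | yes p | no q  = refl
    ... | no p  | yes q = refl
    ... | no p  | no q  = refl

  pairPoint-row : ∀ a b v → sum (λ u → pairPoint (a , b) u v) ≡ [ v ≐ a ] + [ v ≐ b ]
  pairPoint-row a b v = begin
    sum (λ u → [ u ≐ a ] * [ v ≐ b ] + [ u ≐ b ] * [ v ≐ a ])
      ≡⟨ ∑-distrib-+ (λ u → [ u ≐ a ] * [ v ≐ b ]) (λ u → [ u ≐ b ] * [ v ≐ a ]) ⟩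
    sum (λ u → [ u ≐ a ] * [ v ≐ b ]) + sum (λ u → [ u ≐ b ] * [ v ≐ a ])
      ≡⟨ cong₂ _+_ (sum-≐-* (λ _ → [ v ≐ b ]) a) (sum-≐-* (λ _ → [ v ≐ a ]) b) ⟩
    [ v ≐ b ] + [ v ≐ a ]
      ≡⟨ ℚ.+-comm [ v ≐ b ] [ v ≐ a ] ⟩
    [ v ≐ a ] + [ v ≐ b ] ∎
    where open ≡-Reasoning

  edge-support : ∀ t {u v} → ¬ Frac u v → pairPoint (edge t) u v ≡ 0ℚ
  edge-support t {u} {v} ¬f = pairPoint-zero {proj₁ (edge t)} {proj₂ (edge t)} {u} {v}
    (λ { (refl , refl) → ¬f (proj₂ (edge-frac t)) })
    (λ { (refl , refl) → ¬f (frac-sym (proj₂ (edge-frac t))) })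

  edge-disjoint : ∀ s t → s ≢ t → pairPoint (edge s) (proj₁ (edge t)) (proj₂ (edge t)) ≡ 0ℚ
  edge-disjoint s t s≢t = pairPoint-zero {proj₁ (edge s)} {proj₂ (edge s)} {proj₁ (edge t)} {proj₂ (edge t)}
    (λ { (e₁ , e₂) → s≢t (sym (edge-injective (cong₂ _,_ e₁ e₂))) })
    (λ { (e₁ , e₂) → ℕ.<-asym (proj₁ (edge-frac t)) (subst₂ Fin._<_ (sym e₂) (sym e₁) (proj₁ (edge-frac s))) })

  VanishesOn : Point n → List (Fin n) → Set
  VanishesOn δ R = ∀ {v} → v ∈ R → col δ v ≡ 0ℚ

  -- There is one unknown per edge of F and one equation per entry of `R`, hence more unknowns than
  -- equations. The edge matrices have disjoint supports, so a nonzero coefficient survives as a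
  -- nonzero coordinate.
  perturbation-exists : (R : List (Fin n)) → length R ℕ.< m →
    Σ[ δ ∈ Point n ] Perturbation δ × VanishesOn δ R × ¬ (∀ u v → δ u v ≡ 0ℚ)
  perturbation-exists R R<m = δ , (δ-sym , δ-support) , δ-rows , δ≢0
    where
    rows : Fin (length R) → Fin m → ℚ
    rows i t = sum (λ u → pairPoint (edge t) u (List.lookup R i))
    ker = kernel (length R) m rows R<m
    c = proj₁ ker
    δ : Point n
    δ u v = sum (λ t → c t * pairPoint (edge t) u v)
    δ-sym : Symmetric δ
    δ-sym u v = sum-cong-≗ (λ t → cong (c t *_) (pairPoint-sym (edge t) u v))
    δ-support : ∀ u v → ¬ Frac u v → δ u v ≡ 0ℚ
    δ-support u v ¬f = sum-zero (λ t → c t * pairPoint (edge t) u v)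
      (λ t → trans (cong (c t *_) (edge-support t ¬f)) (ℚ.*-zeroʳ (c t)))
    δ-row : ∀ v → col δ v ≡ sum (λ t → sum (λ u → pairPoint (edge t) u v) * c t)
    δ-row v = trans (∑-comm (λ u t → c t * pairPoint (edge t) u v))
      (sum-cong-≗ (λ t → trans (sym (*-distribˡ-sum (c t) (λ u → pairPoint (edge t) u v))) (ℚ.*-comm (c t) _)))
    δ-rows : ∀ {v} → v ∈ R → col δ v ≡ 0ℚ
    δ-rows {v} v∈R = trans (δ-row v) (trans
      (cong (λ w → sum (λ t → sum (λ u → pairPoint (edge t) u w) * c t)) (Any.lookup-index v∈R))
      (proj₂ (proj₂ ker) (Any.index v∈R)))
    δ≢0 : ¬ (∀ u v → δ u v ≡ 0ℚ)
    δ≢0 h = let t , ct≢0 = proj₁ (proj₂ ker) ; a , b = edge t in ct≢0 (begin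
      c t                                 ≡⟨ ℚ.*-identityʳ (c t) ⟨
      c t * 1ℚ                            ≡⟨ cong (c t *_) (pairPoint-at (frac-≢ (proj₂ (edge-frac t)))) ⟨
      c t * pairPoint (edge t) a b
        ≡⟨ sum-single (λ s → c s * pairPoint (edge s) a b) t
             (λ s s≢t → trans (cong (c s *_) (edge-disjoint s t s≢t)) (ℚ.*-zeroʳ (c s))) ⟨
      δ a b                               ≡⟨ h a b ⟩
      0ℚ                                  ∎)
      where open ≡-Reasoning

  single-edge : ∀ {u v} → u Fin.< v → Frac u v → sum (λ t → pairPoint (edge t) u v) ≡ 1ℚ
  single-edge {u} {v} u<v f with edge-surjective u<v f
  ... | t , e rewrite cong proj₁ (sym e) | cong proj₂ (sym e) =
    trans (sum-single (λ s → pairPoint (edge s) (proj₁ (edge t)) (proj₂ (edge t))) t (λ s s≢t → edge-disjoint s t s≢t))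
      (pairPoint-at (frac-≢ (proj₂ (edge-frac t))))

  ⟦F⟧-edges : ∀ u v → ⟦F⟧ u v ≡ sum (λ t → pairPoint (edge t) u v)
  ⟦F⟧-edges u v with frac? u v | Fin.<-cmp u v
  ... | no ¬f | _ = sym (sum-zero (λ t → pairPoint (edge t) u v) (λ t → edge-support t ¬f))
  ... | yes f | tri≈ _ u≡v _ = contradiction u≡v (frac-≢ f)
  ... | yes f | tri< u<v _ _ = sym (single-edge u<v f)
  ... | yes f | tri> _ _ v<u = sym (trans (sum-cong-≗ (λ t → pairPoint-sym (edge t) u v)) (single-edge v<u (frac-sym f)))

  sum-fdeg : sum fdeg ≡ ℕtoℚ m + ℕtoℚ m
  sum-fdeg = begin
    sum (λ v → col ⟦F⟧ v)
      ≡⟨ sum-cong-≗ (λ v → sum-cong-≗ (λ u → ⟦F⟧-edges u v)) ⟩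
    sum (λ v → sum (λ u → sum (λ t → pairPoint (edge t) u v)))
      ≡⟨ sum-cong-≗ (λ v → ∑-comm (λ u t → pairPoint (edge t) u v)) ⟩
    sum (λ v → sum (λ t → sum (λ u → pairPoint (edge t) u v)))
      ≡⟨ ∑-comm (λ v t → sum (λ u → pairPoint (edge t) u v)) ⟩
    sum (λ t → sum (λ v → sum (λ u → pairPoint (edge t) u v)))
      ≡⟨ sum-cong-≗ two ⟩
    sum {m} (λ t → 1ℚ + 1ℚ)
      ≡⟨ ∑-distrib-+ {m} (λ _ → 1ℚ) (λ _ → 1ℚ) ⟩
    sum {m} (λ t → 1ℚ) + sum {m} (λ t → 1ℚ)
      ≡⟨ cong₂ _+_ (sum-one m) (sum-one m) ⟩
    ℕtoℚ m + ℕtoℚ m ∎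
    where
    open ≡-Reasoning
    two : ∀ t → sum (λ v → sum (λ u → pairPoint (edge t) u v)) ≡ 1ℚ + 1ℚ
    two t = let a , b = edge t in trans (sum-cong-≗ (pairPoint-row a b))
      (trans (∑-distrib-+ (λ v → [ v ≐ a ]) (λ v → [ v ≐ b ])) (cong₂ _+_ (sum-≐ a) (sum-≐ b)))

  W-vertices : List (Fin n)
  W-vertices = filter covered? (allFin n)

  -- Otherwise some nonzero perturbation vanishes on the rows in `R`, hence on all rows, against
  -- `rigid`. It is applied to all covered vertices and, for potentials, to all but one of them.
  rows-determine : ∀ {R} → (∀ {δ} → Perturbation δ → VanishesOn δ R → ∀ v → col δ v ≡ 0ℚ) →
    m ℕ.≤ length R
  rows-determine {R} all-rows = ℕ.≮⇒≥ (λ R<m → absurd (perturbation-exists R R<m))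
    where
    absurd : ¬ (Σ[ δ ∈ Point n ] Perturbation δ × VanishesOn δ R × ¬ (∀ u v → δ u v ≡ 0ℚ))
    absurd (δ , pert , rows , δ≢0) = δ≢0 (rigid δ pert (all-rows pert rows))

  m≤W : m ℕ.≤ length W-vertices
  m≤W = rows-determine all-rows
    where
    all-rows : ∀ {δ} → Perturbation δ → VanishesOn δ W-vertices → ∀ v → col δ v ≡ 0ℚ
    all-rows pert rows v with covered? v
    ... | yes w = rows (List.∈-filter⁺ covered? (List.∈-allFin v) w)
    ... | no ¬w = uncovered-row pert ¬w

  fracSum : Fin n → ℚ
  fracSum v = sum (λ u → ⟦F⟧ u v * x u v)

  -- The row sum `d v` is an integer and the coordinates outside F are 0 or 1, so the fractional
  -- ones have an integral sum.
  fracSum-integral : ∀ v → Integral (fracSum v)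
  fracSum-integral v = subst Integral eq (integral-+ (ℤ.+ d v , x-row v) (integral-neg (integral-sum int)))
    where
    int : ∀ u → Integral (x u v - ⟦F⟧ u v * x u v)
    int u with frac? u v
    ... | yes _ = subst Integral (solve 1 (λ x → con 0ℚ := x :- con 1ℚ :* x) refl (x u v)) integral-0
    ... | no ¬f = subst Integral (solve 1 (λ x → x := x :- con 0ℚ :* x) refl (x u v)) (not-frac-integral ¬f)
    eq : col x v - sum (λ u → x u v - ⟦F⟧ u v * x u v) ≡ fracSum v
    eq = trans (cong (λ q → col x v - q) (sum-minus (λ u → x u v) (λ u → ⟦F⟧ u v * x u v)))
      (solve 2 (λ a b → a :- (a :- b) := b) refl (col x v) (fracSum v))

  -- A single fractional coordinate in a row would itself be an integer.
  second-neighbour : ∀ {u v} → Frac u v → ∃[ w ] w ≢ u × Frac w v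
  second-neighbour {u} {v} f with Fin.any? (λ w → ¬? (w ≟ u) ×-dec frac? w v)
  ... | yes r = r
  ... | no ∄ = ⊥-elim (integral-not-fraction (subst Integral single (fracSum-integral v)) (proj₁ f) (proj₂ f))
    where
    single : fracSum v ≡ x u v
    single = trans
      (sum-single (λ w → ⟦F⟧ w v * x w v) u (λ w w≢u →
        trans (cong (_* x w v) (does-false (frac? w v) (λ g → ∄ (w , w≢u , g)))) (ℚ.*-zeroˡ (x w v))))
      (trans (cong (_* x u v) (does-true (frac? u v) f)) (ℚ.*-identityˡ (x u v)))

  two≤fdeg : ∀ {v a b} → a ≢ b → Frac a v → Frac b v → ∀ (z : Fin n → ℚ) → (∀ u → u ≢ a → u ≢ b → z u ≤ ⟦F⟧ u v) →
    z a ≡ 1ℚ → z b ≡ 1ℚ → sum z ≤ fdeg v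
  two≤fdeg {v} {a} {b} a≢b fa fb z z≤ za zb = sum-mono at
    where
    at : ∀ u → z u ≤ ⟦F⟧ u v
    at u with u ≟ a | u ≟ b
    ... | yes refl | _ = ℚ.≤-reflexive (trans za (sym (does-true (frac? u v) fa)))
    ... | no _ | yes refl = ℚ.≤-reflexive (trans zb (sym (does-true (frac? u v) fb)))
    ... | no u≢a | no u≢b = z≤ u u≢a u≢b

  fdeg-lower : ∀ v → ⟦W⟧ v + ⟦W⟧ v ≤ fdeg v
  fdeg-lower v with covered? v
  ... | no _ = sum-nonneg (λ u → ⟦⟧-nonneg (does (frac? u v)))
  ... | yes (a , fa) with second-neighbour fa
  ...   | b , b≢a , fb = subst (_≤ fdeg v)
    (trans (∑-distrib-+ (λ u → [ u ≐ a ]) (λ u → [ u ≐ b ])) (cong₂ _+_ (sum-≐ a) (sum-≐ b)))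
    (two≤fdeg (λ e → b≢a (sym e)) fa fb (λ u → [ u ≐ a ] + [ u ≐ b ])
      (λ u u≢a u≢b → subst (_≤ ⟦F⟧ u v) (sym (cong₂ _+_ (≐-≢ u≢a) (≐-≢ u≢b))) (⟦⟧-nonneg (does (frac? u v))))
      (cong₂ _+_ (≐-refl a) (≐-≢ (λ e → b≢a (sym e))))
      (cong₂ _+_ (≐-≢ b≢a) (≐-refl b)))

  -- Double counting: the F-degrees add up to `2 m`, which is at most twice the number of covered
  -- vertices, while each covered vertex has degree at least two. The excesses are nonnegative with
  -- sum at most zero, so all of them vanish.
  fdeg-W : ∀ v → fdeg v ≡ ⟦W⟧ v + ⟦W⟧ v
  fdeg-W v = trans (solve 2 (λ a b → a := (a :- b) :+ b) refl (fdeg v) (⟦W⟧ v + ⟦W⟧ v))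
    (trans (cong (_+ (⟦W⟧ v + ⟦W⟧ v)) (sum-nonneg-zero (λ v → 0≤- (fdeg-lower v)) excess≡0 v)) (ℚ.+-identityˡ _))
    where
    excess≡0 : sum (λ v → fdeg v - (⟦W⟧ v + ⟦W⟧ v)) ≡ 0ℚ
    excess≡0 = ℚ.≤-antisym
      (subst (_≤ 0ℚ) (sym (trans (sum-minus fdeg (λ v → ⟦W⟧ v + ⟦W⟧ v)) (cong₂ _-_ sum-fdeg
          (trans (∑-distrib-+ ⟦W⟧ ⟦W⟧) (sym (cong₂ _+_ (length-filter covered?) (length-filter covered?)))))))
        (subst (ℕtoℚ m + ℕtoℚ m - (ℕtoℚ k + ℕtoℚ k) ≤_) (ℚ.+-inverseʳ (ℕtoℚ k + ℕtoℚ k))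
          (ℚ.+-monoˡ-≤ (- (ℕtoℚ k + ℕtoℚ k)) (ℚ.+-mono-≤ (ℕtoℚ-mono-≤ m≤W) (ℕtoℚ-mono-≤ m≤W)))))
      (sum-nonneg (λ v → 0≤- (fdeg-lower v)))
      where k = length W-vertices

  m≡W : ℕtoℚ m ≡ sum ⟦W⟧
  m≡W = trans (solve 1 (λ p → p := con ½ :* (p :+ p)) refl (ℕtoℚ m))
    (trans (cong (½ *_) (trans (sym sum-fdeg) (trans (sum-cong-≗ fdeg-W) (∑-distrib-+ ⟦W⟧ ⟦W⟧))))
      (solve 1 (λ p → con ½ :* (p :+ p) := p) refl (sum ⟦W⟧)))

  -- A third neighbour `u` would put three distinct indicators below the row of F, whose sum is two.
  only-neighbours : ∀ {v a b} → a ≢ b → Frac a v → Frac b v → ∀ {u} → Frac u v → u ≡ a ⊎ u ≡ b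
  only-neighbours {v} {a} {b} a≢b fa fb {u} fu with u ≟ a | u ≟ b
  ... | yes e | _ = inj₁ e
  ... | no _ | yes e = inj₂ e
  ... | no u≢a | no u≢b = ⊥-elim (ℚ.<-irrefl refl (ℚ.<-≤-trans {1ℚ + 1ℚ} {1ℚ + 1ℚ + 1ℚ} (ℚ.*<* (ℤ.+<+ (s≤s (s≤s (s≤s z≤n)))))
    (subst₂ _≤_ (trans (∑-distrib-+ (λ w → [ w ≐ a ] + [ w ≐ b ]) (λ w → [ w ≐ u ]))
        (cong₂ _+_ (trans (∑-distrib-+ (λ w → [ w ≐ a ]) (λ w → [ w ≐ b ])) (cong₂ _+_ (sum-≐ a) (sum-≐ b))) (sum-≐ u)))
      (trans (fdeg-W v) (cong₂ _+_ (does-true (covered? v) (a , fa)) (does-true (covered? v) (a , fa))))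
      (two≤fdeg a≢b fa fb (λ w → [ w ≐ a ] + [ w ≐ b ] + [ w ≐ u ]) other
        (cong₂ _+_ (cong₂ _+_ (≐-refl a) (≐-≢ a≢b)) (≐-≢ (λ e → u≢a (sym e))))
        (cong₂ _+_ (cong₂ _+_ (≐-≢ (λ e → a≢b (sym e))) (≐-refl b)) (≐-≢ (λ e → u≢b (sym e))))))))
    where
    other : ∀ w → w ≢ a → w ≢ b → [ w ≐ a ] + [ w ≐ b ] + [ w ≐ u ] ≤ ⟦F⟧ w v
    other w w≢a w≢b with w ≟ u
    ... | yes refl = ℚ.≤-reflexive (trans (cong₂ (λ p q → p + q + 1ℚ) (≐-≢ w≢a) (≐-≢ w≢b)) (sym (does-true (frac? w v) fu)))
    ... | no _ = subst (_≤ ⟦F⟧ w v) (sym (cong₂ (λ p q → p + q + 0ℚ) (≐-≢ w≢a) (≐-≢ w≢b))) (⟦⟧-nonneg (does (frac? w v)))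

  fracSum-W : ∀ v → fracSum v ≡ ⟦W⟧ v
  fracSum-W v with covered? v
  ... | no ¬w = sum-zero (λ u → ⟦F⟧ u v * x u v)
    (λ u → trans (cong (_* x u v) (does-false (frac? u v) (λ f → ¬w (u , f)))) (ℚ.*-zeroˡ (x u v)))
  ... | yes (a , fa) with second-neighbour fa
  ...   | b , b≢a , fb = integral-between (ℤ.+ 0) (fracSum-integral v)
    (subst (0ℚ <_) (sym two) (ℚ.+-mono-< (proj₁ fa) (proj₁ fb)))
    (subst (_< 1ℚ + 1ℚ) (sym two) (ℚ.+-mono-< (proj₂ fa) (proj₂ fb)))
    where
    term : ∀ {u} → Frac u v → ⟦F⟧ u v * x u v ≡ x u v
    term {u} f = trans (cong (_* x u v) (does-true (frac? u v) f)) (ℚ.*-identityˡ (x u v))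
    two : fracSum v ≡ x a v + x b v
    two = trans (sum-pair (λ u → ⟦F⟧ u v * x u v) (λ e → b≢a (sym e)) (λ u u≢a u≢b →
        trans (cong (_* x u v) (does-false (frac? u v)
          (λ f → [ u≢a , u≢b ]′ (only-neighbours (λ e → b≢a (sym e)) fa fb f)))) (ℚ.*-zeroˡ (x u v))))
      (cong₂ _+_ (term fa) (term fb))

  -- The perturbation `F * (x - ½)` has row sums `1 - ½ * 2 = 0` at covered vertices and 0
  -- elsewhere, so rigidity makes it zero.
  half : ∀ {u v} → Frac u v → x u v ≡ ½
  half {u} {v} f = trans (solve 1 (λ x → x := (con 1ℚ :* x :- con ½ :* con 1ℚ) :+ con ½) refl (x u v))
    (trans (cong (λ q → (q * x u v - ½ * q) + ½) (sym (does-true (frac? u v) f)))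
      (trans (cong (_+ ½) (rigid h ((λ a b → cong₂ (λ p q → p * q - ½ * p) (⟦F⟧-sym a b) (x-sym a b)) , support) rows u v)) refl))
    where
    h : Point n
    h u v = ⟦F⟧ u v * x u v - ½ * ⟦F⟧ u v
    support : ∀ u v → ¬ Frac u v → h u v ≡ 0ℚ
    support u v ¬f = trans (cong (λ q → q * x u v - ½ * q) (does-false (frac? u v) ¬f))
      (solve 1 (λ x → con 0ℚ :* x :- con ½ :* con 0ℚ := con 0ℚ) refl (x u v))
    rows : ∀ v → col h v ≡ 0ℚ
    rows v = trans (sum-minus (λ u → ⟦F⟧ u v * x u v) (λ u → ½ * ⟦F⟧ u v))
      (trans (cong₂ _-_ (fracSum-W v) (trans (sym (*-distribˡ-sum ½ (λ u → ⟦F⟧ u v))) (cong (½ *_) (fdeg-W v))))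
        (solve 1 (λ w → w :- con ½ :* (w :+ w) := con 0ℚ) refl (⟦W⟧ v)))

  module _ (π : Fin n → ℚ) (alternating : ∀ {u v} → Frac u v → π u + π v ≡ 0ℚ) where

    -- Twice the weighted sum is the sum of `(π u + π v) * δ u v` over all ordered pairs; the factor
    -- vanishes on F and `δ` vanishes off F.
    weighted-rows : ∀ {δ} → Perturbation δ → sum (λ v → π v * col δ v) ≡ 0ℚ
    weighted-rows {δ} (δ-sym , δ-support) = p≡-p⇒p≡0 _ (begin
      S + S                                                             ≡⟨ cong₂ _+_ S≡ S≡ ⟩
      T + T                                                             ≡⟨ cong (T +_) (sum-sum-transpose δ δ-sym π) ⟩
      T + T′                                                            ≡⟨ ∑-distrib-+ (λ v → sum (λ u → π v * δ v u)) (λ v → sum (λ u → π u * δ v u)) ⟨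
      sum (λ v → sum (λ u → π v * δ v u) + sum (λ u → π u * δ v u))     ≡⟨ sum-zero {n} _ (λ v → trans (sym (∑-distrib-+ (λ u → π v * δ v u) (λ u → π u * δ v u))) (sum-zero {n} _ (term v))) ⟩
      0ℚ                                                                ∎)
      where
      open ≡-Reasoning
      S T T′ : ℚ
      S = sum (λ v → π v * col δ v)
      T = sum (λ v → sum (λ u → π v * δ v u))
      T′ = sum (λ v → sum (λ u → π u * δ v u))
      S≡ : S ≡ T
      S≡ = sum-cong-≗ (λ v → trans (cong (π v *_) (sum-cong-≗ (λ u → δ-sym u v))) (*-distribˡ-sum (π v) (δ v)))
      term : ∀ v u → π v * δ v u + π u * δ v u ≡ 0ℚ
      term v u with frac? v u
      ... | yes f = trans (sym (ℚ.*-distribʳ-+ (δ v u) (π v) (π u))) (trans (cong (_* δ v u) (alternating f)) (ℚ.*-zeroˡ (δ v u)))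
      ... | no ¬f = trans (cong (λ q → π v * q + π u * q) (δ-support v u ¬f))
        (solve 2 (λ a b → a :* con 0ℚ :+ b :* con 0ℚ := con 0ℚ) refl (π v) (π u))

    module _ {w} (cw : Covered w) where

      other? : ∀ v → Dec (Covered v × v ≢ w)
      other? v = covered? v ×-dec ¬? (v ≟ w)

      others : List (Fin n)
      others = filter other? (allFin n)

      count-others : ℕtoℚ (length others) + 1ℚ ≡ ℕtoℚ m
      count-others = trans (cong₂ _+_ (length-filter other?) (sym (sum-≐ w)))
        (trans (sym (∑-distrib-+ (λ v → ⟦ does (other? v) ⟧) (λ v → [ v ≐ w ]))) (trans (sum-cong-≗ indicator) (sym m≡W)))
        where
        indicator : ∀ v → ⟦ does (other? v) ⟧ + [ v ≐ w ] ≡ ⟦W⟧ v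
        indicator v with v ≟ w
        ... | yes refl = trans (cong (_+ 1ℚ) (cong ⟦_⟧ (Bool.∧-zeroʳ (does (covered? w))))) (sym (does-true (covered? w) cw))
        ... | no _ = trans (ℚ.+-identityʳ _) (cong ⟦_⟧ (Bool.∧-identityʳ (does (covered? v))))

      other-row : ∀ {δ} → Perturbation δ → VanishesOn δ others → ∀ v → v ≢ w → col δ v ≡ 0ℚ
      other-row pert rows v v≢w with covered? v
      ... | yes cv = rows (List.∈-filter⁺ other? (List.∈-allFin v) (cv , v≢w))
      ... | no ¬cv = uncovered-row pert ¬cv

      other-rows : π w ≢ 0ℚ → ∀ {δ} → Perturbation δ → VanishesOn δ others → ∀ v → col δ v ≡ 0ℚ
      other-rows πw≢0 {δ} pert rows v with v ≟ w
      ... | no v≢w = other-row pert rows v v≢w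
      ... | yes refl = *-zero-cancelˡ πw≢0 (trans
        (sym (sum-single (λ v → π v * col δ v) w
          (λ v v≢w → trans (cong (π v *_) (other-row pert rows v v≢w)) (ℚ.*-zeroʳ (π v)))))
        (weighted-rows pert))

      -- The weighted sum of the row equations vanishes identically, so the equation at w is redundant.
      potential-zero : π w ≡ 0ℚ
      potential-zero with π w ℚ.≟ 0ℚ
      ... | yes e = e
      ... | no πw≢0 = ⊥-elim (ℕtoℚ-suc-≰ count-others (rows-determine (other-rows πw≢0)))

  G-sym : ∀ u v → G u v ≡ G v u
  G-sym = proj₁ (proj₁ isRealization)

  G-diag : ∀ u → G u u ≡ false
  G-diag = proj₂ (proj₁ isRealization)

  G-row : ∀ v → sum (λ u → ⟦ G u v ⟧) ≡ ℕtoℚ (d v)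
  G-row = realization-row {G = G} isRealization

  D-total : ℚ
  D-total = sum (λ v → ℕtoℚ (d v))

  G-total-even : Even D-total
  G-total-even = subst Even (sum-cong-≗ G-row)
    (even-sum-sum (λ v u → ⟦ G u v ⟧) (λ u v → cong ⟦_⟧ (G-sym v u)) (λ u → cong ⟦_⟧ (G-diag u)) (λ u v → integral-⟦⟧ (G v u)))

  -- Since `x` is ½ on F, the matrix `x - ½ F` is integral and symmetric with zero diagonal, and the
  -- handshake lemma applies to it. Its row sums are those of `d`, less one at each covered vertex.
  rest-even : Even (D-total - sum ⟦W⟧)
  rest-even = subst Even (trans (sum-cong-≗ rest-row) (sum-minus (λ v → ℕtoℚ (d v)) ⟦W⟧))
    (even-sum-sum (λ v u → x u v - ½ * ⟦F⟧ u v)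
      (λ u v → cong₂ (λ p q → p - ½ * q) (x-sym v u) (⟦F⟧-sym v u))
      (λ u → cong₂ (λ p q → p - ½ * q) (x-diag u) (does-false (frac? u u) (λ f → frac-≢ f refl)))
      (λ u v → integral-rest v u))
    where
    integral-rest : ∀ u v → Integral (x u v - ½ * ⟦F⟧ u v)
    integral-rest u v with frac? u v
    ... | yes f = subst Integral (cong (_- ½ * 1ℚ) (sym (half f))) integral-0
    ... | no ¬f = subst Integral (solve 1 (λ x → x := x :- con ½ :* con 0ℚ) refl (x u v)) (not-frac-integral ¬f)
    rest-row : ∀ v → sum (λ u → x u v - ½ * ⟦F⟧ u v) ≡ ℕtoℚ (d v) - ⟦W⟧ v
    rest-row v = trans (sum-minus (λ u → x u v) (λ u → ½ * ⟦F⟧ u v)) (cong₂ _-_ (x-row v)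
      (trans (sym (*-distribˡ-sum ½ (λ u → ⟦F⟧ u v))) (trans (cong (½ *_) (fdeg-W v))
        (solve 1 (λ w → con ½ :* (w :+ w) := w) refl (⟦W⟧ v)))))

  covered-even : Even (sum ⟦W⟧)
  covered-even = even-difference G-total-even rest-even

-- Six covered vertices in the graph of fractional coordinates

Odd : ℕ → Set
Odd l = ∃[ k ] l ≡ suc (k ℕ.+ k)

odd : ∀ k → ¬ Even (ℕtoℚ (suc (k ℕ.+ k)))
odd k (r , (z , refl) , eq) = integral-not-fraction {½} (half-integral , ½-integral) (ℚ.positive⁻¹ ½) (ℚ.*<* (ℤ.+<+ (s≤s (s≤s z≤n))))
  where
  half-integral = proj₁ (integral-+ (z , refl) (integral-neg (ℤ.+ k , refl)))
  ½-integral : ½ ≡ fromℤ half-integral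
  ½-integral = trans (begin
    ½                                           ≡⟨ solve 1 (λ k → con ½ := con ½ :* (con 1ℚ :+ (k :+ k)) :- k) refl (ℕtoℚ k) ⟩
    ½ * (1ℚ + (ℕtoℚ k + ℕtoℚ k)) - ℕtoℚ k       ≡⟨ cong (λ q → ½ * q - ℕtoℚ k) (trans (cong (1ℚ +_) (sym (ℕtoℚ-+ k k))) (trans (sym (ℕtoℚ-suc (k ℕ.+ k))) eq)) ⟩
    ½ * (fromℤ z + fromℤ z) - ℕtoℚ k            ≡⟨ solve 2 (λ z k → con ½ :* (z :+ z) :- k := z :- k) refl (fromℤ z) (ℕtoℚ k) ⟩
    fromℤ z - ℕtoℚ k                            ∎) (proj₂ (integral-+ (z , refl) (integral-neg (ℤ.+ k , refl))))
    where open ≡-Reasoning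

count-list : ∀ {n} {P : Fin n → Set} (P? : ∀ v → Dec (P v)) {vs} → Unique vs → All P vs → ℕtoℚ (length vs) ≤ sum (λ v → ⟦ does (P? v) ⟧)
count-list {n} {P} P? {vs} vs! all = subst (_≤ sum (λ v → ⟦ does (P? v) ⟧))
  (trans (sum-image (List.lookup vs) (unique-lookup-injective vs!) (λ v → ⟦ does (v ∈? vs) ⟧)
      (λ v off → does-false (v ∈? vs) (λ v∈ → off (Any.index v∈) (sym (Any.lookup-index v∈)))))
    (trans (sum-cong-≗ (λ i → does-true (List.lookup vs i ∈? vs) (List.∈-lookup {xs = vs} i))) (sum-one (length vs))))
  (sum-mono at)
  where
  open DecMembership (_≟_ {n}) using (_∈?_)
  at : ∀ v → ⟦ does (v ∈? vs) ⟧ ≤ ⟦ does (P? v) ⟧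
  at v with v ∈? vs
  ... | no _   = ⟦⟧-nonneg (does (P? v))
  ... | yes v∈ = ℚ.≤-reflexive (sym (does-true (P? v) (All.lookup all v∈)))

-- The combinatorial extract of the linear algebra: every covered vertex has exactly two neighbours,
-- no component is bipartite, and (`fresh`) an odd number of vertices never exhausts the covered
-- ones.
module FracGraph {n} (Frac : Fin n → Fin n → Set) (frac? : ∀ u v → Dec (Frac u v))
  (frac-sym : ∀ {u v} → Frac u v → Frac v u) (frac-≢ : ∀ {u v} → Frac u v → u ≢ v)
  (second-neighbour : ∀ {u v} → Frac u v → ∃[ w ] w ≢ u × Frac w v)
  (only-neighbours : ∀ {v a b} → a ≢ b → Frac a v → Frac b v → ∀ {u} → Frac u v → u ≡ a ⊎ u ≡ b)
  (bipartite-impossible : (ps qs : List (Fin n)) → (∀ {u v} → Frac u v → v ∈ ps → u ∈ qs) → (∀ {u v} → Frac u v → v ∈ qs → u ∈ ps) →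
    ∀ {w} → ∃[ u ] Frac u w → w ∈ ps → ¬ w ∈ qs → ⊥)
  (fresh : (vs : List (Fin n)) → Unique vs → All (λ v → ∃[ u ] Frac u v) vs → Odd (length vs) →
    ∃[ w ] (∃[ u ] Frac u w) × All (w ≢_) vs) where

  Covered : Fin n → Set
  Covered v = ∃[ u ] Frac u v

  neighbours : ∀ {v a b} → a ≢ b → Frac a v → Frac b v → ∀ {u} → Frac u v → u ∈ a ∷ b ∷ []
  neighbours a≢b fa fb f with only-neighbours a≢b fa fb f
  ... | inj₁ e = here e
  ... | inj₂ e = there (here e)

  not-neighbour : ∀ {v a b} → a ≢ b → Frac a v → Frac b v → ∀ {u w} → w ≢ a → w ≢ b → Frac u w → u ≢ v
  not-neighbour a≢b fa fb w≢a w≢b f refl = [ w≢a , w≢b ]′ (only-neighbours a≢b fa fb (frac-sym f))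

  data SixCovered : Set where
    triangle : ∀ {a b c d e f} → Unique (d ∷ e ∷ f ∷ a ∷ b ∷ c ∷ []) →
      Frac b a → Frac c a → Frac c b → Frac e d → Frac f d → SixCovered
    path : ∀ {a b c d e f} → Unique (f ∷ d ∷ e ∷ a ∷ b ∷ c ∷ []) →
      Frac b a → Frac c a → Frac d b → Frac e c → Covered f → SixCovered

  -- Let `a` have neighbours `b` and `c`. If these are adjacent, the triangle is odd, so there is a
  -- covered vertex elsewhere, which brings its two neighbours along. If not, the walk continues one
  -- step on both sides to a path on five vertices, and parity supplies a sixth.
  sixCovered : ∀ {v} → Covered v → SixCovered
  sixCovered {a} (b , fba) with second-neighbour fba
  ... | c , c≢b , fca with frac? c b
  ...   | yes fcb = two-triangles (fresh (a ∷ b ∷ c ∷ [])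
            (((frac-≢ (frac-sym fba)) ∷ (frac-≢ (frac-sym fca)) ∷ []) ∷ (b≢c ∷ []) ∷ [] ∷ [])
            ((b , fba) ∷ (a , frac-sym fba) ∷ (a , frac-sym fca) ∷ []) (1 , refl))
    where
    b≢c = λ e → c≢b (sym e)
    two-triangles : ∃[ w ] Covered w × All (w ≢_) (a ∷ b ∷ c ∷ []) → SixCovered
    two-triangles (d , (e , fed) , (d≢a ∷ d≢b ∷ d≢c ∷ [])) with second-neighbour fed
    ... | f , f≢e , ffd = triangle
      ( (frac-≢ (frac-sym fed) ∷ frac-≢ (frac-sym ffd) ∷ d≢a ∷ d≢b ∷ d≢c ∷ [])
      ∷ ((λ p → f≢e (sym p)) ∷ away fed)
      ∷ away ffd
      ∷ (frac-≢ (frac-sym fba) ∷ frac-≢ (frac-sym fca) ∷ []) ∷ (b≢c ∷ []) ∷ [] ∷ [])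
      fba fca fcb fed ffd
      where
      away : ∀ {u} → Frac u d → All (u ≢_) (a ∷ b ∷ c ∷ [])
      away g = not-neighbour b≢c fba fca d≢b d≢c g
        ∷ not-neighbour (frac-≢ (frac-sym fca)) (frac-sym fba) fcb d≢a d≢c g
        ∷ not-neighbour (frac-≢ (frac-sym fba)) (frac-sym fca) (frac-sym fcb) d≢a d≢b g ∷ []
  ...   | no ¬fcb with second-neighbour (frac-sym fba) | second-neighbour (frac-sym fca)
  ...     | d , d≢a , fdb | e , e≢a , fec with d ≟ e
  -- Both ends of the walk meet in `d`: a 4-cycle, with sides `a`, `d` and `b`, `c`.
  ...       | yes refl = ⊥-elim (bipartite-impossible (a ∷ d ∷ []) (b ∷ c ∷ [])
                (λ { f (here refl) → neighbours b≢c fba fca f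
                   ; f (there (here refl)) → neighbours b≢c (frac-sym fdb) (frac-sym fec) f })
                (λ { f (here refl) → neighbours (λ e → d≢a (sym e)) (frac-sym fba) fdb f
                   ; f (there (here refl)) → neighbours (λ e → d≢a (sym e)) (frac-sym fca) fec f })
                (b , fba) (here refl)
                (λ { (here e) → frac-≢ fba (sym e) ; (there (here e)) → frac-≢ fca (sym e) }))
    where b≢c = λ e → c≢b (sym e)
  ...       | no d≢e = path-and-vertex (fresh (d ∷ e ∷ a ∷ b ∷ c ∷ []) unique
              ((b , frac-sym fdb) ∷ (c , frac-sym fec) ∷ (b , fba) ∷ (a , frac-sym fba) ∷ (a , frac-sym fca) ∷ []) (2 , refl))
    where
    b≢c = λ e → c≢b (sym e)
    unique : Unique (d ∷ e ∷ a ∷ b ∷ c ∷ [])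
    unique = (d≢e ∷ d≢a ∷ frac-≢ fdb ∷ (λ { refl → ¬fcb fdb }) ∷ [])
      ∷ (e≢a ∷ (λ { refl → ¬fcb (frac-sym fec) }) ∷ frac-≢ fec ∷ [])
      ∷ (frac-≢ (frac-sym fba) ∷ frac-≢ (frac-sym fca) ∷ []) ∷ (b≢c ∷ []) ∷ [] ∷ []
    path-and-vertex : ∃[ w ] Covered w × All (w ≢_) (d ∷ e ∷ a ∷ b ∷ c ∷ []) → SixCovered
    path-and-vertex (f , cf , f∉) = path (f∉ ∷ unique) fba fca fdb fec cf

  covered-list : SixCovered → Σ[ vs ∈ List (Fin n) ] Unique vs × All Covered vs × length vs ≡ 6
  covered-list (triangle vs! fba fca fcb fed ffd) = _ , vs! ,
    ((_ , fed) ∷ (_ , frac-sym fed) ∷ (_ , frac-sym ffd) ∷ (_ , fba) ∷ (_ , fcb) ∷ (_ , frac-sym fcb) ∷ []) , refl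
  covered-list (path vs! fba fca fdb fec cf) = _ , vs! ,
    (cf ∷ (_ , frac-sym fdb) ∷ (_ , frac-sym fec) ∷ (_ , fba) ∷ (_ , fdb) ∷ (_ , fec) ∷ []) , refl

  record TwoTriangles : Set where
    constructor twoTriangles
    field
      {a b c d e f} : Fin n
      distinct : Unique (d ∷ e ∷ f ∷ a ∷ b ∷ c ∷ [])
      ba : Frac b a
      ca : Frac c a
      cb : Frac c b
      ed : Frac e d
      fd : Frac f d
      fe : Frac f e

  -- When six covered vertices are all there are, the second neighbour of `e` has nowhere to be but
  -- at `f`, which closes the second triangle. In the other case the path and the sixth vertex would
  -- close to a 6-cycle.
  hexad : (∀ {vs} → Unique vs → All Covered vs → length vs ≡ 6 → ∀ {v} → Covered v → v ∈ vs) →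
    ∀ {v} → Covered v → TwoTriangles
  hexad complete cv with sixCovered cv
  ... | triangle {a} {b} {c} {d} {e} {f} vs! fba fca fcb fed ffd = twoTriangles vs! fba fca fcb fed ffd ffe
    where
    inside : ∀ {v} → Covered v → v ∈ d ∷ e ∷ f ∷ a ∷ b ∷ c ∷ []
    inside = complete vs! ((_ , fed) ∷ (_ , frac-sym fed) ∷ (_ , frac-sym ffd) ∷ (_ , fba) ∷ (_ , fcb) ∷ (_ , frac-sym fcb) ∷ []) refl
    ffe : Frac f e
    ffe with second-neighbour (frac-sym fed)
    ... | y , y≢d , fye with inside (_ , frac-sym fye)
    ...   | here e = contradiction e y≢d
    ...   | there (here e) = contradiction e (frac-≢ fye)
    ...   | there (there (here refl)) = fye
    ...   | there (there (there rest)) = ⊥-elim (outside vs! rest)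
      where
      outside : Unique (d ∷ e ∷ f ∷ a ∷ b ∷ c ∷ []) → y ∈ a ∷ b ∷ c ∷ [] → ⊥
      outside (_ ∷ (_ ∷ e≢a ∷ e≢b ∷ e≢c ∷ []) ∷ _) (here refl) = not-neighbour (frac-≢ fcb ∘ sym) fba fca e≢b e≢c fye refl
      outside (_ ∷ (_ ∷ e≢a ∷ e≢b ∷ e≢c ∷ []) ∷ _) (there (here refl)) = not-neighbour (frac-≢ fca ∘ sym) (frac-sym fba) fcb e≢a e≢c fye refl
      outside (_ ∷ (_ ∷ e≢a ∷ e≢b ∷ e≢c ∷ []) ∷ _) (there (there (here refl))) = not-neighbour (frac-≢ fba ∘ sym) (frac-sym fca) (frac-sym fcb) e≢a e≢b fye refl
  ... | path {a} {b} {c} {d} {e} {f} vs!@((f≢d ∷ f≢e ∷ f≢a ∷ f≢b ∷ f≢c ∷ []) ∷ (d≢e ∷ d≢a ∷ d≢b ∷ d≢c ∷ []) ∷ (e≢a ∷ e≢b ∷ e≢c ∷ []) ∷ (a≢b ∷ a≢c ∷ []) ∷ (b≢c ∷ []) ∷ _)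
          fba fca fdb fec cf@(y , fyf) =
    -- The 6-cycle is `a b d f e c`; its alternate vertices form the two sides.
    ⊥-elim (bipartite-impossible (a ∷ d ∷ e ∷ []) (b ∷ c ∷ f ∷ [])
      (λ { g (here refl) → weaken (neighbours b≢c fba fca g)
         ; g (there (here refl)) → widen (neighbours (f≢b ∘ sym) (frac-sym fdb) (frac-sym fdf) g)
         ; g (there (there (here refl))) → there (neighbours (f≢c ∘ sym) (frac-sym fec) (frac-sym fef) g) })
      (λ { g (here refl) → weaken (neighbours (d≢a ∘ sym) (frac-sym fba) fdb g)
         ; g (there (here refl)) → widen (neighbours (e≢a ∘ sym) (frac-sym fca) fec g)
         ; g (there (there (here refl))) → there (neighbours d≢e fdf fef g) })
      (b , fba) (here refl)
      (λ { (here e) → a≢b e ; (there (here e)) → a≢c e ; (there (there (here e))) → f≢a (sym e) }))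
    where
    weaken : ∀ {u v w z : Fin n} → u ∈ v ∷ w ∷ [] → u ∈ v ∷ w ∷ z ∷ []
    weaken (here e) = here e
    weaken (there (here e)) = there (here e)
    widen : ∀ {u v w z : Fin n} → u ∈ v ∷ w ∷ [] → u ∈ v ∷ z ∷ w ∷ []
    widen (here e) = here e
    widen (there (here e)) = there (there (here e))
    inside : ∀ {v} → Covered v → v ∈ f ∷ d ∷ e ∷ a ∷ b ∷ c ∷ []
    inside = complete vs! (cf ∷ (_ , frac-sym fdb) ∷ (_ , frac-sym fec) ∷ (_ , fba) ∷ (_ , fdb) ∷ (_ , fec) ∷ []) refl
    f-neighbour : ∀ {u} → Frac u f → u ≡ d ⊎ u ≡ e
    f-neighbour {u} fuf with inside (_ , frac-sym fuf)
    ... | here e = contradiction e (frac-≢ fuf)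
    ... | there (here e) = inj₁ e
    ... | there (there (here e)) = inj₂ e
    ... | there (there (there (here e))) = contradiction e (not-neighbour b≢c fba fca f≢b f≢c fuf)
    ... | there (there (there (there (here e)))) = contradiction e (not-neighbour (d≢a ∘ sym) (frac-sym fba) fdb f≢a f≢d fuf)
    ... | there (there (there (there (there (here e))))) = contradiction e (not-neighbour (e≢a ∘ sym) (frac-sym fca) fec f≢a f≢e fuf)
    both : Frac d f × Frac e f
    both with second-neighbour fyf
    ... | z , z≢y , fzf with f-neighbour fyf | f-neighbour fzf
    ...   | inj₁ refl | inj₂ refl = fyf , fzf
    ...   | inj₂ refl | inj₁ refl = fzf , fyf
    ...   | inj₁ refl | inj₁ refl = contradiction refl z≢y
    ...   | inj₂ refl | inj₂ refl = contradiction refl z≢y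
    fdf = proj₁ both
    fef = proj₂ both

module Support {n} {d : Fin n → ℕ} {G : Graph n} (real : Realizes d G) {x : Point n} (vertex : VertexOf d x) where
  open Vertex real vertex
  open DecMembership (_≟_ {n}) using (_∈?_)

  -- The indicator of `ps` minus that of `qs` is a potential along F with the value 1 at `w`, where
  -- it must vanish.
  bipartite-impossible : (ps qs : List (Fin n)) → (∀ {u v} → Frac u v → v ∈ ps → u ∈ qs) → (∀ {u v} → Frac u v → v ∈ qs → u ∈ ps) →
    ∀ {w} → Covered w → w ∈ ps → ¬ w ∈ qs → ⊥
  bipartite-impossible ps qs p→q q→p {w} cw w∈ps w∉qs = ℚ.1≢0 (trans (sym at-w) (potential-zero π alternating cw))
    where
    π : Fin n → ℚ
    π v = ⟦ does (v ∈? ps) ⟧ - ⟦ does (v ∈? qs) ⟧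
    at-w : π w ≡ 1ℚ
    at-w = cong₂ _-_ (does-true (w ∈? ps) w∈ps) (does-false (w ∈? qs) w∉qs)
    alternating : ∀ {u v} → Frac u v → π u + π v ≡ 0ℚ
    alternating {u} {v} f with v ∈? ps | v ∈? qs | u ∈? ps | u ∈? qs
    ... | yes _ | yes _ | yes _ | yes _ = refl
    ... | yes _ | no _  | no _  | yes _ = refl
    ... | no _  | yes _ | yes _ | no _  = refl
    ... | no _  | no _  | no _  | no _  = refl
    ... | yes a | _ | _ | no ¬b = contradiction (p→q f a) ¬b
    ... | no ¬a | _ | _ | yes b = contradiction (q→p (frac-sym f) b) ¬a
    ... | _ | yes a | no ¬b | _ = contradiction (q→p f a) ¬b
    ... | _ | no ¬a | yes b | _ = contradiction (p→q (frac-sym f) b) ¬a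

  -- If nothing were left, the number of covered vertices would be the odd length of `vs`.
  fresh : (vs : List (Fin n)) → Unique vs → All Covered vs → Odd (length vs) → ∃[ w ] Covered w × All (w ≢_) vs
  fresh vs vs! cvs (k , |vs|) with Fin.any? (λ w → covered? w ×-dec All.all? (λ v → ¬? (w ≟ v)) vs)
  ... | yes r = r
  ... | no ∄ = contradiction (subst Even (trans count (cong ℕtoℚ |vs|)) covered-even) (odd k)
    where
    count : sum ⟦W⟧ ≡ ℕtoℚ (length vs)
    count = trans (sum-image (List.lookup vs) (unique-lookup-injective vs!) ⟦W⟧
        (λ w off → does-false (covered? w) (λ cw → ∄ (w , cw , All.tabulate (λ v∈ w≡v → off (Any.index v∈) (trans (sym (Any.lookup-index v∈)) (sym w≡v)))))))
      (trans (sum-cong-≗ (λ i → does-true (covered? (List.lookup vs i)) (All.lookup cvs (List.∈-lookup {xs = vs} i)))) (sum-one (length vs)))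

  open FracGraph Frac frac? frac-sym frac-≢ second-neighbour only-neighbours bipartite-impossible fresh public hiding (Covered)

  six≤covered : ∀ {v} → Covered v → ∀ {P : Fin n → Set} (P? : ∀ v → Dec (P v)) → (∀ {v} → Covered v → P v) →
    ℕtoℚ 6 ≤ sum (λ v → ⟦ does (P? v) ⟧)
  six≤covered cv P? c→P with covered-list (sixCovered cv)
  ... | vs , vs! , all , len = subst (λ k → ℕtoℚ k ≤ _) len (count-list P? vs! (All.map c→P all))
 

-- Fractional coordinates relative to a partition

ℕtoℚ-cancel-≤ : ∀ {k l} → ℕtoℚ k ≤ ℕtoℚ l → k ℕ.≤ l
ℕtoℚ-cancel-≤ {k} {l} k≤l = ℕ.≮⇒≥ (λ l<k → ℚ.<-irrefl refl (ℚ.<-≤-trans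
  (subst₂ _<_ (ℚ.+-identityˡ (ℕtoℚ l)) (sym (ℕtoℚ-suc l)) (ℚ.+-monoˡ-< (ℕtoℚ l) (ℚ.positive⁻¹ 1ℚ)))
  (ℚ.≤-trans (ℕtoℚ-mono-≤ l<k) k≤l)))

-- These weights serve twice: as multipliers of the row equations they make every term nonnegative,
-- and as a potential along F they confine F to V₃, the only part of weight zero.
weight : Fin 3 → ℚ
weight 0F = 1ℚ
weight 1F = - 1ℚ
weight 2F = 0ℚ

weight-zero : ∀ i → weight i ≡ 0ℚ → i ≡ 2F
weight-zero 0F ()
weight-zero 1F ()
weight-zero 2F _ = refl

-- Pigeonhole: a missing vertex together with `vs` would inject `k + 1` positions into `Fin k`.
unique-exhausts : ∀ {n k} {P : Fin n → Set} (g : Fin k → Fin n) → (∀ v → P v → ∃[ a ] g a ≡ v) →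
  ∀ {vs} → Unique vs → All P vs → length vs ≡ k → ∀ {v} → P v → v ∈ vs
unique-exhausts {n} {k} {P} g g-onto {vs} vs! vs-P len {v} pv with DecMembership._∈?_ _≟_ v vs
... | yes v∈ = v∈
... | no v∉ = ⊥-elim (ℕ.1+n≰n (subst (λ l → suc l ℕ.≤ k) len (Fin.injective⇒≤ {f = h} h-inj)))
  where
  ws = v ∷ vs
  ws! : Unique ws
  ws! = All.tabulate (λ w∈ v≡w → v∉ (subst (_∈ vs) (sym v≡w) w∈)) ∷ vs!
  pre : ∀ i → ∃[ a ] g a ≡ List.lookup ws i
  pre i = g-onto _ (All.lookup (pv ∷ vs-P) (List.∈-lookup {xs = ws} i))
  h : Fin (length ws) → Fin k
  h = proj₁ ∘ pre
  h-inj : Injective _≡_ _≡_ h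
  h-inj {i} {j} e = unique-lookup-injective ws! (trans (sym (proj₂ (pre i))) (trans (cong g e) (proj₂ (pre j))))

-- The three rows of one triangle minus those of the other: the nine entries between the triangles
-- cancel, and so do the halves, which amount to 3 in each triangle, as well as the common term `t`.
triangles-balance : ∀ {t s iₐ i_b i_c i_d i_e i_f da db dc ea eb ec fa fb fc} →
  t + s * iₐ ≡ da + (ea + (fa + (0ℚ + (½ + (½ + 0ℚ))))) →
  t + s * i_b ≡ db + (eb + (fb + (½ + (0ℚ + (½ + 0ℚ))))) →
  t + s * i_c ≡ dc + (ec + (fc + (½ + (½ + (0ℚ + 0ℚ))))) →
  t + s * i_d ≡ 0ℚ + (½ + (½ + (da + (db + (dc + 0ℚ))))) →
  t + s * i_e ≡ ½ + (0ℚ + (½ + (ea + (eb + (ec + 0ℚ))))) →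
  t + s * i_f ≡ ½ + (½ + (0ℚ + (fa + (fb + (fc + 0ℚ))))) →
  s * (iₐ + i_b + i_c - (i_d + i_e + i_f)) ≡ 0ℚ
triangles-balance {t} {s} {iₐ} {i_b} {i_c} {i_d} {i_e} {i_f} {da} {db} {dc} {ea} {eb} {ec} {fa} {fb} {fc} ra rb rc rd re rf =
  trans (solve 8 (λ t s a b c d e f → s :* (a :+ b :+ c :- (d :+ e :+ f)) :=
      (t :+ s :* a) :+ (t :+ s :* b) :+ (t :+ s :* c) :- ((t :+ s :* d) :+ (t :+ s :* e) :+ (t :+ s :* f)))
      refl t s iₐ i_b i_c i_d i_e i_f)
    (trans (cong₂ _-_ (cong₂ _+_ (cong₂ _+_ ra rb) rc) (cong₂ _+_ (cong₂ _+_ rd re) rf))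
      (solve 9 (λ da db dc ea eb ec fa fb fc →
        (da :+ (ea :+ (fa :+ (con 0ℚ :+ (con ½ :+ (con ½ :+ con 0ℚ)))))) :+ (db :+ (eb :+ (fb :+ (con ½ :+ (con 0ℚ :+ (con ½ :+ con 0ℚ))))))
          :+ (dc :+ (ec :+ (fc :+ (con ½ :+ (con ½ :+ (con 0ℚ :+ con 0ℚ))))))
        :- ((con 0ℚ :+ (con ½ :+ (con ½ :+ (da :+ (db :+ (dc :+ con 0ℚ)))))) :+ (con ½ :+ (con 0ℚ :+ (con ½ :+ (ea :+ (eb :+ (ec :+ con 0ℚ))))))
          :+ (con ½ :+ (con ½ :+ (con 0ℚ :+ (fa :+ (fb :+ (fc :+ con 0ℚ))))))) := con 0ℚ) refl da db dc ea eb ec fa fb fc))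

module Separated {n} {d : Fin n → ℕ} {G : Graph n} (real : Realizes d G) {x : Point n} (vertex : VertexOf d x)
  (p : Fin n → Fin 3)
  (independent : ∀ u v → p u ≡ 0F → p v ≡ 0F → G u v ≡ false)
  (clique : ∀ u v → u ≢ v → p u ≡ 1F → p v ≡ 1F → G u v ≡ true)
  (joined : ∀ u v → p u ≡ 2F → p v ≡ 1F → G u v ≡ true)
  (disjoint : ∀ u v → p u ≡ 2F → p v ≡ 0F → G u v ≡ false) where
  open Vertex real vertex public
  open Support real vertex public
  open DecMembership (_≟_ {n}) using (_∈?_)

  difference : Point n
  difference u v = x u v - ⟦ G u v ⟧

  difference-row : ∀ v → col difference v ≡ 0ℚ
  difference-row v = trans (sum-minus (λ u → x u v) (λ u → ⟦ G u v ⟧))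
    (trans (cong₂ _-_ (x-row v) (G-row v)) (ℚ.+-inverseʳ (ℕtoℚ (d v))))

  difference-sym : Symmetric difference
  difference-sym u v = cong₂ (λ a b → a - ⟦ b ⟧) (x-sym u v) (G-sym u v)

  nonedge-term : ∀ {k u v} → 0ℚ ≤ k → G u v ≡ false → 0ℚ ≤ k * difference u v
  nonedge-term {k} {u} {v} 0≤k e = *-nonneg 0≤k
    (subst (0ℚ ≤_) (sym (trans (cong (λ b → x u v - ⟦ b ⟧) e) (ℚ.+-identityʳ (x u v)))) (proj₁ (x-bounds u v)))

  edge-term : ∀ {k u v} → 0ℚ ≤ k → G u v ≡ true → 0ℚ ≤ - k * difference u v
  edge-term {k} {u} {v} 0≤k e = subst (0ℚ ≤_)
    (trans (solve 2 (λ k x → k :* (con 1ℚ :- x) := (:- k) :* (x :- con 1ℚ)) refl k (x u v)) (cong (λ b → - k * (x u v - ⟦ b ⟧)) (sym e)))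
    (*-nonneg 0≤k (0≤- (proj₂ (x-bounds u v))))

  term : Fin n → Fin n → ℚ
  term u v = (weight (p u) + weight (p v)) * difference u v

  0≤1 : 0ℚ ≤ 1ℚ
  0≤1 = ℚ.nonNegative⁻¹ 1ℚ

  -- Off the diagonal, the sum of the two weights is positive only on pairs that are non-edges of
  -- `G`, where the difference is at least 0, and negative only on pairs that are edges, where it is
  -- at most 0. It vanishes on V₁ × V₂ and inside V₃, where the partition leaves `G` free.
  term-nonneg : ∀ u v → 0ℚ ≤ term u v
  term-nonneg u v with p u in pu | p v in pv
  ... | 0F | 0F = nonedge-term (ℚ.nonNegative⁻¹ (1ℚ + 1ℚ)) (independent u v pu pv)
  ... | 0F | 1F = ℚ.≤-reflexive (sym (ℚ.*-zeroˡ (difference u v)))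
  ... | 0F | 2F = nonedge-term 0≤1 (trans (G-sym u v) (disjoint v u pv pu))
  ... | 1F | 0F = ℚ.≤-reflexive (sym (ℚ.*-zeroˡ (difference u v)))
  ... | 1F | 1F = case u ≟ v of λ where
    (yes refl) → ℚ.≤-reflexive (sym (trans (cong₂ (λ q b → (- 1ℚ + - 1ℚ) * (q - ⟦ b ⟧)) (x-diag u) (G-diag u)) refl))
    (no u≢v) → edge-term (ℚ.nonNegative⁻¹ (1ℚ + 1ℚ)) (clique u v u≢v pu pv)
  ... | 1F | 2F = edge-term 0≤1 (trans (G-sym u v) (joined v u pv pu))
  ... | 2F | 0F = nonedge-term 0≤1 (disjoint u v pu pv)
  ... | 2F | 1F = edge-term 0≤1 (joined u v pu pv)
  ... | 2F | 2F = ℚ.≤-reflexive (sym (ℚ.*-zeroˡ (difference u v)))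

  total-zero : sum (λ u → sum (term u)) ≡ 0ℚ
  total-zero = begin
    sum (λ u → sum (term u))
      ≡⟨ sum-cong-≗ (λ u → trans (sum-cong-≗ (λ v → ℚ.*-distribʳ-+ (difference u v) (weight (p u)) (weight (p v))))
           (∑-distrib-+ (λ v → weight (p u) * difference u v) (λ v → weight (p v) * difference u v))) ⟩
    sum (λ u → sum (λ v → weight (p u) * difference u v) + sum (λ v → weight (p v) * difference u v))
      ≡⟨ ∑-distrib-+ (λ u → sum (λ v → weight (p u) * difference u v)) (λ u → sum (λ v → weight (p v) * difference u v)) ⟩
    sum (λ u → sum (λ v → weight (p u) * difference u v)) + sum (λ u → sum (λ v → weight (p v) * difference u v))
      ≡⟨ cong₂ _+_ zero-sum (trans (sym (sum-sum-transpose difference difference-sym (weight ∘ p))) zero-sum) ⟩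
    0ℚ ∎
    where
    open ≡-Reasoning
    zero-sum = weighted-rows-zero difference (weight ∘ p) (λ u → trans
      (cong (weight (p u) *_) (trans (sum-cong-≗ (λ v → difference-sym u v)) (difference-row u))) (ℚ.*-zeroʳ (weight (p u))))

  term-zero : ∀ u v → term u v ≡ 0ℚ
  term-zero u = sum-nonneg-zero (term-nonneg u) (sum-nonneg-zero (λ u → sum-nonneg (term-nonneg u)) total-zero u)

  settled : ∀ {u v} → weight (p u) + weight (p v) ≢ 0ℚ → difference u v ≡ 0ℚ
  settled {u} {v} w≢0 = *-zero-cancelˡ w≢0 (term-zero u v)

  frac-weights : ∀ {u v} → Frac u v → weight (p u) + weight (p v) ≡ 0ℚ
  frac-weights {u} {v} f with weight (p u) + weight (p v) ℚ.≟ 0ℚ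
  ... | yes e = e
  ... | no w≢0 = ⊥-elim (not-bit (G u v) (trans (solve 2 (λ a b → a := (a :- b) :+ b) refl (x u v) ⟦ G u v ⟧)
      (trans (cong (_+ ⟦ G u v ⟧) (settled w≢0)) (ℚ.+-identityˡ ⟦ G u v ⟧))))
    where
    not-bit : ∀ b → x u v ≢ ⟦ b ⟧
    not-bit true  e = ℚ.<-irrefl e (proj₂ f)
    not-bit false e = ℚ.<-irrefl (sym e) (proj₁ f)

  -- Along F the weights of the ends cancel, since otherwise `x` would agree there with the 0/1
  -- value of `G`. So the weights form a potential, which vanishes at covered vertices.
  covered-V₃ : ∀ {v} → Covered v → p v ≡ 2F
  covered-V₃ {v} cv = weight-zero (p v) (potential-zero (weight ∘ p) frac-weights cv)

  V₃? : ∀ v → Dec (p v ≡ 2F)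
  V₃? v = p v ≟ 2F

  ⟦V⟧ : Fin n → ℚ
  ⟦V⟧ v = ⟦ does (V₃? v) ⟧

  Vsum : Point n → Fin n → ℚ
  Vsum y v = sum (λ u → ⟦V⟧ u * y u v)

  -- Seen from V₃, entries towards V₁ and V₂ have nonzero weight sum and therefore agree with `G`;
  -- equality of the full row sums then restricts to V₃.
  V-row : ∀ {v} → p v ≡ 2F → Vsum x v ≡ sum (λ u → ⟦V⟧ u * ⟦ G u v ⟧)
  V-row {v} pv = trans (solve 2 (λ a b → a := (a :- b) :+ b) refl (Vsum x v) (sum (λ u → ⟦V⟧ u * ⟦ G u v ⟧)))
    (trans (cong (_+ sum (λ u → ⟦V⟧ u * ⟦ G u v ⟧)) (trans (sym (sum-minus (λ u → ⟦V⟧ u * x u v) (λ u → ⟦V⟧ u * ⟦ G u v ⟧)))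
      (trans (sum-cong-≗ inside) (difference-row v)))) (ℚ.+-identityˡ _))
    where
    off-V : ∀ i → i ≢ 2F → weight i + 0ℚ ≢ 0ℚ
    off-V 0F _ ()
    off-V 1F _ ()
    off-V 2F i≢2 _ = i≢2 refl
    inside : ∀ u → ⟦V⟧ u * x u v - ⟦V⟧ u * ⟦ G u v ⟧ ≡ difference u v
    inside u with V₃? u
    ... | yes _ = solve 2 (λ a b → con 1ℚ :* a :- con 1ℚ :* b := a :- b) refl (x u v) ⟦ G u v ⟧
    ... | no pu = trans (solve 2 (λ a b → con 0ℚ :* a :- con 0ℚ :* b := con 0ℚ) refl (x u v) ⟦ G u v ⟧)
      (sym (settled (λ e → off-V (p u) pu (trans (cong (λ i → weight (p u) + weight i) (sym pv)) e))))

  small-uncovered : length (filter V₃? (allFin n)) ℕ.< 6 → ∀ {v} → ¬ Covered v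
  small-uncovered V<6 cv = ℕ.<⇒≱ V<6 (ℕtoℚ-cancel-≤ (subst (ℕtoℚ 6 ≤_) (sym (length-filter V₃?)) (six≤covered cv V₃? covered-V₃)))

  -- The matrix `z` will be `x` for K₂ + K₁,ₘ and the complement of `x` for the complementary graph,
  -- so that one count serves both. Inside V₃ the centre `c` has row sum `K`, all others have row
  -- sum 1, and there are `K + 3` vertices.
  module Star (z : Point n) (z-sym : Symmetric z) (z-bounds : ∀ u v → (0ℚ ≤ z u v) × (z u v ≤ 1ℚ)) (z-diag : ∀ u → z u u ≡ 0ℚ)
    (z-frac : ∀ {u v} → Frac u v → z u v ≡ ½) (c : Fin n) (c∈V : p c ≡ 2F) (K : ℚ)
    (centre : Vsum z c ≡ K) (size : sum ⟦V⟧ ≡ K + ℕtoℚ 3)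
    (other : ∀ {v} → p v ≡ 2F → v ≢ c → Vsum z v ≡ 1ℚ) where

    -- The two halves at `v` already exhaust its row sum 1 inside V₃, so its remaining entries there
    -- are zero.
    saturated : ∀ {v} → Covered v → v ≢ c → ¬ Frac v c → z v c ≡ 0ℚ
    saturated {v} cv v≢c ¬f = begin
      z v c                            ≡⟨ z-sym v c ⟩
      z c v                            ≡⟨ solve 1 (λ a → a := con 1ℚ :* a :- con ½ :* con 0ℚ) refl (z c v) ⟩
      1ℚ * z c v - ½ * 0ℚ              ≡⟨ cong₂ (λ a b → a * z c v - ½ * b) (does-true (V₃? c) c∈V) (does-false (frac? c v) (λ f → ¬f (frac-sym f))) ⟨
      ⟦V⟧ c * z c v - ½ * ⟦F⟧ c v      ≡⟨ sum-nonneg-zero nonneg total c ⟩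
      0ℚ                               ∎
      where
      open ≡-Reasoning
      nonneg : ∀ u → 0ℚ ≤ ⟦V⟧ u * z u v - ½ * ⟦F⟧ u v
      nonneg u with frac? u v
      ... | yes f = ℚ.≤-reflexive (sym (cong₂ (λ a b → a * b - ½ * 1ℚ) (does-true (V₃? u) (covered-V₃ (v , frac-sym f))) (z-frac f)))
      ... | no _ = subst (0ℚ ≤_) (sym (ℚ.+-identityʳ (⟦V⟧ u * z u v))) (*-nonneg (⟦⟧-nonneg (does (V₃? u))) (proj₁ (z-bounds u v)))
      total : sum (λ u → ⟦V⟧ u * z u v - ½ * ⟦F⟧ u v) ≡ 0ℚ
      total = trans (sum-minus (λ u → ⟦V⟧ u * z u v) (λ u → ½ * ⟦F⟧ u v))
        (cong₂ _-_ (other (covered-V₃ cv) v≢c) (trans (sym (*-distribˡ-sum ½ (λ u → ⟦F⟧ u v)))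
          (cong (½ *_) (trans (fdeg-W v) (cong₂ _+_ (does-true (covered? v) cv) (does-true (covered? v) cv))))))

    -- Covered vertices not joined to `c` in F contribute nothing to the row of `c`. Summed over
    -- `v`, the inequality leaves at most three covered vertices besides the at most two neighbours
    -- of `c` in F: five, where six are needed.
    budget : ∀ v → ⟦V⟧ v * z v c + ⟦W⟧ v ≤ ⟦V⟧ v + ⟦F⟧ v c
    budget v with frac? v c
    ... | yes f = ℚ.+-mono-≤ (subst (⟦V⟧ v * z v c ≤_) (ℚ.*-identityʳ (⟦V⟧ v)) (scaled v)) (⟦⟧≤1 (does (covered? v)))
      where
      scaled : ∀ v → ⟦V⟧ v * z v c ≤ ⟦V⟧ v * 1ℚ
      scaled v = ℚ.*-monoˡ-≤-nonNeg (⟦V⟧ v) {{ℚ.nonNegative (⟦⟧-nonneg (does (V₃? v)))}} (proj₂ (z-bounds v c))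
    ... | no ¬f with covered? v
    ...   | no _ = ℚ.+-mono-≤ (subst (⟦V⟧ v * z v c ≤_) (ℚ.*-identityʳ (⟦V⟧ v))
              (ℚ.*-monoˡ-≤-nonNeg (⟦V⟧ v) {{ℚ.nonNegative (⟦⟧-nonneg (does (V₃? v)))}} (proj₂ (z-bounds v c)))) ℚ.≤-refl
    ...   | yes cv = ℚ.≤-reflexive (trans (cong₂ (λ a b → a * b + 1ℚ) (does-true (V₃? v) (covered-V₃ cv)) z≡0)
              (cong (_+ 0ℚ) (sym (does-true (V₃? v) (covered-V₃ cv)))))
      where
      z≡0 : z v c ≡ 0ℚ
      z≡0 = case v ≟ c of λ where
        (yes refl) → z-diag v
        (no v≢c) → saturated cv v≢c ¬f

    five : sum ⟦W⟧ ≤ ℕtoℚ 5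
    five = ℚ.≤-trans (≤-by {sum ⟦W⟧} {ℕtoℚ 3 + fdeg c} _ (0≤- (sum-mono budget)) eq)
      (ℚ.+-monoʳ-≤ (ℕtoℚ 3) (subst (_≤ 1ℚ + 1ℚ) (sym (fdeg-W c)) (ℚ.+-mono-≤ (⟦⟧≤1 (does (covered? c))) (⟦⟧≤1 (does (covered? c))))))
      where
      eq : ℕtoℚ 3 + fdeg c ≡ sum ⟦W⟧ + (sum (λ v → ⟦V⟧ v + ⟦F⟧ v c) - sum (λ v → ⟦V⟧ v * z v c + ⟦W⟧ v))
      eq = trans (solve 4 (λ K t f w → t :+ f := w :+ (((K :+ t) :+ f) :- (K :+ w))) refl K (ℕtoℚ 3) (fdeg c) (sum ⟦W⟧))
        (cong (sum ⟦W⟧ +_) (cong₂ _-_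
          (trans (cong (_+ fdeg c) (sym size)) (sym (∑-distrib-+ ⟦V⟧ (λ v → ⟦F⟧ v c))))
          (trans (cong (_+ sum ⟦W⟧) (sym centre)) (sym (∑-distrib-+ (λ v → ⟦V⟧ v * z v c) ⟦W⟧)))))

    star-uncovered : ∀ {v} → ¬ Covered v
    star-uncovered cv = ℕ.<⇒≱ (ℕ.n<1+n 5) (ℕtoℚ-cancel-≤ {6} {5} (ℚ.≤-trans (six≤covered cv covered? id) five))

  -- In U one vertex has degree 4 and the others 2; in Ū one has degree 1 and the others 3. The form
  -- `t + s * [ v ≐ g 0F ]` covers both, and `s ≢ 0ℚ` is the exception.
  module Hexad (g : Fin 6 → Fin n) (g-V : ∀ a → p (g a) ≡ 2F) (g-onto : ∀ v → p v ≡ 2F → ∃[ a ] g a ≡ v)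
    (t s : ℚ) (s≢0 : s ≢ 0ℚ) (rows : ∀ {v} → p v ≡ 2F → Vsum x v ≡ t + s * [ v ≐ g 0F ]) where

    complete : ∀ {vs} → Unique vs → All (λ v → p v ≡ 2F) vs → length vs ≡ 6 → ∀ {v} → p v ≡ 2F → v ∈ vs
    complete = unique-exhausts g g-onto

    module Listed {vs : List (Fin n)} (vs! : Unique vs) (vs-V : All (λ v → p v ≡ 2F) vs) (len : length vs ≡ 6) where

      listed-sum : (f : Fin n → ℚ) → (∀ v → p v ≢ 2F → f v ≡ 0ℚ) → sum f ≡ sum (f ∘ List.lookup vs)
      listed-sum f f≡0 = sum-image (List.lookup vs) (unique-lookup-injective vs!) f (λ v off → f≡0 v (λ pv →
        let v∈ = complete vs! vs-V len pv in off (Any.index v∈) (sym (Any.lookup-index v∈))))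

      listed-row : ∀ {v} → p v ≡ 2F → sum (λ i → x (List.lookup vs i) v) ≡ t + s * [ v ≐ g 0F ]
      listed-row {v} pv = trans (sym (trans
        (listed-sum (λ u → ⟦V⟧ u * x u v) (λ u pu → trans (cong (_* x u v) (does-false (V₃? u) pu)) (ℚ.*-zeroˡ (x u v))))
        (sum-cong-≗ (λ i → trans (cong (_* x (List.lookup vs i) v) (does-true (V₃? (List.lookup vs i)) (All.lookup vs-V (List.∈-lookup {xs = vs} i))))
          (ℚ.*-identityˡ (x (List.lookup vs i) v)))))) (rows pv)

      listed-centre : sum (λ i → [ List.lookup vs i ≐ g 0F ]) ≡ 1ℚ
      listed-centre = trans (sym (listed-sum (λ v → [ v ≐ g 0F ]) (λ v pv → ≐-≢ (λ e → pv (trans (cong p e) (g-V 0F)))))) (sum-≐ (g 0F))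

    -- With two triangles every edge between them is integral, so both triangles have the same degree sum,
    -- which is impossible as exactly one of them contains the exceptional vertex.
    two-triangles-impossible : ∀ {a b c d e f} → Unique (d ∷ e ∷ f ∷ a ∷ b ∷ c ∷ []) → All (λ v → p v ≡ 2F) (d ∷ e ∷ f ∷ a ∷ b ∷ c ∷ []) →
      Frac b a → Frac c a → Frac c b → Frac e d → Frac f d → Frac f e → ⊥
    two-triangles-impossible {a} {b} {c} {d} {e} {f} vs! vs-V@(dV ∷ eV ∷ fV ∷ aV ∷ bV ∷ cV ∷ []) fba fca fcb fed ffd ffe =
      integral-not-fraction (subst Integral A≡½ A-integral) (ℚ.positive⁻¹ ½) (ℚ.*<* (ℤ.+<+ (s≤s (s≤s z≤n))))
      where
      open Listed vs! vs-V refl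
      I : Fin n → ℚ
      I v = [ v ≐ g 0F ]
      A B : ℚ
      A = I a + I b + I c
      B = I d + I e + I f
      A-integral : Integral A
      A-integral = integral-+ (integral-+ (integral-⟦⟧ (does (a ≟ g 0F))) (integral-⟦⟧ (does (b ≟ g 0F)))) (integral-⟦⟧ (does (c ≟ g 0F)))
      A≡B : A - B ≡ 0ℚ
      A≡B = *-zero-cancelˡ s≢0 (triangles-balance {t} {s} {I a} {I b} {I c} {I d} {I e} {I f}
        {x d a} {x d b} {x d c} {x e a} {x e b} {x e c} {x f a} {x f b} {x f c}
        (trans (sym (listed-row aV)) (last (x-diag a) (half fba) (half fca)))
        (trans (sym (listed-row bV)) (last (half (frac-sym fba)) (x-diag b) (half fcb)))
        (trans (sym (listed-row cV)) (last (half (frac-sym fca)) (half (frac-sym fcb)) (x-diag c)))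
        (trans (sym (listed-row dV)) (first (x-diag d) (half fed) (half ffd)))
        (trans (sym (listed-row eV)) (first (half (frac-sym fed)) (x-diag e) (half ffe)))
        (trans (sym (listed-row fV)) (first (half (frac-sym ffd)) (half (frac-sym ffe)) (x-diag f))))
        where
        last : ∀ {v i j k} → x a v ≡ i → x b v ≡ j → x c v ≡ k →
          x d v + (x e v + (x f v + (x a v + (x b v + (x c v + 0ℚ))))) ≡ x d v + (x e v + (x f v + (i + (j + (k + 0ℚ)))))
        last refl refl refl = refl
        first : ∀ {v i j k} → x d v ≡ i → x e v ≡ j → x f v ≡ k →
          x d v + (x e v + (x f v + (x a v + (x b v + (x c v + 0ℚ))))) ≡ i + (j + (k + (x v a + (x v b + (x v c + 0ℚ)))))
        first {v} refl refl refl = cong₂ (λ q r → x d v + (x e v + (x f v + (q + r)))) (x-sym a v)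
          (cong₂ (λ q r → q + (r + 0ℚ)) (x-sym b v) (x-sym c v))
      A≡½ : A ≡ ½
      A≡½ = trans (solve 6 (λ a b c d e f → a :+ b :+ c := con ½ :* ((d :+ (e :+ (f :+ (a :+ (b :+ (c :+ con 0ℚ)))))) :+ (a :+ b :+ c :- (d :+ e :+ f))))
          refl (I a) (I b) (I c) (I d) (I e) (I f))
        (trans (cong₂ (λ q r → ½ * (q + r)) listed-centre A≡B) refl)

    hexad-uncovered : ∀ {v} → ¬ Covered v
    hexad-uncovered cv = two-triangles-impossible distinct
        (covered-V₃ (_ , ed) ∷ covered-V₃ (_ , frac-sym ed) ∷ covered-V₃ (_ , frac-sym fd)
          ∷ covered-V₃ (_ , ba) ∷ covered-V₃ (_ , cb) ∷ covered-V₃ (_ , frac-sym cb) ∷ [])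
        ba ca cb ed fd fe
      where
      open TwoTriangles (hexad (λ vs! covered len cw → complete vs! (All.map covered-V₃ covered) len (covered-V₃ cw)) cv)

-- Degrees in the exceptional graphs

≐-sym : ∀ {n} (i j : Fin n) → [ i ≐ j ] ≡ [ j ≐ i ]
≐-sym i j with i ≟ j
... | yes refl = sym (≐-refl i)
... | no i≢j   = sym (≐-≢ (i≢j ∘ sym))

≐-injective : ∀ {k n} {g : Fin k → Fin n} → Injective _≡_ _≡_ g → ∀ a b → [ g a ≐ g b ] ≡ [ a ≐ b ]
≐-injective {g = g} g-inj a b with a ≟ b
... | yes refl = ≐-refl (g a)
... | no a≢b   = ≐-≢ (a≢b ∘ g-inj)

≡ᵇ-refl : ∀ i → (i ℕ.≡ᵇ i) ≡ true
≡ᵇ-refl zero    = refl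
≡ᵇ-refl (suc i) = ≡ᵇ-refl i

≡ᵇ-≢ : ∀ {i j} → i ≢ j → (i ℕ.≡ᵇ j) ≡ false
≡ᵇ-≢ {zero}  {zero}  i≢j = contradiction refl i≢j
≡ᵇ-≢ {zero}  {suc j} _   = refl
≡ᵇ-≢ {suc i} {zero}  _   = refl
≡ᵇ-≢ {suc i} {suc j} i≢j = ≡ᵇ-≢ (i≢j ∘ cong suc)

<ᵇ-true : ∀ {i j} → i ℕ.< j → (i ℕ.<ᵇ j) ≡ true
<ᵇ-true {zero}  (s≤s _) = refl
<ᵇ-true {suc i} {suc j} (s≤s i<j) = <ᵇ-true i<j

<ᵇ-false : ∀ {i j} → j ℕ.≤ i → (i ℕ.<ᵇ j) ≡ false
<ᵇ-false {i} {zero}  z≤n = refl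
<ᵇ-false {suc i} {suc j} (s≤s j≤i) = <ᵇ-false j≤i

≤ᵇ-true : ∀ {i j} → i ℕ.≤ j → (i ℕ.≤ᵇ j) ≡ true
≤ᵇ-true {zero}  _ = refl
≤ᵇ-true {suc i} i<j = <ᵇ-true i<j

≤ᵇ-false : ∀ {i j} → j ℕ.< i → (i ℕ.≤ᵇ j) ≡ false
≤ᵇ-false {suc i} (s≤s j≤i) = <ᵇ-false j≤i

-- Terms indexed by naturals allow the length `m + 3` to be rewritten as `3 + m` without
-- transporting indices.
sumTo : ℕ → (ℕ → ℚ) → ℚ
sumTo k φ = sum {k} (φ ∘ toℕ)

sumTo-last : ∀ m φ → sumTo (m ℕ.+ 3) φ ≡ sumTo m φ + (φ m + (φ (suc m) + φ (suc (suc m))))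
sumTo-last zero φ = solve 3 (λ a b c → a :+ (b :+ (c :+ con 0ℚ)) := con 0ℚ :+ (a :+ (b :+ c))) refl (φ 0) (φ 1) (φ 2)
sumTo-last (suc m) φ = trans (cong (φ 0 +_) (sumTo-last m (φ ∘ suc))) (sym (ℚ.+-assoc (φ 0) (sumTo m (φ ∘ suc)) _))

sumTo-const : ∀ m {φ} q → (∀ {j} → j ℕ.< m → φ j ≡ q) → sumTo m φ ≡ sum {m} (λ _ → q)
sumTo-const m q h = sum-cong-≗ (λ j → h (Fin.toℕ<n j))

U-row : ∀ a → sum (λ b → ⟦ U b a ⟧) ≡ ℕtoℚ 2 + ℕtoℚ 2 * [ a ≐ 0F ]
U-row 0F = refl
U-row 1F = refl
U-row 2F = refl
U-row 3F = refl
U-row 4F = refl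
U-row 5F = refl

Ū-row : ∀ a → sum (λ b → ⟦ Ū b a ⟧) ≡ ℕtoℚ 3 + - ℕtoℚ 2 * [ a ≐ 0F ]
Ū-row 0F = refl
Ū-row 1F = refl
Ū-row 2F = refl
Ū-row 3F = refl
Ū-row 4F = refl
Ū-row 5F = refl

starAdj : ℕ → ℕ → Bool
starAdj i j = not (i ℕ.≡ᵇ j) ∧ (e i j ∨ e j i)
  where
  e : ℕ → ℕ → Bool
  e a b = ((a ℕ.≡ᵇ 0) ∧ (b ℕ.≡ᵇ 1)) ∨ ((a ℕ.≡ᵇ 2) ∧ (3 ℕ.≤ᵇ b))

starRow : ℕ → ℕ → ℚ
starRow m 2 = ℕtoℚ m
starRow m _ = 1ℚ

K₂+K₁ₘ-row : ∀ m a → sum (λ b → ⟦ K₂+K₁ₘ m b a ⟧) ≡ starRow m (toℕ a)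
K₂+K₁ₘ-row m a = trans (cong (λ k → sumTo k (λ j → ⟦ starAdj j (toℕ a) ⟧)) (ℕ.+-comm m 3)) (row (toℕ a))
  where
  row : ∀ i → sumTo (3 ℕ.+ m) (λ j → ⟦ starAdj j i ⟧) ≡ starRow m i
  row 0 = cong (λ s → 0ℚ + (1ℚ + (0ℚ + s))) (sum-zero {m} _ (λ _ → refl))
  row 1 = cong (λ s → 1ℚ + (0ℚ + (0ℚ + s))) (sum-zero {m} _ (λ _ → refl))
  row 2 = trans (cong (λ s → 0ℚ + (0ℚ + (0ℚ + s))) (sum-one m)) (solve 1 (λ s → con 0ℚ :+ (con 0ℚ :+ (con 0ℚ :+ s)) := s) refl (ℕtoℚ m))
  row (suc (suc (suc i))) = cong (λ s → 0ℚ + (0ℚ + (1ℚ + s)))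
    (sum-zero {m} _ (λ j → cong ⟦_⟧ (Bool.∧-zeroʳ (not (toℕ j ℕ.≡ᵇ i)))))

coAdj : ℕ → ℕ → ℕ → Bool
coAdj m i j = not (i ℕ.≡ᵇ j) ∧ (e i j ∨ e j i)
  where
  e : ℕ → ℕ → Bool
  e a b = ((a ℕ.<ᵇ m) ∧ (b ℕ.<ᵇ m)) ∨ ((a ℕ.≤ᵇ m) ∧ (m ℕ.<ᵇ b))

-- Adjacency in the complement of (Kₘ + K₁) ∨ 2K₁: a star with centre `m` and leaves below `m`,
-- together with an edge between `suc m` and `suc (suc m)`.
coVal : ℕ → ℕ → ℕ → ℚ
coVal m i j = 1ℚ - ⟦ coAdj m j i ⟧ - ⟦ j ℕ.≡ᵇ i ⟧

module _ (m : ℕ) where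

  coVal-diag : ∀ i → coVal m i i ≡ 0ℚ
  coVal-diag i rewrite ≡ᵇ-refl i = refl

  coVal-edge : ∀ {i j} → j ≢ i → coAdj m j i ≡ true → coVal m i j ≡ 0ℚ
  coVal-edge {i} {j} j≢i e = cong₂ (λ b c → 1ℚ - ⟦ b ⟧ - ⟦ c ⟧) e (≡ᵇ-≢ j≢i)

  coVal-nonedge : ∀ {i j} → j ≢ i → coAdj m j i ≡ false → coVal m i j ≡ 1ℚ
  coVal-nonedge {i} {j} j≢i e = cong₂ (λ b c → 1ℚ - ⟦ b ⟧ - ⟦ c ⟧) e (≡ᵇ-≢ j≢i)

  coAdj-clique : ∀ {i j} → i ≢ j → i ℕ.< m → j ℕ.< m → coAdj m i j ≡ true
  coAdj-clique i≢j i<m j<m rewrite ≡ᵇ-≢ i≢j | <ᵇ-true i<m | <ᵇ-true j<m = refl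

  coAdj-far : ∀ {i j} → i ℕ.≤ m → m ℕ.< j → coAdj m i j ≡ true
  coAdj-far {i} {j} i≤m m<j
    rewrite ≡ᵇ-≢ (ℕ.<⇒≢ (ℕ.≤-<-trans i≤m m<j)) | ≤ᵇ-true i≤m | <ᵇ-true m<j | Bool.∨-zeroʳ ((i ℕ.<ᵇ m) ∧ (j ℕ.<ᵇ m)) = refl

  coAdj-far′ : ∀ {i j} → m ℕ.< i → j ℕ.≤ m → coAdj m i j ≡ true
  coAdj-far′ {i} {j} m<i j≤m
    rewrite ≡ᵇ-≢ (ℕ.>⇒≢ (ℕ.≤-<-trans j≤m m<i)) | ≤ᵇ-true j≤m | <ᵇ-true m<i | Bool.∨-zeroʳ ((j ℕ.<ᵇ m) ∧ (i ℕ.<ᵇ m))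
          | Bool.∨-zeroʳ (((i ℕ.<ᵇ m) ∧ (j ℕ.<ᵇ m)) ∨ ((i ℕ.≤ᵇ m) ∧ (m ℕ.<ᵇ j))) = refl

  coAdj-centre : ∀ {i} → i ℕ.< m → coAdj m i m ≡ false
  coAdj-centre {i} i<m
    rewrite ≡ᵇ-≢ (ℕ.<⇒≢ i<m) | <ᵇ-false (ℕ.≤-refl {m}) | <ᵇ-true i<m | ≤ᵇ-true (ℕ.<⇒≤ i<m) | ≤ᵇ-true (ℕ.≤-refl {m}) | <ᵇ-false (ℕ.<⇒≤ i<m) = refl

  coAdj-centre′ : ∀ {j} → j ℕ.< m → coAdj m m j ≡ false
  coAdj-centre′ {j} j<m
    rewrite ≡ᵇ-≢ (ℕ.>⇒≢ j<m) | <ᵇ-false (ℕ.≤-refl {m}) | <ᵇ-true j<m | ≤ᵇ-true (ℕ.<⇒≤ j<m) | ≤ᵇ-true (ℕ.≤-refl {m}) | <ᵇ-false (ℕ.<⇒≤ j<m) = refl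

  coAdj-pair : ∀ {i j} → m ℕ.< i → m ℕ.< j → coAdj m i j ≡ false
  coAdj-pair {i} {j} m<i m<j
    rewrite <ᵇ-false (ℕ.<⇒≤ m<i) | <ᵇ-false (ℕ.<⇒≤ m<j) | ≤ᵇ-false m<i | ≤ᵇ-false m<j = Bool.∧-zeroʳ (not (i ℕ.≡ᵇ j))

  coVal-clique : ∀ {i j} → i ℕ.< m → j ℕ.< m → coVal m i j ≡ 0ℚ
  coVal-clique {i} {j} i<m j<m with j ℕ.≟ i
  ... | yes refl = coVal-diag i
  ... | no j≢i = coVal-edge j≢i (coAdj-clique j≢i j<m i<m)

  coVal-far : ∀ {i j} → i ℕ.≤ m → m ℕ.< j → coVal m i j ≡ 0ℚ
  coVal-far i≤m m<j = coVal-edge (ℕ.>⇒≢ (ℕ.≤-<-trans i≤m m<j)) (coAdj-far′ m<j i≤m)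

  coVal-far′ : ∀ {i j} → m ℕ.< i → j ℕ.≤ m → coVal m i j ≡ 0ℚ
  coVal-far′ m<i j≤m = coVal-edge (ℕ.<⇒≢ (ℕ.≤-<-trans j≤m m<i)) (coAdj-far j≤m m<i)

  coVal-centre : ∀ {i} → i ℕ.< m → coVal m i m ≡ 1ℚ
  coVal-centre i<m = coVal-nonedge (ℕ.>⇒≢ i<m) (coAdj-centre′ i<m)

  coVal-centre′ : ∀ {j} → j ℕ.< m → coVal m m j ≡ 1ℚ
  coVal-centre′ j<m = coVal-nonedge (ℕ.<⇒≢ j<m) (coAdj-centre j<m)

  coVal-pair : ∀ {i j} → i ≢ j → m ℕ.< i → m ℕ.< j → coVal m i j ≡ 1ℚ
  coVal-pair i≢j m<i m<j = coVal-nonedge (i≢j ∘ sym) (coAdj-pair m<j m<i)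

  coRow : ∀ {i} → i ℕ.< m ℕ.+ 3 → i ≢ m → sumTo (m ℕ.+ 3) (coVal m i) ≡ 1ℚ
  coRow {i} i<m+3 i≢m = trans (sumTo-last m (coVal m i)) (go (ℕ.<-cmp i m))
    where
    go : Tri (i ℕ.< m) (i ≡ m) (m ℕ.< i) →
      sumTo m (coVal m i) + (coVal m i m + (coVal m i (suc m) + coVal m i (suc (suc m)))) ≡ 1ℚ
    go (tri< i<m _ _) = cong₂ _+_ (trans (sumTo-const m {coVal m i} 0ℚ (coVal-clique i<m)) (sum-zero {m} _ (λ _ → refl)))
      (cong₂ _+_ (coVal-centre i<m) (cong₂ _+_ (coVal-far (ℕ.<⇒≤ i<m) (ℕ.n<1+n m)) (coVal-far (ℕ.<⇒≤ i<m) (ℕ.m≤n⇒m≤1+n (ℕ.n<1+n m)))))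
    go (tri≈ _ i≡m _) = contradiction i≡m i≢m
    go (tri> _ _ m<i) = cong₂ _+_
      (trans (sumTo-const m {coVal m i} 0ℚ (λ j<m → coVal-far′ m<i (ℕ.<⇒≤ j<m))) (sum-zero {m} _ (λ _ → refl)))
      (cong₂ _+_ (coVal-far′ m<i ℕ.≤-refl) (last-two (i ℕ.≟ suc m)))
      where
      last-two : Dec (i ≡ suc m) → coVal m i (suc m) + coVal m i (suc (suc m)) ≡ 1ℚ
      last-two (yes refl) = cong₂ _+_ (coVal-diag (suc m)) (coVal-pair (ℕ.<⇒≢ (ℕ.n<1+n (suc m))) m<i (ℕ.m≤n⇒m≤1+n (ℕ.n<1+n m)))
      last-two (no i≢1+m) = cong₂ _+_ (coVal-pair i≢1+m m<i (ℕ.n<1+n m)) (subst (λ j → coVal m i j ≡ 0ℚ) i≡2+m (coVal-diag i))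
        where
        i≡2+m : i ≡ suc (suc m)
        i≡2+m = ℕ.≤-antisym (ℕ.≤-pred (subst (i ℕ.<_) (ℕ.+-comm m 3) i<m+3)) (ℕ.≤∧≢⇒< m<i (i≢1+m ∘ sym))

  coRow-centre : sumTo (m ℕ.+ 3) (coVal m m) ≡ ℕtoℚ m
  coRow-centre = trans (sumTo-last m (coVal m m)) (trans
    (cong₂ _+_ (trans (sumTo-const m {coVal m m} 1ℚ coVal-centre′) (sum-one m))
      (cong₂ _+_ (coVal-diag m) (cong₂ _+_ (coVal-far ℕ.≤-refl (ℕ.n<1+n m)) (coVal-far ℕ.≤-refl (ℕ.m≤n⇒m≤1+n (ℕ.n<1+n m))))))
    (ℚ.+-identityʳ (ℕtoℚ m)))

≐-toℕ : ∀ {k} (a b : Fin k) → [ a ≐ b ] ≡ ⟦ toℕ a ℕ.≡ᵇ toℕ b ⟧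
≐-toℕ a b with a ≟ b
... | yes refl = cong ⟦_⟧ (sym (≡ᵇ-refl (toℕ a)))
... | no a≢b   = cong ⟦_⟧ (sym (≡ᵇ-≢ (a≢b ∘ Fin.toℕ-injective)))

ℕtoℚ-2≢0 : ℕtoℚ 2 ≢ 0ℚ
ℕtoℚ-2≢0 ()

good-vertex-integral : ∀ {n} {d : Fin n → ℕ} {G : Graph n} → Realization d G → HasGoodPartition G →
  ∀ {x : Point n} → IsVertex d x → ∀ i j → (x i j ≡ 0ℚ) ⊎ (x i j ≡ 1ℚ)
good-vertex-integral {n} {d} {G} real (p , indep , clique , joined , disjoint , types) {x} vertex = integral types
  where
  open Separated {G = G} (realizes real) (vertexOf vertex) p indep clique joined disjoint

  from-uncovered : (∀ {v} → ¬ Covered v) → ∀ i j → (x i j ≡ 0ℚ) ⊎ (x i j ≡ 1ℚ)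
  from-uncovered uncovered i j = not-frac (λ f → uncovered (i , f))

  module Iso {k} {H : Graph k} (iso : InducedIso G (λ v → p v ≡ 2F) H) where
    g = proj₁ iso
    g-inj : Injective _≡_ _≡_ g
    g-inj = proj₁ (proj₂ iso)
    g-V = proj₁ (proj₂ (proj₂ iso))
    g-onto = proj₁ (proj₂ (proj₂ (proj₂ iso)))
    g-adj = proj₂ (proj₂ (proj₂ (proj₂ iso)))

    V-sum : (f : Fin n → ℚ) → sum (λ u → ⟦V⟧ u * f u) ≡ sum (f ∘ g)
    V-sum f = trans (sum-image g g-inj (λ u → ⟦V⟧ u * f u)
        (λ u off → trans (cong (_* f u) (does-false (V₃? u) (λ pu → let a , e = g-onto u pu in off a e))) (ℚ.*-zeroˡ (f u))))
      (sum-cong-≗ (λ a → trans (cong (_* f (g a)) (does-true (V₃? (g a)) (g-V a))) (ℚ.*-identityˡ (f (g a)))))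

    size : sum ⟦V⟧ ≡ ℕtoℚ k
    size = trans (sum-cong-≗ (λ u → sym (ℚ.*-identityʳ (⟦V⟧ u)))) (trans (V-sum (λ _ → 1ℚ)) (sum-one k))

    row : ∀ a → Vsum x (g a) ≡ sum (λ b → ⟦ H b a ⟧)
    row a = trans (V-row (g-V a)) (trans (V-sum (λ u → ⟦ G u (g a) ⟧)) (sum-cong-≗ (λ b → cong ⟦_⟧ (sym (g-adj b a)))))

    hexad-rows : ∀ t s (a₀ : Fin k) → (∀ a → sum (λ b → ⟦ H b a ⟧) ≡ t + s * [ a ≐ a₀ ]) →
      ∀ {v} → p v ≡ 2F → Vsum x v ≡ t + s * [ v ≐ g a₀ ]
    hexad-rows t s a₀ degrees {v} pv with g-onto v pv
    ... | a , refl = trans (row a) (trans (degrees a) (cong (λ q → t + s * q) (sym (≐-injective g-inj a a₀))))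

  -- Subtracting also the identity keeps the diagonal zero. The bounds and the value ½ on F are
  -- preserved, as `Star` requires.
  complement : Point n
  complement u v = 1ℚ - x u v - [ u ≐ v ]

  complement-bounds : ∀ u v → (0ℚ ≤ complement u v) × (complement u v ≤ 1ℚ)
  complement-bounds u v with u ≟ v
  ... | yes refl = subst (λ q → (0ℚ ≤ 1ℚ - q - 1ℚ) × (1ℚ - q - 1ℚ ≤ 1ℚ)) (sym (x-diag u)) (ℚ.≤-refl , 0≤1)
  ... | no _ = subst (0ℚ ≤_) (sym (ℚ.+-identityʳ (1ℚ - x u v))) (0≤- (proj₂ (x-bounds u v))) ,
    ≤-by _ (proj₁ (x-bounds u v)) (solve 1 (λ x → con 1ℚ := (con 1ℚ :- x :- con 0ℚ) :+ x) refl (x u v))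

  integral : (SplitOn G (λ v → p v ≡ 2F)
      ⊎ length (filter V₃? (allFin n)) ℕ.< 6
      ⊎ InducedIso G (λ v → p v ≡ 2F) U
      ⊎ InducedIso G (λ v → p v ≡ 2F) Ū
      ⊎ (∃[ m ] 3 ℕ.≤ m × InducedIso G (λ v → p v ≡ 2F) (K₂+K₁ₘ m))
      ⊎ (∃[ m ] 3 ℕ.≤ m × InducedIso G (λ v → p v ≡ 2F) (Kₘ+K₁∨2K₁ m))) →
    ∀ i j → (x i j ≡ 0ℚ) ⊎ (x i j ≡ 1ℚ)
  -- A split V₃ can be distributed over V₁ and V₂. The refined partition has an empty third part,
  -- where all covered vertices would have to lie.
  integral (inj₁ (q , split)) i j = S.not-frac (λ f → not-V₃ i (S.covered-V₃ {i} (j , S.frac-sym f)))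
    where
    side : Bool → Fin 3
    side false = 0F
    side true = 1F
    p′ : Fin n → Fin 3
    p′ v with p v
    ... | 2F = side (q v)
    ... | i = i
    side-0 : ∀ b → side b ≡ 0F → b ≡ false
    side-0 false _ = refl
    side-1 : ∀ b → side b ≡ 1F → b ≡ true
    side-1 true _ = refl
    side-2 : ∀ b → side b ≢ 2F
    side-2 false ()
    side-2 true ()
    not-V₃ : ∀ v → p′ v ≢ 2F
    not-V₃ v e with p v | e
    ... | 2F | e = side-2 (q v) e
    part-0 : ∀ v → p′ v ≡ 0F → p v ≡ 0F ⊎ (p v ≡ 2F × q v ≡ false)
    part-0 v e with p v | e
    ... | 0F | _ = inj₁ refl
    ... | 2F | e = inj₂ (refl , side-0 (q v) e)
    part-1 : ∀ v → p′ v ≡ 1F → p v ≡ 1F ⊎ (p v ≡ 2F × q v ≡ true)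
    part-1 v e with p v | e
    ... | 1F | _ = inj₁ refl
    ... | 2F | e = inj₂ (refl , side-1 (q v) e)
    indep′ : ∀ u v → p′ u ≡ 0F → p′ v ≡ 0F → G u v ≡ false
    indep′ u v pu pv with part-0 u pu | part-0 v pv
    ... | inj₁ a | inj₁ b = indep u v a b
    ... | inj₁ a | inj₂ (b , _) = trans (G-sym u v) (disjoint v u b a)
    ... | inj₂ (a , _) | inj₁ b = disjoint u v a b
    ... | inj₂ (a , qu) | inj₂ (b , qv) with u ≟ v
    ...   | yes refl = proj₂ (proj₁ real) u
    ...   | no u≢v = proj₁ (split u v a b u≢v) qu qv
    clique′ : ∀ u v → u ≢ v → p′ u ≡ 1F → p′ v ≡ 1F → G u v ≡ true
    clique′ u v u≢v pu pv with part-1 u pu | part-1 v pv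
    ... | inj₁ a | inj₁ b = clique u v u≢v a b
    ... | inj₁ a | inj₂ (b , _) = trans (G-sym u v) (joined v u b a)
    ... | inj₂ (a , _) | inj₁ b = joined u v a b
    ... | inj₂ (a , qu) | inj₂ (b , qv) = proj₂ (split u v a b u≢v) qu qv
    module S = Separated {G = G} (realizes real) (vertexOf vertex) p′ indep′ clique′
      (λ u _ pu _ → contradiction pu (not-V₃ u)) (λ u _ pu _ → contradiction pu (not-V₃ u))
  integral (inj₂ (inj₁ V<6)) = from-uncovered (small-uncovered V<6)
  integral (inj₂ (inj₂ (inj₁ iso))) = from-uncovered (Hexad.hexad-uncovered g g-V g-onto (ℕtoℚ 2) (ℕtoℚ 2) ℕtoℚ-2≢0 (hexad-rows (ℕtoℚ 2) (ℕtoℚ 2) 0F U-row))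
    where open Iso iso
  integral (inj₂ (inj₂ (inj₂ (inj₁ iso)))) =
    from-uncovered (Hexad.hexad-uncovered g g-V g-onto (ℕtoℚ 3) (- ℕtoℚ 2) (λ ()) (hexad-rows (ℕtoℚ 3) (- ℕtoℚ 2) 0F Ū-row))
    where open Iso iso
  integral (inj₂ (inj₂ (inj₂ (inj₂ (inj₁ (m , _ , iso)))))) = from-uncovered
    (Star.star-uncovered x x-sym x-bounds x-diag half (g c) (g-V c) (ℕtoℚ m) centre (trans size (ℕtoℚ-+ m 3)) other)
    where
    open Iso iso
    2<m+3 : 2 ℕ.< m ℕ.+ 3
    2<m+3 = ℕ.m≤n+m 3 m
    c : Fin (m ℕ.+ 3)
    c = Fin.fromℕ< 2<m+3
    toℕ-c : toℕ c ≡ 2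
    toℕ-c = Fin.toℕ-fromℕ< 2<m+3
    centre : Vsum x (g c) ≡ ℕtoℚ m
    centre = trans (row c) (trans (K₂+K₁ₘ-row m c) (cong (starRow m) toℕ-c))
    starRow-other : ∀ i → i ≢ 2 → starRow m i ≡ 1ℚ
    starRow-other 0 _ = refl
    starRow-other 1 _ = refl
    starRow-other 2 ne = contradiction refl ne
    starRow-other (suc (suc (suc i))) _ = refl
    other : ∀ {v} → p v ≡ 2F → v ≢ g c → Vsum x v ≡ 1ℚ
    other {v} pv v≢c with g-onto v pv
    ... | a , refl = trans (row a) (trans (K₂+K₁ₘ-row m a)
      (starRow-other (toℕ a) (λ e → v≢c (cong g (Fin.toℕ-injective (trans e (sym toℕ-c)))))))
  integral (inj₂ (inj₂ (inj₂ (inj₂ (inj₂ (m , _ , iso)))))) = from-uncovered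
    (Star.star-uncovered complement
      (λ u v → cong₂ (λ a b → 1ℚ - a - b) (x-sym u v) (≐-sym u v)) complement-bounds
      (λ u → cong₂ (λ a b → 1ℚ - a - b) (x-diag u) (≐-refl u))
      (λ f → cong₂ (λ a b → 1ℚ - a - b) (half f) (≐-≢ (frac-≢ f)))
      (g c) (g-V c) (ℕtoℚ m) centre (trans size (ℕtoℚ-+ m 3)) other)
    where
    open Iso iso
    m<m+3 : m ℕ.< m ℕ.+ 3
    m<m+3 = ℕ.m<m+n m (s≤s z≤n)
    c : Fin (m ℕ.+ 3)
    c = Fin.fromℕ< m<m+3
    toℕ-c : toℕ c ≡ m
    toℕ-c = Fin.toℕ-fromℕ< m<m+3
    co-row : ∀ a → Vsum complement (g a) ≡ sumTo (m ℕ.+ 3) (coVal m (toℕ a))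
    co-row a = begin
      Vsum complement (g a)
        ≡⟨ sum-cong-≗ (λ u → solve 3 (λ V x d → V :* (con 1ℚ :- x :- d) := V :* (con 1ℚ :- d) :- V :* x) refl (⟦V⟧ u) (x u (g a)) [ u ≐ g a ]) ⟩
      sum (λ u → ⟦V⟧ u * (1ℚ - [ u ≐ g a ]) - ⟦V⟧ u * x u (g a))
        ≡⟨ sum-minus (λ u → ⟦V⟧ u * (1ℚ - [ u ≐ g a ])) (λ u → ⟦V⟧ u * x u (g a)) ⟩
      sum (λ u → ⟦V⟧ u * (1ℚ - [ u ≐ g a ])) - Vsum x (g a)
        ≡⟨ cong₂ _-_ (V-sum (λ u → 1ℚ - [ u ≐ g a ])) (row a) ⟩
      sum (λ b → 1ℚ - [ g b ≐ g a ]) - sum (λ b → ⟦ Kₘ+K₁∨2K₁ m b a ⟧)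
        ≡⟨ sum-minus (λ b → 1ℚ - [ g b ≐ g a ]) (λ b → ⟦ Kₘ+K₁∨2K₁ m b a ⟧) ⟨
      sum (λ b → (1ℚ - [ g b ≐ g a ]) - ⟦ coAdj m (toℕ b) (toℕ a) ⟧)
        ≡⟨ sum-cong-≗ (λ b → trans
             (cong (λ q → (1ℚ - q) - ⟦ coAdj m (toℕ b) (toℕ a) ⟧) (trans (≐-injective g-inj b a) (≐-toℕ b a)))
             (solve 2 (λ d h → (con 1ℚ :- d) :- h := con 1ℚ :- h :- d) refl ⟦ toℕ b ℕ.≡ᵇ toℕ a ⟧ ⟦ coAdj m (toℕ b) (toℕ a) ⟧)) ⟩
      sumTo (m ℕ.+ 3) (coVal m (toℕ a)) ∎
      where open ≡-Reasoning
    centre : Vsum complement (g c) ≡ ℕtoℚ m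
    centre = trans (co-row c) (trans (cong (λ i → sumTo (m ℕ.+ 3) (coVal m i)) toℕ-c) (coRow-centre m))
    other : ∀ {v} → p v ≡ 2F → v ≢ g c → Vsum complement v ≡ 1ℚ
    other {v} pv v≢c with g-onto v pv
    ... | a , refl = trans (co-row a) (coRow m (Fin.toℕ<n a) (λ e → v≢c (cong g (Fin.toℕ-injective (trans e (sym toℕ-c))))))

-- Blossoms and half-integral vertices

module Overlay {k n} (f : Fin k → Fin n) (f-inj : Injective _≡_ _≡_ f) where

  image? : ∀ u → Dec (∃[ a ] f a ≡ u)
  image? u = Fin.any? (λ a → f a ≟ u)

  overlay : {A : Set} → (Fin k → Fin k → A) → (Fin n → Fin n → A) → Fin n → Fin n → A
  overlay K y u v with image? u | image? v
  ... | yes (a , _) | yes (b , _) = K a b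
  ... | yes _       | no _        = y u v
  ... | no _        | _           = y u v

  module _ {A : Set} (K : Fin k → Fin k → A) (y : Fin n → Fin n → A) where

    overlay-at : ∀ a b → overlay K y (f a) (f b) ≡ K a b
    overlay-at a b with image? (f a) | image? (f b)
    ... | yes (a′ , e) | yes (b′ , e′) = cong₂ K (f-inj e) (f-inj e′)
    ... | yes _ | no ∄ = contradiction (b , refl) ∄
    ... | no ∄ | _ = contradiction (a , refl) ∄

    overlay-off : ∀ {u} v → (∀ a → f a ≢ u) → overlay K y u v ≡ y u v
    overlay-off {u} v off with image? u
    ... | yes (a , e) = contradiction e (off a)
    ... | no _ = refl

    overlay-offʳ : ∀ u {v} → (∀ a → f a ≢ v) → overlay K y u v ≡ y u v
    overlay-offʳ u {v} off with image? u | image? v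
    ... | yes _ | yes (a , e) = contradiction e (off a)
    ... | yes _ | no _ = refl
    ... | no _ | _ = refl

    overlay-elim : (P : Fin n → Fin n → A → Set) → (∀ a b → P (f a) (f b) (K a b)) →
      (∀ u v → (∀ a b → f a ≡ u → f b ≢ v) → P u v (y u v)) → ∀ u v → P u v (overlay K y u v)
    overlay-elim P new old u v with image? u | image? v
    ... | yes (a , refl) | yes (b , refl) = new a b
    ... | yes _ | no ∄ = old u v (λ _ b _ e → ∄ (b , e))
    ... | no ∄ | _ = old u v (λ a _ e _ → ∄ (a , e))

    overlay-sym : (∀ a b → K a b ≡ K b a) → (∀ u v → y u v ≡ y v u) → ∀ u v → overlay K y u v ≡ overlay K y v u
    overlay-sym K-sym y-sym u v with image? u | image? v
    ... | yes (a , _) | yes (b , _) = K-sym a b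
    ... | yes _ | no _ = y-sym u v
    ... | no _ | yes _ = y-sym u v
    ... | no _ | no _ = y-sym u v

  -- The two matrices differ only inside the block, so a column changes by the difference of two
  -- block column sums, which is zero.
  overlay-row : (K : Fin k → Fin k → ℚ) (y : Point n) → (∀ b → sum (λ a → K a b) ≡ sum (λ a → y (f a) (f b))) →
    ∀ v → sum (λ u → overlay K y u v) ≡ sum (λ u → y u v)
  overlay-row K y rows v = trans (solve 2 (λ a b → a := (a :- b) :+ b) refl (sum (λ u → overlay K y u v)) (sum (λ u → y u v)))
    (trans (cong (_+ sum (λ u → y u v)) (trans (sym (sum-minus (λ u → overlay K y u v) (λ u → y u v)))
      (trans (sum-image f f-inj (λ u → overlay K y u v - y u v)
        (λ u off → trans (cong (_- y u v) (overlay-off K y v off)) (ℚ.+-inverseʳ (y u v))))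
        (balance (image? v))))) (ℚ.+-identityˡ _))
    where
    balance : Dec (∃[ b ] f b ≡ v) → sum (λ a → overlay K y (f a) v - y (f a) v) ≡ 0ℚ
    balance (yes (b , refl)) = trans (sum-cong-≗ (λ a → cong (_- y (f a) (f b)) (overlay-at K y a b)))
      (trans (sum-minus (λ a → K a b) (λ a → y (f a) (f b)))
        (trans (cong (_- sum (λ a → y (f a) (f b))) (rows b)) (ℚ.+-inverseʳ (sum (λ a → y (f a) (f b))))))
    balance (no ∄) = sum-zero {k} _ (λ a → trans (cong (_- y (f a) v) (overlay-offʳ K y (f a) (λ b e → ∄ (b , e)))) (ℚ.+-inverseʳ (y (f a) v)))

-- Two nonnegative products with sum zero are both zero, and the factors `l` and `1 - l` are not.
convex-zero : ∀ {l y z} → 0ℚ < l → l < 1ℚ → 0ℚ ≤ y → 0ℚ ≤ z → 0ℚ ≡ l * y + (1ℚ - l) * z → y ≡ z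
convex-zero {l} {y} {z} 0<l l<1 0≤y 0≤z eq =
  trans (*-zero-cancelˡ (ℚ.<⇒≢ 0<l ∘ sym) (nonneg-+-zero ly mz (sym eq)))
    (sym (*-zero-cancelˡ (ℚ.<⇒≢ (0<- l<1) ∘ sym) (nonneg-+-zero mz ly (trans (ℚ.+-comm ((1ℚ - l) * z) (l * y)) (sym eq)))))
  where
  ly = *-nonneg (ℚ.<⇒≤ 0<l) 0≤y
  mz = *-nonneg (ℚ.<⇒≤ (0<- l<1)) 0≤z

convex-one : ∀ {l y z} → 0ℚ < l → l < 1ℚ → y ≤ 1ℚ → z ≤ 1ℚ → 1ℚ ≡ l * y + (1ℚ - l) * z → y ≡ z
convex-one {l} {y} {z} 0<l l<1 y≤1 z≤1 eq = begin
  y             ≡⟨ solve 1 (λ y → y := con 1ℚ :- (con 1ℚ :- y)) refl y ⟩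
  1ℚ - (1ℚ - y) ≡⟨ cong (λ q → 1ℚ - q) (convex-zero 0<l l<1 (0≤- y≤1) (0≤- z≤1) eq′) ⟩
  1ℚ - (1ℚ - z) ≡⟨ solve 1 (λ z → con 1ℚ :- (con 1ℚ :- z) := z) refl z ⟩
  z             ∎
  where
  open ≡-Reasoning
  eq′ : 0ℚ ≡ l * (1ℚ - y) + (1ℚ - l) * (1ℚ - z)
  eq′ = trans (cong (λ q → 1ℚ - q) eq)
    (solve 3 (λ l y z → con 1ℚ :- (l :* y :+ (con 1ℚ :- l) :* z) := l :* (con 1ℚ :- y) :+ (con 1ℚ :- l) :* (con 1ℚ :- z)) refl l y z)

⟦not⟧ : ∀ b → ⟦ not b ⟧ ≡ 1ℚ - ⟦ b ⟧
⟦not⟧ true  = refl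
⟦not⟧ false = refl

-- At v₁ the statuses b, b, not b turn into ½, ½, b, both with sum `1 + B`; likewise at w₁ in
-- `balance-3`. At the other four vertices b and not b turn into two halves.
balance-0 : ∀ {p B q r s t u} → s ≡ B → t ≡ B → u ≡ 1ℚ - B →
  p + (½ + (½ + (B + (q + (r + 0ℚ))))) ≡ p + (s + (t + (u + (q + (r + 0ℚ)))))
balance-0 {p} {B} {q} {r} refl refl refl = solve 4 (λ B p q r →
  p :+ (con ½ :+ (con ½ :+ (B :+ (q :+ (r :+ con 0ℚ))))) := p :+ (B :+ (B :+ ((con 1ℚ :- B) :+ (q :+ (r :+ con 0ℚ)))))) refl B p q r

balance-1 : ∀ {p B q r s t u} → t ≡ B → u ≡ 1ℚ - B →
  ½ + (p + (½ + (q + (r + (s + 0ℚ))))) ≡ t + (p + (u + (q + (r + (s + 0ℚ)))))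
balance-1 {p} {B} {q} {r} {s} refl refl = solve 5 (λ B p q r s →
  con ½ :+ (p :+ (con ½ :+ (q :+ (r :+ (s :+ con 0ℚ))))) := B :+ (p :+ ((con 1ℚ :- B) :+ (q :+ (r :+ (s :+ con 0ℚ)))))) refl B p q r s

balance-2 : ∀ {p B q r s t u} → t ≡ B → u ≡ 1ℚ - B →
  ½ + (½ + (p + (q + (r + (s + 0ℚ))))) ≡ t + (u + (p + (q + (r + (s + 0ℚ)))))
balance-2 {p} {B} {q} {r} {s} refl refl = solve 5 (λ B p q r s →
  con ½ :+ (con ½ :+ (p :+ (q :+ (r :+ (s :+ con 0ℚ))))) := B :+ ((con 1ℚ :- B) :+ (p :+ (q :+ (r :+ (s :+ con 0ℚ)))))) refl B p q r s

balance-3 : ∀ {p B q r s t u} → u ≡ 1ℚ - B → s ≡ B → t ≡ B →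
  B + (q + (r + (p + (½ + (½ + 0ℚ))))) ≡ u + (q + (r + (p + (s + (t + 0ℚ)))))
balance-3 {p} {B} {q} {r} refl refl refl = solve 4 (λ B p q r →
  B :+ (q :+ (r :+ (p :+ (con ½ :+ (con ½ :+ con 0ℚ))))) := (con 1ℚ :- B) :+ (q :+ (r :+ (p :+ (B :+ (B :+ con 0ℚ)))))) refl B p q r

balance-4 : ∀ {p B q r s t u} → t ≡ B → u ≡ 1ℚ - B →
  q + (r + (s + (½ + (p + (½ + 0ℚ))))) ≡ q + (r + (s + (t + (p + (u + 0ℚ)))))
balance-4 {p} {B} {q} {r} {s} refl refl = solve 5 (λ B p q r s →
  q :+ (r :+ (s :+ (con ½ :+ (p :+ (con ½ :+ con 0ℚ))))) := q :+ (r :+ (s :+ (B :+ (p :+ ((con 1ℚ :- B) :+ con 0ℚ)))))) refl B p q r s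

balance-5 : ∀ {p B q r s t u} → t ≡ B → u ≡ 1ℚ - B →
  q + (r + (s + (½ + (½ + (p + 0ℚ))))) ≡ q + (r + (s + (t + (u + (p + 0ℚ)))))
balance-5 {p} {B} {q} {r} {s} refl refl = solve 5 (λ B p q r s →
  q :+ (r :+ (s :+ (con ½ :+ (con ½ :+ (p :+ con 0ℚ))))) := q :+ (r :+ (s :+ (B :+ ((con 1ℚ :- B) :+ (p :+ con 0ℚ)))))) refl B p q r s

module Blossom {n} {d : Fin n → ℕ} {G : Graph n} (real : Realizes d G)
  (f : Fin 6 → Fin n) (f-inj : Injective _≡_ _≡_ f) (b : Bool)
  (e₀₁ : G (f 0F) (f 1F) ≡ b) (e₁₂ : G (f 1F) (f 2F) ≡ not b) (e₂₀ : G (f 2F) (f 0F) ≡ b)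
  (e₀₃ : G (f 0F) (f 3F) ≡ not b) (e₃₄ : G (f 3F) (f 4F) ≡ b) (e₄₅ : G (f 4F) (f 5F) ≡ not b) (e₅₃ : G (f 5F) (f 3F) ≡ b) where
  open Overlay f f-inj
  open Realizes real

  G-sym : ∀ u v → G u v ≡ G v u
  G-sym = proj₁ (proj₁ isRealization)

  halfPair : Fin 6 → Fin 6 → Bool
  halfPair 0F 1F = true
  halfPair 1F 0F = true
  halfPair 1F 2F = true
  halfPair 2F 1F = true
  halfPair 2F 0F = true
  halfPair 0F 2F = true
  halfPair 3F 4F = true
  halfPair 4F 3F = true
  halfPair 4F 5F = true
  halfPair 5F 4F = true
  halfPair 5F 3F = true
  halfPair 3F 5F = true
  halfPair _  _  = false

  flipped : Fin 6 → Fin 6 → Bool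
  flipped 0F 3F = true
  flipped 3F 0F = true
  flipped _  _  = false

  bits : Fin 6 → Fin 6 → Bool
  bits i j = if flipped i j then b else G (f i) (f j)

  K : Fin 6 → Fin 6 → ℚ
  K i j = if halfPair i j then ½ else ⟦ bits i j ⟧

  K-sym : ∀ i j → K i j ≡ K j i
  K-sym i j = cong₂ (λ h c → if h then ½ else ⟦ c ⟧) (symmetric halfPair i j)
    (cong₂ (λ s c → if s then b else c) (symmetric flipped i j) (G-sym (f i) (f j)))
    where
    symmetric : ∀ (h : Fin 6 → Fin 6 → Bool) {_ : True (Fin.all? (λ i → Fin.all? (λ j → h i j Bool.≟ h j i)))} → ∀ i j → h i j ≡ h j i
    symmetric h {t} = toWitness t

  y : Point n
  y u v = ⟦ G u v ⟧

  x : Point n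
  x = overlay K y

  B : ℚ
  B = ⟦ b ⟧

  at : ∀ {u v} → G u v ≡ b → y u v ≡ B
  at = cong ⟦_⟧

  at′ : ∀ {u v} → G u v ≡ not b → y u v ≡ 1ℚ - B
  at′ e = trans (cong ⟦_⟧ e) (⟦not⟧ b)

  rev : ∀ {u v c} → G u v ≡ c → G v u ≡ c
  rev {u} {v} e = trans (G-sym v u) e

  w : Fin 6 → Fin 6 → ℚ
  w i j = y (f i) (f j)

  K-rows : ∀ j → sum (λ i → K i j) ≡ sum (λ i → y (f i) (f j))
  K-rows 0F = balance-0 {w 0F 0F} {B} {w 4F 0F} {w 5F 0F} (at (rev e₀₁)) (at e₂₀) (at′ (rev e₀₃))
  K-rows 1F = balance-1 {w 1F 1F} {B} {w 3F 1F} {w 4F 1F} {w 5F 1F} (at e₀₁) (at′ (rev e₁₂))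
  K-rows 2F = balance-2 {w 2F 2F} {B} {w 3F 2F} {w 4F 2F} {w 5F 2F} (at (rev e₂₀)) (at′ e₁₂)
  K-rows 3F = balance-3 {w 3F 3F} {B} {w 1F 3F} {w 2F 3F} (at′ e₀₃) (at (rev e₃₄)) (at e₅₃)
  K-rows 4F = balance-4 {w 4F 4F} {B} {w 0F 4F} {w 1F 4F} {w 2F 4F} (at e₃₄) (at′ (rev e₄₅))
  K-rows 5F = balance-5 {w 5F 5F} {B} {w 0F 5F} {w 1F 5F} {w 2F 5F} (at (rev e₅₃)) (at′ e₄₅)

  bounded : ∀ u v → (0ℚ ≤ x u v) × (x u v ≤ 1ℚ)
  bounded = overlay-elim K y (λ _ _ q → (0ℚ ≤ q) × (q ≤ 1ℚ)) (λ i j → entry (halfPair i j) (bits i j)) (λ u v _ → bit (G u v))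
    where
    bit : ∀ c → (0ℚ ≤ ⟦ c ⟧) × (⟦ c ⟧ ≤ 1ℚ)
    bit c = ⟦⟧-nonneg c , ⟦⟧≤1 c
    entry : ∀ h c → (0ℚ ≤ (if h then ½ else ⟦ c ⟧)) × ((if h then ½ else ⟦ c ⟧) ≤ 1ℚ)
    entry true  c = ℚ.nonNegative⁻¹ ½ , ℚ.*≤* (ℤ.+≤+ (s≤s z≤n))
    entry false c = bit c

  x-inP : InP d x
  x-inP = overlay-sym K y K-sym (λ u v → cong ⟦_⟧ (G-sym u v))
    , diag
    , (λ v → trans (sumℚ≡sum (λ u → x u v)) (trans (overlay-row K y K-rows v) (realization-row {G = G} isRealization v)))
    , λ u v _ → bounded u v
    where
    diag : ∀ u → x u u ≡ 0ℚ
    diag u = overlay-elim K y (λ u v q → u ≡ v → q ≡ 0ℚ) new (λ { u .u _ refl → cong ⟦_⟧ (proj₂ (proj₁ isRealization) u) }) u u refl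
      where
      K-diag : ∀ i → K i i ≡ 0ℚ
      K-diag 0F = cong ⟦_⟧ (proj₂ (proj₁ isRealization) (f 0F))
      K-diag 1F = cong ⟦_⟧ (proj₂ (proj₁ isRealization) (f 1F))
      K-diag 2F = cong ⟦_⟧ (proj₂ (proj₁ isRealization) (f 2F))
      K-diag 3F = cong ⟦_⟧ (proj₂ (proj₁ isRealization) (f 3F))
      K-diag 4F = cong ⟦_⟧ (proj₂ (proj₁ isRealization) (f 4F))
      K-diag 5F = cong ⟦_⟧ (proj₂ (proj₁ isRealization) (f 5F))
      new : ∀ i j → f i ≡ f j → K i j ≡ 0ℚ
      new i j e with f-inj e
      ... | refl = K-diag i

  HalfAt : Fin n → Fin n → Set
  HalfAt u v = ∃[ i ] ∃[ j ] f i ≡ u × f j ≡ v × halfPair i j ≡ true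

  bit-or-half : ∀ u v → (∃[ c ] x u v ≡ ⟦ c ⟧) ⊎ HalfAt u v
  bit-or-half = overlay-elim K y (λ u v q → (∃[ c ] q ≡ ⟦ c ⟧) ⊎ HalfAt u v) new (λ u v _ → inj₁ (G u v , refl))
    where
    new : ∀ i j → (∃[ c ] K i j ≡ ⟦ c ⟧) ⊎ HalfAt (f i) (f j)
    new i j with halfPair i j in h
    ... | true  = inj₂ (i , j , refl , refl , h)
    ... | false = inj₁ (bits i j , refl)

  module _ {p q : Point n} (p-inP : InP d p) (q-inP : InP d q) {l : ℚ} (0<l : 0ℚ < l) (l<1 : l < 1ℚ)
    (combination : ∀ u v → x u v ≡ l * p u v + (1ℚ - l) * q u v) where

    δ : Point n
    δ u v = p u v - q u v

    δ-sym : Symmetric δ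
    δ-sym u v = cong₂ _-_ (proj₁ p-inP u v) (proj₁ q-inP u v)

    bounds : ∀ {r : Point n} → InP d r → ∀ u v → (0ℚ ≤ r u v) × (r u v ≤ 1ℚ)
    bounds (_ , diag , _ , within) u v with u ≟ v
    ... | yes refl = subst (λ s → (0ℚ ≤ s) × (s ≤ 1ℚ)) (sym (diag u)) (ℚ.≤-refl , ℚ.nonNegative⁻¹ 1ℚ)
    ... | no u≢v = within u v u≢v

    δ-row : ∀ v → col δ v ≡ 0ℚ
    δ-row v = trans (sum-minus (λ u → p u v) (λ u → q u v))
      (trans (cong₂ _-_ (row p-inP) (row q-inP)) (ℚ.+-inverseʳ (ℕtoℚ (d v))))
      where
      row : ∀ {r} → InP d r → col r v ≡ ℕtoℚ (d v)
      row {r} r-inP = trans (sym (sumℚ≡sum (λ u → r u v))) (proj₁ (proj₂ (proj₂ r-inP)) v)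

    δ-bit : ∀ u v c → x u v ≡ ⟦ c ⟧ → δ u v ≡ 0ℚ
    δ-bit u v c e = trans (cong (_- q u v) (equal c e)) (ℚ.+-inverseʳ (q u v))
      where
      equal : ∀ c → x u v ≡ ⟦ c ⟧ → p u v ≡ q u v
      equal true  e = convex-one 0<l l<1 (proj₂ (bounds p-inP u v)) (proj₂ (bounds q-inP u v)) (trans (sym e) (combination u v))
      equal false e = convex-zero 0<l l<1 (proj₁ (bounds p-inP u v)) (proj₁ (bounds q-inP u v)) (trans (sym e) (combination u v))

    OnlyPartners : Fin 6 → Fin 6 → Fin 6 → Set
    OnlyPartners j i i′ = i ≢ i′ × (∀ a → halfPair a j ≡ true → a ≡ i ⊎ a ≡ i′)

    onlyPartners? : ∀ j i i′ → Dec (OnlyPartners j i i′)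
    onlyPartners? j i i′ = ¬? (i ≟ i′) ×-dec Fin.all? (λ a → (halfPair a j Bool.≟ true) →-dec ((a ≟ i) ⊎-dec (a ≟ i′)))

    pair-row : ∀ j i i′ → OnlyPartners j i i′ → δ (f i) (f j) + δ (f i′) (f j) ≡ 0ℚ
    pair-row j i i′ (i≢i′ , only) = trans (sym (sum-pair (λ u → δ u (f j)) (i≢i′ ∘ f-inj) other)) (δ-row (f j))
      where
      other : ∀ u → u ≢ f i → u ≢ f i′ → δ u (f j) ≡ 0ℚ
      other u u≢i u≢i′ = [ (λ (c , e) → δ-bit u (f j) c e) , (λ (a , j′ , fa≡u , fj′≡fj , h) → ⊥-elim
        ([ (λ a≡i → u≢i (trans (sym fa≡u) (cong f a≡i))) , (λ a≡i′ → u≢i′ (trans (sym fa≡u) (cong f a≡i′))) ]′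
          (only a (subst (λ j → halfPair a j ≡ true) (f-inj fj′≡fj) h)))) ]′ (bit-or-half u (f j))

    -- Each row equation makes the two entries at a corner of the triangle opposite. Going round the
    -- triangle takes three sign changes, so every entry equals its own negative.
    triangle-zero : ∀ i j k {_ : True (onlyPartners? i j k ×-dec onlyPartners? j i k ×-dec onlyPartners? k i j)} → δ (f i) (f j) ≡ 0ℚ
    triangle-zero i j k {t} = p≡-p⇒p≡0 _ (begin
      ij + ij                              ≡⟨ solve 3 (λ a b c → a :+ a := (a :+ b) :+ (a :+ c) :- (b :+ c)) refl ij ik jk ⟩
      (ij + ik) + (ij + jk) - (ik + jk)    ≡⟨ cong₂ _-_ (cong₂ _+_ (trans (cong₂ _+_ (δ-sym (f i) (f j)) (δ-sym (f i) (f k))) (pair-row i j k (proj₁ partners)))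
                                                               (trans (cong (ij +_) (δ-sym (f j) (f k))) (pair-row j i k (proj₁ (proj₂ partners)))))
                                                      (pair-row k i j (proj₂ (proj₂ partners))) ⟩
      0ℚ                                   ∎)
      where
      open ≡-Reasoning
      partners = toWitness t
      ij = δ (f i) (f j)
      ik = δ (f i) (f k)
      jk = δ (f j) (f k)

    half-zero : ∀ i j → halfPair i j ≡ true → δ (f i) (f j) ≡ 0ℚ
    half-zero 0F 1F _ = triangle-zero 0F 1F 2F
    half-zero 1F 0F _ = triangle-zero 1F 0F 2F
    half-zero 1F 2F _ = triangle-zero 1F 2F 0F
    half-zero 2F 1F _ = triangle-zero 2F 1F 0F
    half-zero 2F 0F _ = triangle-zero 2F 0F 1F
    half-zero 0F 2F _ = triangle-zero 0F 2F 1F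
    half-zero 3F 4F _ = triangle-zero 3F 4F 5F
    half-zero 4F 3F _ = triangle-zero 4F 3F 5F
    half-zero 4F 5F _ = triangle-zero 4F 5F 3F
    half-zero 5F 4F _ = triangle-zero 5F 4F 3F
    half-zero 5F 3F _ = triangle-zero 5F 3F 4F
    half-zero 3F 5F _ = triangle-zero 3F 5F 4F

    endpoints-equal : ∀ u v → p u v ≡ q u v
    endpoints-equal u v = trans (solve 2 (λ a b → a := (a :- b) :+ b) refl (p u v) (q u v))
      (trans (cong (_+ q u v) (zero-at (bit-or-half u v))) (ℚ.+-identityˡ (q u v)))
      where
      zero-at : (∃[ c ] x u v ≡ ⟦ c ⟧) ⊎ HalfAt u v → δ u v ≡ 0ℚ
      zero-at (inj₁ (c , e)) = δ-bit u v c e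
      zero-at (inj₂ (i , j , refl , refl , h)) = half-zero i j h

  blossom-vertex : IsVertex d x
  blossom-vertex = x-inP , λ p q l p-inP q-inP 0<l l<1 combination → endpoints-equal p-inP q-inP 0<l l<1 combination

  not-decisive : ¬ Decisive d
  not-decisive decisive = not-bit (overlay-at K y 0F 1F) (decisive x blossom-vertex (f 0F) (f 1F))
    where
    not-bit : ∀ {q} → q ≡ ½ → ¬ (q ≡ 0ℚ ⊎ q ≡ 1ℚ)
    not-bit refl (inj₁ ())
    not-bit refl (inj₂ ())

decisive⇒blossom-free : ∀ {n} {d : Fin n → ℕ} → Decisive d → ∀ G → Realization d G → ¬ HasBlossom G
decisive⇒blossom-free decisive G real (f , f-inj , b , e₀₁ , e₁₂ , e₂₀ , e₀₃ , e₃₄ , e₄₅ , e₅₃) =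
  Blossom.not-decisive (realizes real) f f-inj b e₀₁ e₁₂ e₂₀ e₀₃ e₃₄ e₄₅ e₅₃ decisive

-- Exchanging induced subgraphs of equal degrees

ℕtoℚ-injective : ∀ {k l} → ℕtoℚ k ≡ ℕtoℚ l → k ≡ l
ℕtoℚ-injective e = ℕ.≤-antisym (ℕtoℚ-cancel-≤ (ℚ.≤-reflexive e)) (ℕtoℚ-cancel-≤ (ℚ.≤-reflexive (sym e)))

degrees : Graph 6 → List ℕ
degrees H = map (deg H) (allFin 6)

lookup-degrees : ∀ H i → List.lookup (degrees H) i ≡ deg H i
lookup-degrees H 0F = refl
lookup-degrees H 1F = refl
lookup-degrees H 2F = refl
lookup-degrees H 3F = refl
lookup-degrees H 4F = refl
lookup-degrees H 5F = refl

degree-matching : ∀ (H K : Graph 6) → degrees H ↭ degrees K →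
  Σ[ π ∈ Inverse (setoid (Fin 6)) (setoid (Fin 6)) ] ∀ i → deg H i ≡ deg K (Inverse.to π i)
degree-matching H K p = π , λ i → trans (sym (lookup-degrees H i))
  (trans (PermutationSetoid.onIndices-lookup (setoid ℕ) (↭⇒↭ₛ p) i) (lookup-degrees K (Inverse.to π i)))
  where π = Homogeneous.onIndices (↭⇒↭ₛ p)

symmetrize : ∀ {k} → (Fin k → Fin k → Bool) → Graph k
symmetrize h i j = h i j ∨ h j i

degree-sum : ∀ {k} {H : Graph k} → (∀ i j → H i j ≡ H j i) → ∀ i → sum (λ j → ⟦ H j i ⟧) ≡ ℕtoℚ (deg H i)
degree-sum {H = H} H-sym i = trans (sum-cong-≗ (λ j → cong ⟦_⟧ (H-sym j i))) (sym (ℕtoℚ-deg H i))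

-- Each pair is described in one orientation only and the reverse one falls under the default;
-- `symmetrize` joins them. Seven of the fifteen pairs are prescribed by the blossom, and eight are
-- free.
blossomPattern : Bool → Vec Bool 8 → Fin 6 → Fin 6 → Bool
blossomPattern b _ 0F 1F = b
blossomPattern b _ 1F 2F = not b
blossomPattern b _ 2F 0F = b
blossomPattern b _ 0F 3F = not b
blossomPattern b _ 3F 4F = b
blossomPattern b _ 4F 5F = not b
blossomPattern b _ 5F 3F = b
blossomPattern _ (p ∷ _) 0F 4F = p
blossomPattern _ (_ ∷ p ∷ _) 0F 5F = p
blossomPattern _ (_ ∷ _ ∷ p ∷ _) 1F 3F = p
blossomPattern _ (_ ∷ _ ∷ _ ∷ p ∷ _) 1F 4F = p
blossomPattern _ (_ ∷ _ ∷ _ ∷ _ ∷ p ∷ _) 1F 5F = p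
blossomPattern _ (_ ∷ _ ∷ _ ∷ _ ∷ _ ∷ p ∷ _) 2F 3F = p
blossomPattern _ (_ ∷ _ ∷ _ ∷ _ ∷ _ ∷ _ ∷ p ∷ _) 2F 4F = p
blossomPattern _ (_ ∷ _ ∷ _ ∷ _ ∷ _ ∷ _ ∷ _ ∷ p ∷ _) 2F 5F = p
blossomPattern _ _ _ _ = false

blossomGraph : Bool × Vec Bool 8 → Graph 6
blossomGraph (b , ps) = symmetrize (blossomPattern b ps)

-- The blossom is recorded by its type and by the eight remaining pairs of vertices.
BlossomRealization : List ℕ → Set
BlossomRealization L = ∃[ w ] sort (degrees (blossomGraph w)) ≡ L

module Replace {n} {d : Fin n → ℕ} {G : Graph n} (real : Realization d G) {k} (g : Fin k → Fin n) (g-inj : Injective _≡_ _≡_ g)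
  (K : Graph k) (K-simple : IsSimple K) (same : ∀ b → sum (λ a → ⟦ K a b ⟧) ≡ sum (λ a → ⟦ G (g a) (g b) ⟧)) where
  open Overlay g g-inj

  G′ : Graph n
  G′ = overlay K G

  ⟦overlay⟧ : ∀ u v → ⟦ G′ u v ⟧ ≡ overlay (λ a b → ⟦ K a b ⟧) (λ u v → ⟦ G u v ⟧) u v
  ⟦overlay⟧ u v with image? u | image? v
  ... | yes _ | yes _ = refl
  ... | yes _ | no _ = refl
  ... | no _ | _ = refl

  G′-sym : ∀ u v → G′ u v ≡ G′ v u
  G′-sym = overlay-sym K G (proj₁ K-simple) (proj₁ (proj₁ real))

  replaced : Realization d G′
  replaced = (G′-sym , λ u → overlay-elim K G (λ u v c → u ≡ v → c ≡ false) (λ a b e → diag (g-inj e)) (λ { u .u _ refl → proj₂ (proj₁ real) u }) u u refl)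
    , λ i → ℕtoℚ-injective (trans (sym (degree-sum G′-sym i)) (trans (sum-cong-≗ (λ u → ⟦overlay⟧ u i))
        (trans (overlay-row (λ a b → ⟦ K a b ⟧) (λ u v → ⟦ G u v ⟧) same i) (realization-row {G = G} real i))))
    where
    diag : ∀ {a b} → a ≡ b → K a b ≡ false
    diag {a} refl = proj₂ K-simple a

blossomGraph-simple : ∀ w → IsSimple (blossomGraph w)
blossomGraph-simple (b , ps) = (λ i j → Bool.∨-comm (blossomPattern b ps i j) (blossomPattern b ps j i)) , diag ps
  where
  diag : ∀ ps i → blossomGraph (b , ps) i i ≡ false
  diag (_ ∷ _ ∷ _ ∷ _ ∷ _ ∷ _ ∷ _ ∷ _ ∷ []) 0F = refl
  diag (_ ∷ _ ∷ _ ∷ _ ∷ _ ∷ _ ∷ _ ∷ _ ∷ []) 1F = refl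
  diag (_ ∷ _ ∷ _ ∷ _ ∷ _ ∷ _ ∷ _ ∷ _ ∷ []) 2F = refl
  diag (_ ∷ _ ∷ _ ∷ _ ∷ _ ∷ _ ∷ _ ∷ _ ∷ []) 3F = refl
  diag (_ ∷ _ ∷ _ ∷ _ ∷ _ ∷ _ ∷ _ ∷ _ ∷ []) 4F = refl
  diag (_ ∷ _ ∷ _ ∷ _ ∷ _ ∷ _ ∷ _ ∷ _ ∷ []) 5F = refl

blossomGraph-has : ∀ w {n} {G : Graph n} (f : Fin 6 → Fin n) → Injective _≡_ _≡_ f →
  (∀ i j → G (f i) (f j) ≡ blossomGraph w i j) → HasBlossom G
blossomGraph-has w@(b , _ ∷ _ ∷ _ ∷ _ ∷ _ ∷ _ ∷ _ ∷ _ ∷ []) {G = G} f f-inj f-adj = f , f-inj , b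
  , at 0F 1F b refl , at 1F 2F (not b) refl , at 2F 0F b refl , at 0F 3F (not b) refl , at 3F 4F b refl , at 4F 5F (not b) refl , at 5F 3F b refl
  where
  -- The second disjunct is the reversed pair, which takes the default value.
  at : ∀ i j c → blossomGraph w i j ≡ c ∨ false → G (f i) (f j) ≡ c
  at i j c e = trans (f-adj i j) (trans e (Bool.∨-identityʳ c))

-- Relabelling `P` along a degree-preserving bijection keeps the column sums of the block, so the
-- new graph still realizes `d`; `f` finds `P` in it in the original numbering.
module Substitute {n} {d : Fin n → ℕ} {G : Graph n} (real : Realization d G) {H : Graph 6} (H-simple : IsSimple H)
  (copy : InducedCopy G H) {P : Graph 6} (P-simple : IsSimple P) (same-degrees : degrees H ↭ degrees P) where
  g = proj₁ copy
  g-inj : Injective _≡_ _≡_ g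
  g-inj = proj₁ (proj₂ copy)
  matching = degree-matching H P same-degrees
  open Inverse (proj₁ matching) using (to; from; strictlyInverseˡ; strictlyInverseʳ)

  to-inj : Injective _≡_ _≡_ to
  to-inj {i} {j} e = trans (sym (strictlyInverseʳ i)) (trans (cong from e) (strictlyInverseʳ j))

  from-inj : Injective _≡_ _≡_ from
  from-inj {i} {j} e = trans (sym (strictlyInverseˡ i)) (trans (cong to e) (strictlyInverseˡ j))

  K : Graph 6
  K i j = P (to i) (to j)

  same : ∀ j → sum (λ i → ⟦ K i j ⟧) ≡ sum (λ i → ⟦ G (g i) (g j) ⟧)
  same j = begin
    sum (λ i → ⟦ P (to i) (to j) ⟧)
      ≡⟨ sum-image to to-inj (λ i → ⟦ P i (to j) ⟧) (λ i off → contradiction (strictlyInverseˡ i) (off (from i))) ⟨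
    sum (λ i → ⟦ P i (to j) ⟧)            ≡⟨ degree-sum (proj₁ P-simple) (to j) ⟩
    ℕtoℚ (deg P (to j))                   ≡⟨ cong ℕtoℚ (proj₂ matching j) ⟨
    ℕtoℚ (deg H j)                        ≡⟨ degree-sum (proj₁ H-simple) j ⟨
    sum (λ i → ⟦ H i j ⟧)                 ≡⟨ sum-cong-≗ (λ i → cong ⟦_⟧ (proj₂ (proj₂ copy) i j)) ⟩
    sum (λ i → ⟦ G (g i) (g j) ⟧)         ∎
    where open ≡-Reasoning

  open Replace {G = G} real g g-inj K ((λ i j → proj₁ P-simple (to i) (to j)) , λ i → proj₂ P-simple (to i)) same public

  f : Fin 6 → Fin n
  f = g ∘ from

  f-injective : Injective _≡_ _≡_ f
  f-injective e = from-inj (g-inj e)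

  f-adjacency : ∀ i j → G′ (f i) (f j) ≡ P i j
  f-adjacency i j = trans (Overlay.overlay-at g g-inj K G (from i) (from j)) (cong₂ P (strictlyInverseˡ i) (strictlyInverseˡ j))

blossom-free⇒𝓑-free : (∀ {L} → L ∈ 𝓑-degseqs → BlossomRealization L) →
  ∀ {n} {d : Fin n → ℕ} → (∀ G → Realization d G → ¬ HasBlossom G) → ∀ G → Realization d G → 𝓑-free G
blossom-free⇒𝓑-free witness no-blossom G real (H , (H-simple , L , L∈ , H↭L) , copy) =
  no-blossom G′ replaced (blossomGraph-has w {G = G′} f f-injective f-adjacency)
  where
  w = proj₁ (witness L∈)
  open Substitute {G = G} real H-simple copy (blossomGraph-simple w)
    (↭-trans H↭L (subst (_↭ degrees (blossomGraph w)) (proj₂ (witness L∈)) (sort-↭ (degrees (blossomGraph w)))))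

-- Only the sequence of ones uses type `false`, where the prescribed edges form a perfect matching:
-- in type `true` the vertex v₁ already has degree two.
witnesses : All BlossomRealization 𝓑-degseqs
witnesses =
  (((false , false ∷ false ∷ false ∷ false ∷ false ∷ false ∷ false ∷ false ∷ []) , refl)) ∷
  (((true , false ∷ false ∷ false ∷ false ∷ false ∷ false ∷ false ∷ false ∷ []) , refl)) ∷
  (((true , false ∷ false ∷ false ∷ false ∷ false ∷ false ∷ false ∷ true ∷ []) , refl)) ∷
  (((true , false ∷ false ∷ false ∷ false ∷ true ∷ false ∷ true ∷ false ∷ []) , refl)) ∷
  (((true , false ∷ false ∷ false ∷ false ∷ false ∷ true ∷ false ∷ false ∷ []) , refl)) ∷
  (((true , false ∷ false ∷ false ∷ false ∷ false ∷ false ∷ true ∷ true ∷ []) , refl)) ∷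
  (((true , false ∷ false ∷ false ∷ false ∷ false ∷ true ∷ false ∷ true ∷ []) , refl)) ∷
  (((true , false ∷ false ∷ false ∷ false ∷ true ∷ false ∷ true ∷ true ∷ []) , refl)) ∷
  (((true , false ∷ false ∷ false ∷ false ∷ true ∷ true ∷ false ∷ true ∷ []) , refl)) ∷
  (((true , false ∷ true ∷ false ∷ false ∷ false ∷ true ∷ false ∷ true ∷ []) , refl)) ∷
  (((true , false ∷ false ∷ false ∷ true ∷ true ∷ false ∷ true ∷ true ∷ []) , refl)) ∷
  (((true , false ∷ true ∷ false ∷ true ∷ true ∷ true ∷ true ∷ false ∷ []) , refl)) ∷
  (((true , false ∷ false ∷ true ∷ false ∷ false ∷ true ∷ false ∷ false ∷ []) , refl)) ∷
  (((true , false ∷ false ∷ false ∷ false ∷ false ∷ true ∷ true ∷ true ∷ []) , refl)) ∷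
  (((true , false ∷ false ∷ false ∷ false ∷ true ∷ true ∷ true ∷ true ∷ []) , refl)) ∷
  (((true , false ∷ false ∷ true ∷ false ∷ true ∷ true ∷ false ∷ true ∷ []) , refl)) ∷
  (((true , false ∷ false ∷ false ∷ true ∷ true ∷ true ∷ true ∷ true ∷ []) , refl)) ∷
  (((true , false ∷ false ∷ true ∷ false ∷ false ∷ true ∷ true ∷ true ∷ []) , refl)) ∷
  (((true , false ∷ false ∷ true ∷ false ∷ true ∷ true ∷ true ∷ true ∷ []) , refl)) ∷
  (((true , false ∷ true ∷ true ∷ false ∷ true ∷ true ∷ false ∷ true ∷ []) , refl)) ∷
  (((true , false ∷ true ∷ false ∷ true ∷ true ∷ true ∷ true ∷ true ∷ []) , refl)) ∷
  (((true , false ∷ false ∷ true ∷ true ∷ true ∷ true ∷ true ∷ true ∷ []) , refl)) ∷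
  (((true , false ∷ true ∷ true ∷ true ∷ true ∷ true ∷ true ∷ true ∷ []) , refl)) ∷
  (((true , true ∷ true ∷ true ∷ true ∷ true ∷ true ∷ true ∷ true ∷ []) , refl)) ∷
  []

-- Complements and six-vertex induced subgraphs

co : ∀ {n} → Graph n → Graph n
co G u v = not (does (u ≟ v)) ∧ not (G u v)

co-≢ : ∀ {n} (G : Graph n) {u v} → u ≢ v → co G u v ≡ not (G u v)
co-≢ G {u} {v} u≢v = cong (λ c → not c ∧ not (G u v)) (dec-false (u ≟ v) u≢v)

co-diag : ∀ {n} (G : Graph n) u → co G u u ≡ false
co-diag G u = cong (λ c → not c ∧ not (G u u)) (dec-true (u ≟ u) refl)

co-simple : ∀ {n} {G : Graph n} → IsSimple G → IsSimple (co G)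
co-simple {G = G} (G-sym , _) = co-sym , co-diag G
  where
  co-sym : ∀ u v → co G u v ≡ co G v u
  co-sym u v with u ≟ v | v ≟ u
  ... | yes _ | yes _ = refl
  ... | no _ | no _ = cong not (G-sym u v)
  ... | yes e | no ne = contradiction (sym e) ne
  ... | no ne | yes e = contradiction (sym e) ne

co-involutive : ∀ {n} {G : Graph n} → IsSimple G → ∀ u v → co (co G) u v ≡ G u v
co-involutive {G = G} (_ , G-diag) u v with u ≟ v
... | yes refl = sym (G-diag u)
... | no _ = Bool.not-involutive (G u v)

-- Comparing sorted lists (in descending order, as in `𝓑-degseqs`) can be decided by evaluation,
-- whereas `In𝓑` asks for a permutation.
𝓑-degrees : Graph 6 → Set
𝓑-degrees H = sort (degrees H) ∈ 𝓑-degseqs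

𝓑-degrees? : ∀ H → Dec (𝓑-degrees H)
𝓑-degrees? H = sort (degrees H) ∈ₗ? 𝓑-degseqs
  where open DecMembership (List.≡-dec ℕ._≟_) renaming (_∈?_ to _∈ₗ?_)

Free : ∀ {n} → Graph n → Set
Free G = ∀ {H : Graph 6} → InducedCopy G H → ¬ 𝓑-degrees H

module _ {n} {G : Graph n} where

  copy-simple : IsSimple G → ∀ {k} {H : Graph k} → InducedCopy G H → IsSimple H
  copy-simple (G-sym , G-diag) (g , _ , H≡G) =
    (λ a b → trans (H≡G a b) (trans (G-sym (g a) (g b)) (sym (H≡G b a)))) , λ a → trans (H≡G a a) (G-diag (g a))

  𝓑-free⇒free : IsSimple G → 𝓑-free G → Free G
  𝓑-free⇒free simple free {H} copy ∈𝓑 = free (H , (copy-simple simple copy , sort (degrees H) , ∈𝓑 , ↭-sym (sort-↭ (degrees H))) , copy)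

  restrict : ∀ {k l} {H : Graph l} → InducedCopy G H → (σ : Fin k → Fin l) → Injective _≡_ _≡_ σ → InducedCopy G (λ a b → H (σ a) (σ b))
  restrict (g , g-inj , H≡G) σ σ-inj = g ∘ σ , σ-inj ∘ g-inj , λ a b → H≡G (σ a) (σ b)

  copy-≗ : ∀ {k} {H K : Graph k} → (∀ a b → K a b ≡ H a b) → InducedCopy G H → InducedCopy G K
  copy-≗ K≡H (g , g-inj , H≡G) = g , g-inj , λ a b → trans (K≡H a b) (H≡G a b)

co-copy : ∀ {n k} {G : Graph n} {H : Graph k} → InducedCopy G H → InducedCopy (co G) (co H)
co-copy {G = G} {H} (g , g-inj , H≡G) = g , g-inj , agree
  where
  agree : ∀ a b → co H a b ≡ co G (g a) (g b)
  agree a b with a ≟ b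
  ... | yes refl = sym (co-diag G (g a))
  ... | no a≢b = trans (cong not (H≡G a b)) (sym (co-≢ G (a≢b ∘ g-inj)))

deg-co : ∀ {n} {H : Graph n} → IsSimple H → ∀ i → suc (deg (co H) i ℕ.+ deg H i) ≡ n
deg-co {n} {H} simple i = ℕtoℚ-injective (begin
  ℕtoℚ (suc (deg (co H) i ℕ.+ deg H i))
    ≡⟨ trans (ℕtoℚ-suc (deg (co H) i ℕ.+ deg H i)) (cong (1ℚ +_) (ℕtoℚ-+ (deg (co H) i) (deg H i))) ⟩
  1ℚ + (ℕtoℚ (deg (co H) i) + ℕtoℚ (deg H i))
    ≡⟨ cong₂ _+_ (sym (sum-≐ i)) (trans (cong₂ _+_ (ℕtoℚ-deg (co H) i) (ℕtoℚ-deg H i)) (sym (∑-distrib-+ (λ j → ⟦ co H i j ⟧) (λ j → ⟦ H i j ⟧)))) ⟩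
  sum (λ j → [ j ≐ i ]) + sum (λ j → ⟦ co H i j ⟧ + ⟦ H i j ⟧)
    ≡⟨ ∑-distrib-+ (λ j → [ j ≐ i ]) (λ j → ⟦ co H i j ⟧ + ⟦ H i j ⟧) ⟨
  sum (λ j → [ j ≐ i ] + (⟦ co H i j ⟧ + ⟦ H i j ⟧))
    ≡⟨ sum-cong-≗ one ⟩
  sum {n} (λ _ → 1ℚ)
    ≡⟨ sum-one n ⟩
  ℕtoℚ n ∎)
  where
  open ≡-Reasoning
  complementary : ∀ b → 0ℚ + (⟦ not b ⟧ + ⟦ b ⟧) ≡ 1ℚ
  complementary true  = refl
  complementary false = refl
  one : ∀ j → [ j ≐ i ] + (⟦ co H i j ⟧ + ⟦ H i j ⟧) ≡ 1ℚ
  one j with j ≟ i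
  ... | yes refl = cong₂ (λ b c → 1ℚ + (⟦ b ⟧ + ⟦ c ⟧)) (co-diag H j) (proj₂ simple j)
  ... | no j≢i = trans (cong (λ b → 0ℚ + (⟦ b ⟧ + ⟦ H i j ⟧)) (co-≢ H (j≢i ∘ sym))) (complementary (H i j))

degrees-co : ∀ {H : Graph 6} → IsSimple H → degrees (co H) ≡ map (5 ℕ.∸_) (degrees H)
degrees-co {H} simple = trans (List.map-cong at (allFin 6)) (List.map-∘ {g = 5 ℕ.∸_} {f = deg H} (allFin 6))
  where
  at : ∀ i → deg (co H) i ≡ 5 ℕ.∸ deg H i
  at i = sym (trans (cong (ℕ._∸ deg H i) (sym (ℕ.suc-injective (deg-co simple i)))) (ℕ.m+n∸n≡m (deg (co H) i) (deg H i)))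

-- On six vertices complementation turns degree `k` into `5 - k`. This is what lets the analysis of
-- 2K₂ cover C₄ as well.
𝓑-degseqs-co : All (λ L → sort (map (5 ℕ.∸_) L) ∈ 𝓑-degseqs) 𝓑-degseqs
𝓑-degseqs-co = toWitness {a? = All.all? (λ L → sort (map (5 ℕ.∸_) L) ∈ₗ? 𝓑-degseqs) 𝓑-degseqs} _
  where open DecMembership (List.≡-dec ℕ._≟_) renaming (_∈?_ to _∈ₗ?_)

free-co : ∀ {n} {G : Graph n} → IsSimple G → 𝓑-free G → 𝓑-free (co G)
free-co {G = G} simple free (H , (H-simple , L , L∈ , H↭L) , copy) = free
  (co H , (co-simple H-simple , sort (map (5 ℕ.∸_) L) , All.lookup 𝓑-degseqs-co L∈ ,
    subst (_↭ sort (map (5 ℕ.∸_) L)) (sym (degrees-co H-simple)) (↭-trans (↭.map⁺ (5 ℕ.∸_) H↭L) (↭-sym (sort-↭ (map (5 ℕ.∸_) L)))))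
  , back (co-copy {G = co G} copy))
  where
  back : ∀ {K : Graph 6} → InducedCopy (co (co G)) K → InducedCopy G K
  back (g , g-inj , K≡) = g , g-inj , λ a b → trans (K≡ a b) (co-involutive simple (g a) (g b))

-- Finite checks on one-vertex extensions

ext : ∀ {k} → Graph k → Vec Bool k → Graph (suc k)
ext H c zero    zero    = false
ext H c zero    (suc b) = Vec.lookup c b
ext H c (suc a) zero    = Vec.lookup c a
ext H c (suc a) (suc b) = H a b

Uniform : ∀ {k} → Vec Bool k → Set
Uniform {k} c = ∃[ b ] c ≡ Vec.replicate k b

uniform? : ∀ {k} (c : Vec Bool k) → Dec (Uniform c)
uniform? {k} c with Vec.≡-dec Bool._≟_ c (Vec.replicate k false) | Vec.≡-dec Bool._≟_ c (Vec.replicate k true)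
... | yes e | _ = yes (false , e)
... | no _ | yes e = yes (true , e)
... | no ¬f | no ¬t = no λ { (false , e) → ¬f e ; (true , e) → ¬t e }

allBits? : ∀ k {P : Vec Bool k → Set} → (∀ c → Dec (P c)) → Dec (∀ c → P c)
allBits? zero P? = map′ (λ { p [] → p }) (λ h → h []) (P? [])
allBits? (suc k) P? = map′ (λ { (f , t) (false ∷ c) → f c ; (f , t) (true ∷ c) → t c }) (λ h → (λ c → h (false ∷ c)) , (λ c → h (true ∷ c)))
  (allBits? k (λ c → P? (false ∷ c)) ×-dec allBits? k (λ c → P? (true ∷ c)))

module Extension {n} {G : Graph n} (simple : IsSimple G) {k} {H : Graph k} (copy : InducedCopy G H) where

  T : Fin k → Fin n
  T = proj₁ copy

  bits : Fin n → Vec Bool k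
  bits w = Vec.tabulate (λ a → G w (T a))

  Outside : Fin n → Set
  Outside w = ∀ a → T a ≢ w

  outside? : ∀ w → Dec (Outside w)
  outside? w = Fin.all? (λ a → ¬? (T a ≟ w))

  extend : ∀ {w} → Outside w → InducedCopy G (ext H (bits w))
  extend {w} out = g , g-inj , agree
    where
    g : Fin (suc k) → Fin n
    g zero = w
    g (suc a) = T a
    g-inj : Injective _≡_ _≡_ g
    g-inj {zero} {zero} _ = refl
    g-inj {zero} {suc b} e = contradiction (sym e) (out b)
    g-inj {suc a} {zero} e = contradiction e (out a)
    g-inj {suc a} {suc b} e = cong suc (proj₁ (proj₂ copy) e)
    agree : ∀ a b → ext H (bits w) a b ≡ G (g a) (g b)
    agree zero zero = sym (proj₂ simple w)
    agree zero (suc b) = Vec.lookup∘tabulate (λ a → G w (T a)) b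
    agree (suc a) zero = trans (Vec.lookup∘tabulate (λ a → G w (T a)) a) (proj₁ simple w (T a))
    agree (suc a) (suc b) = proj₂ (proj₂ copy) a b

  uniform-bits : ∀ {w} → ((b , _) : Uniform (bits w)) → ∀ a → G w (T a) ≡ b
  uniform-bits {w} (b , e) a = trans (sym (Vec.lookup∘tabulate (λ a → G w (T a)) a))
    (trans (cong (λ c → Vec.lookup c a) e) (Vec.lookup-replicate a b))

2K₂ : Graph 4
2K₂ 0F 1F = true
2K₂ 1F 0F = true
2K₂ 2F 3F = true
2K₂ 3F 2F = true
2K₂ _  _  = false

C₅ : Graph 5
C₅ 0F 1F = true
C₅ 1F 0F = true
C₅ 1F 2F = true
C₅ 2F 1F = true
C₅ 2F 3F = true
C₅ 3F 2F = true
C₅ 3F 4F = true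
C₅ 4F 3F = true
C₅ 4F 0F = true
C₅ 0F 4F = true
C₅ _  _  = false

-- One mixed vertex already makes six, so a C₅ in a 𝓑-free graph is never extended and becomes a V₃
-- of five vertices.
C₅-extension : ∀ c → ¬ Uniform c → 𝓑-degrees (ext C₅ c)
C₅-extension = toWitness {a? = allBits? 5 (λ c → ¬? (uniform? c) →-dec 𝓑-degrees? (ext C₅ c))} _

-- The added vertex 0 is kept: without it the six original vertices of U, Ū or the star remain, and
-- their degrees are not in the list.
Deletable : Graph 7 → Set
Deletable H = ∃[ i ] 𝓑-degrees (λ a b → H (Fin.punchIn (suc i) a) (Fin.punchIn (suc i) b))

deletable? : ∀ H → Dec (Deletable H)
deletable? H = Fin.any? (λ i → 𝓑-degrees? (λ a b → H (Fin.punchIn (suc i) a) (Fin.punchIn (suc i) b)))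

U-extension : ∀ c → ¬ Uniform c → Deletable (ext U c)
U-extension = toWitness {a? = allBits? 6 (λ c → ¬? (uniform? c) →-dec deletable? (ext U c))} _

Ū-extension : ∀ c → ¬ Uniform c → Deletable (ext Ū c)
Ū-extension = toWitness {a? = allBits? 6 (λ c → ¬? (uniform? c) →-dec deletable? (ext Ū c))} _

star₆ : Graph 6
star₆ = K₂+K₁ₘ 3

-- Vertex 2 is the centre, so a vertex adjacent to it alone is one more leaf.
leafBits : Vec Bool 6
leafBits = false ∷ false ∷ true ∷ false ∷ false ∷ false ∷ []

star-extension : ∀ c → ¬ Uniform c → c ≢ leafBits → Deletable (ext star₆ c)
star-extension = toWitness {a? = allBits? 6 (λ c → ¬? (uniform? c) →-dec (¬? (Vec.≡-dec Bool._≟_ c leafBits) →-dec deletable? (ext star₆ c)))} _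

data Shape : Set where
  shape-U shape-Ū shape-star : Shape

shapeGraph : Shape → Graph 6
shapeGraph shape-U    = U
shapeGraph shape-Ū    = Ū
shapeGraph shape-star = star₆

Placement : Graph 6 → Shape × Vec (Fin 6) 6 → Set
Placement H (s , π) = (∀ a b → Vec.lookup π a ≡ Vec.lookup π b → a ≡ b) × (∀ a b → shapeGraph s a b ≡ H (Vec.lookup π a) (Vec.lookup π b))

placement? : ∀ H sπ → Dec (Placement H sπ)
placement? H (s , π) = Fin.all? (λ a → Fin.all? (λ b → (Vec.lookup π a ≟ Vec.lookup π b) →-dec (a ≟ b)))
  ×-dec Fin.all? (λ a → Fin.all? (λ b → shapeGraph s a b Bool.≟ H (Vec.lookup π a) (Vec.lookup π b)))

-- In the twice extended 2K₂, vertex 0 is the last one added, 1 the one before, and 2 to 5 carry the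
-- 2K₂. Each vector lists where the vertices of the standard graph sit.
placements : List (Shape × Vec (Fin 6) 6)
placements =
  (shape-star , 2F ∷ 3F ∷ 5F ∷ 0F ∷ 1F ∷ 4F ∷ []) ∷
  (shape-U , 0F ∷ 2F ∷ 3F ∷ 1F ∷ 5F ∷ 4F ∷ []) ∷
  (shape-star , 2F ∷ 3F ∷ 4F ∷ 0F ∷ 1F ∷ 5F ∷ []) ∷
  (shape-U , 0F ∷ 2F ∷ 3F ∷ 1F ∷ 4F ∷ 5F ∷ []) ∷
  (shape-star , 4F ∷ 5F ∷ 3F ∷ 0F ∷ 1F ∷ 2F ∷ []) ∷
  (shape-U , 0F ∷ 4F ∷ 5F ∷ 1F ∷ 3F ∷ 2F ∷ []) ∷
  (shape-Ū , 2F ∷ 0F ∷ 1F ∷ 4F ∷ 3F ∷ 5F ∷ []) ∷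
  (shape-U , 1F ∷ 4F ∷ 5F ∷ 0F ∷ 2F ∷ 3F ∷ []) ∷
  (shape-star , 4F ∷ 5F ∷ 2F ∷ 0F ∷ 1F ∷ 3F ∷ []) ∷
  (shape-U , 0F ∷ 4F ∷ 5F ∷ 1F ∷ 2F ∷ 3F ∷ []) ∷
  (shape-Ū , 3F ∷ 0F ∷ 1F ∷ 4F ∷ 2F ∷ 5F ∷ []) ∷
  (shape-U , 1F ∷ 4F ∷ 5F ∷ 0F ∷ 3F ∷ 2F ∷ []) ∷
  (shape-Ū , 4F ∷ 0F ∷ 1F ∷ 2F ∷ 5F ∷ 3F ∷ []) ∷
  (shape-U , 1F ∷ 2F ∷ 3F ∷ 0F ∷ 4F ∷ 5F ∷ []) ∷
  (shape-Ū , 5F ∷ 0F ∷ 1F ∷ 2F ∷ 4F ∷ 3F ∷ []) ∷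
  (shape-U , 1F ∷ 2F ∷ 3F ∷ 0F ∷ 5F ∷ 4F ∷ []) ∷
  []

-- Evaluated over the 14 mixed vectors on four vertices and the 30 on five.
2K₂-extension : ∀ c → ¬ Uniform c → ∀ e → ¬ Uniform e →
  𝓑-degrees (ext (ext 2K₂ c) e) ⊎ Any.Any (Placement (ext (ext 2K₂ c) e)) placements
2K₂-extension = toWitness {a? = allBits? 4 (λ c → ¬? (uniform? c) →-dec allBits? 5 (λ e → ¬? (uniform? e) →-dec
  (𝓑-degrees? (ext (ext 2K₂ c) e) ⊎-dec Any.any? (placement? (ext (ext 2K₂ c) e)) placements)))} _

-- Partitions around an induced subgraph

SeparatedBy : ∀ {n} → Graph n → (Fin n → Fin 3) → Set
SeparatedBy G p =
  (∀ u v → p u ≡ 0F → p v ≡ 0F → G u v ≡ false) ×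
  (∀ u v → u ≢ v → p u ≡ 1F → p v ≡ 1F → G u v ≡ true) ×
  (∀ u v → p u ≡ 2F → p v ≡ 1F → G u v ≡ true) ×
  (∀ u v → p u ≡ 2F → p v ≡ 0F → G u v ≡ false)

side : Bool → Fin 3
side b = if b then 1F else 0F

side≢2 : ∀ b → side b ≢ 2F
side≢2 true  ()
side≢2 false ()

separated-by-sides : ∀ {n} {G : Graph n} {p} → IsSimple G → (∀ b u v → u ≢ v → p u ≡ side b → p v ≡ side b → G u v ≡ b) →
  (∀ b u v → p u ≡ 2F → p v ≡ side b → G u v ≡ b) → SeparatedBy G p
separated-by-sides {G = G} {p} simple homogeneous mixed = independent , homogeneous true , mixed true , mixed false
  where
  independent : ∀ u v → p u ≡ 0F → p v ≡ 0F → G u v ≡ false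
  independent u v pu pv with u ≟ v
  ... | yes refl = proj₂ simple u
  ... | no u≢v = homogeneous false u v u≢v pu pv

tabulate-const : ∀ {k} {f : Fin k → Bool} {b} → (∀ a → f a ≡ b) → Vec.tabulate f ≡ Vec.replicate k b
tabulate-const {k} {f} {b} f≡b = trans (Vec.tabulate-cong (λ a → trans (f≡b a) (sym (Vec.lookup-replicate a b)))) (Vec.tabulate∘lookup (Vec.replicate k b))

-- Two added vertices that relate to all of `H` by `b` but to each other by `not b`. Excluding this
-- configuration is what makes V₁ independent and V₂ a clique.
TwinCheck : Graph 4 → Bool → Set
TwinCheck H b = 𝓑-degrees (ext (ext H (Vec.replicate 4 b)) (not b ∷ Vec.replicate 4 b))

twinCheck? : ∀ H b → Dec (TwinCheck H b)
twinCheck? H b = 𝓑-degrees? (ext (ext H (Vec.replicate 4 b)) (not b ∷ Vec.replicate 4 b))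

module Copies {n} {G : Graph n} (simple : IsSimple G) (free : Free G) where

  not-≡ : ∀ {b c} → b ≢ c → b ≡ not c
  not-≡ {false} {true} _ = refl
  not-≡ {true} {false} _ = refl
  not-≡ {false} {false} h = contradiction refl h
  not-≡ {true} {true} h = contradiction refl h

  twins : ∀ {H} (copy : InducedCopy G H) {b} → TwinCheck H b → ∀ {u v} → u ≢ v →
    Extension.Outside simple copy u → Extension.Outside simple copy v →
    (∀ a → G u (proj₁ copy a) ≡ b) → (∀ a → G v (proj₁ copy a) ≡ b) → G u v ≡ b
  twins {H} copy {b} check {u} {v} u≢v u-out v-out u≡b v≡b with G u v Bool.≟ b
  ... | yes e = e
  ... | no ne = contradiction check (free (subst₂ (λ c c′ → InducedCopy G (ext (ext H c) c′)) (tabulate-const v≡b)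
      (cong₂ Vec._∷_ (not-≡ ne) (tabulate-const u≡b))
      (Extension.extend simple (Extension.extend simple copy v-out) outside)))
    where
    outside : Extension.Outside simple (Extension.extend simple copy v-out) u
    outside zero = u≢v ∘ sym
    outside (suc a) = u-out a

  -- Here V₃ is the copy itself, and a vertex outside is sent to V₁ or V₂ by its adjacency to one
  -- vertex of the copy. Two outside vertices leave room for four inside a six-vertex test, and `σ`
  -- selects these.
  module Hull {k} {H : Graph k} (copy : InducedCopy G H) (σ : Fin 4 → Fin k) (σ-inj : Injective _≡_ _≡_ σ)
    (check : ∀ b → TwinCheck (λ a b → H (σ a) (σ b)) b)
    (unmixed : ∀ w → Extension.Outside simple copy w → Uniform (Extension.bits simple copy w)) where
    open Extension simple copy

    p : Fin n → Fin 3
    p v with outside? v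
    ... | no _  = 2F
    ... | yes _ = side (G v (T (σ 0F)))

    p-T : ∀ a → p (T a) ≡ 2F
    p-T a with outside? (T a)
    ... | no _ = refl
    ... | yes out = contradiction refl (out a)

    inside : ∀ v → p v ≡ 2F → ∃[ a ] T a ≡ v
    inside v e with outside? v
    ... | no ¬out = let a , ¬¬e = Fin.¬∀⟶∃¬ k (λ a → T a ≢ v) (λ a → ¬? (T a ≟ v)) ¬out in a , decidable-stable (T a ≟ v) ¬¬e
    ... | yes _ = contradiction e (side≢2 (G v (T (σ 0F))))

    outer : ∀ b v → p v ≡ side b → Outside v × (∀ a → G v (T a) ≡ b)
    outer b v e with outside? v
    ... | no _ = contradiction (sym e) (side≢2 b)
    ... | yes out = out , λ a → trans (uniform-bits u a) (trans (sym (uniform-bits u (σ 0F))) (side-injective (G v (T (σ 0F))) b e))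
      where
      u = unmixed v out
      side-injective : ∀ b c → side b ≡ side c → b ≡ c
      side-injective true true _ = refl
      side-injective false false _ = refl

    homogeneous : ∀ b u v → u ≢ v → p u ≡ side b → p v ≡ side b → G u v ≡ b
    homogeneous b u v u≢v pu pv = twins {H = λ a b → H (σ a) (σ b)} (restrict {G = G} {H = H} copy σ σ-inj) (check b) u≢v (λ a → proj₁ (outer b u pu) (σ a)) (λ a → proj₁ (outer b v pv) (σ a))
      (λ a → proj₂ (outer b u pu) (σ a)) (λ a → proj₂ (outer b v pv) (σ a))

    mixed : ∀ b u v → p u ≡ 2F → p v ≡ side b → G u v ≡ b
    mixed b u v pu pv with inside u pu
    ... | a , refl = trans (proj₁ simple (T a) v) (proj₂ (outer b v pv) a)

    separated : SeparatedBy G p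
    separated = separated-by-sides simple homogeneous mixed

    hull-iso : InducedIso G (λ v → p v ≡ 2F) H
    hull-iso = T , proj₁ (proj₂ copy) , p-T , inside , proj₂ (proj₂ copy)

    hull-size : length (filter (λ v → p v ≟ 2F) (allFin n)) ≡ k
    hull-size = ℕtoℚ-injective (trans (length-filter (λ v → p v ≟ 2F))
      (trans (sum-image T (proj₁ (proj₂ copy)) (λ v → ⟦ does (p v ≟ 2F) ⟧)
          (λ v off → does-false (p v ≟ 2F) (λ e → let a , Ta≡v = inside v e in off a Ta≡v)))
        (trans (sum-cong-≗ (λ a → does-true (p (T a) ≟ 2F) (p-T a))) (sum-one k))))

  deletable-absurd : ∀ {H} → InducedCopy G H → ¬ Deletable H
  deletable-absurd {H} copy (i , ∈𝓑) = free (restrict {G = G} {H = H} copy (Fin.punchIn (suc i)) (λ {a} {b} → Fin.punchIn-injective (suc i) a b)) ∈𝓑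

-- Stars with any number of leaves

Tag : ℕ → Set
Tag m = Fin 3 ⊎ Fin m

tagAdj : ∀ {m} → Tag m → Tag m → Bool
tagAdj (inj₁ 0F) (inj₁ 1F) = true
tagAdj (inj₁ 1F) (inj₁ 0F) = true
tagAdj (inj₁ 2F) (inj₂ _)  = true
tagAdj (inj₂ _)  (inj₁ 2F) = true
tagAdj _ _ = false

-- Naming vertices by role (ends of K₂, centre, leaves) abstracts from the numberings of `K₂+K₁ₘ`
-- and `Kₘ+K₁∨2K₁`, of which the former puts the leaves last and the latter first. Thus the same
-- record, taken in `co G`, yields the complementary graph.
record StarOn {n} (G : Graph n) (V : Fin n → Set) (m : ℕ) : Set where
  field
    vertex    : Tag m → Fin n
    injective : ∀ {s t} → vertex s ≡ vertex t → s ≡ t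
    member    : ∀ s → V (vertex s)
    onto      : ∀ v → V v → ∃[ s ] vertex s ≡ v
    adjacency : ∀ s t → G (vertex s) (vertex t) ≡ tagAdj s t

pattern leafAt i = suc (suc (suc i))

star₆-leaf-0 : ∀ i → star₆ (leafAt i) 0F ≡ false
star₆-leaf-0 = toWitness {a? = Fin.all? (λ i → star₆ (leafAt i) 0F Bool.≟ false)} _

star₆-leaf-1 : ∀ i → star₆ (leafAt i) 1F ≡ false
star₆-leaf-1 = toWitness {a? = Fin.all? (λ i → star₆ (leafAt i) 1F Bool.≟ false)} _

star₆-leaf-2 : ∀ i → star₆ (leafAt i) 2F ≡ true
star₆-leaf-2 = toWitness {a? = Fin.all? (λ i → star₆ (leafAt i) 2F Bool.≟ true)} _

star₆-leaf-leaf : ∀ i j → star₆ (leafAt i) (leafAt j) ≡ false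
star₆-leaf-leaf = toWitness {a? = Fin.all? (λ i → Fin.all? (λ j → star₆ (leafAt i) (leafAt j) Bool.≟ false))} _

module StarPartition {n} {G : Graph n} (simple : IsSimple G) (free : Free G) (copy : InducedCopy G star₆) where
  open Copies simple free

  T : Fin 6 → Fin n
  T = proj₁ copy

  T-adj : ∀ a b → G (T a) (T b) ≡ star₆ a b
  T-adj a b = sym (proj₂ (proj₂ copy) a b)

  q r c : Fin n
  q = T 0F
  r = T 1F
  c = T 2F

  -- Two adjacencies are enough to recognize a leaf: a uniform vertex relates alike to `c` and `q`.
  Leaf Core Other : Fin n → Set
  Leaf v = G v c ≡ true × G v q ≡ false
  Core v = v ≡ q ⊎ v ≡ r ⊎ v ≡ c
  Other v = ¬ Core v

  leaf? : ∀ v → Dec (Leaf v)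
  leaf? v = (G v c Bool.≟ true) ×-dec (G v q Bool.≟ false)

  core? : ∀ v → Dec (Core v)
  core? v = (v ≟ q) ⊎-dec ((v ≟ r) ⊎-dec (v ≟ c))

  leaf-T : ∀ i → Leaf (T (leafAt i))
  leaf-T i = trans (T-adj (leafAt i) 2F) (star₆-leaf-2 i) , trans (T-adj (leafAt i) 0F) (star₆-leaf-0 i)

  leaf-other : ∀ {v} → Leaf v → Other v
  leaf-other (vc , _) (inj₁ refl) = case trans (sym vc) (T-adj 0F 2F) of λ ()
  leaf-other (vc , _) (inj₂ (inj₁ refl)) = case trans (sym vc) (T-adj 1F 2F) of λ ()
  leaf-other (vc , _) (inj₂ (inj₂ refl)) = case trans (sym vc) (T-adj 2F 2F) of λ ()

  -- A copy of the star with the same core and any three leaves. Varying the leaves spreads what the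
  -- checks say about six vertices to all leaves.
  record Anchored : Set where
    field
      anchored : InducedCopy G star₆
    A : Fin 6 → Fin n
    A = proj₁ anchored
    field
      A-q : A 0F ≡ q
      A-r : A 1F ≡ r
      A-c : A 2F ≡ c

  module _ (φ : Anchored) where
    open Anchored φ
    open Extension simple anchored using (outside?; extend; bits; uniform-bits)

    Uniformly Leafwise : Fin n → Set
    Uniformly v = ∃[ b ] G v q ≡ b × G v r ≡ b × G v c ≡ b × (∀ i → G v (A (leafAt i)) ≡ b)
    Leafwise v = Leaf v × G v r ≡ false × (∀ i → G v (A (leafAt i)) ≡ false)

    -- Outside the copy, a vertex that is neither uniform nor a further leaf gives a member of 𝓑 by
    -- `star-extension`; inside the copy, a vertex off the core is one of its leaves.
    anchored-type : ∀ {v} → Other v → Uniformly v ⊎ Leafwise v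
    anchored-type {v} other with outside? v
    ... | yes out with uniform? (bits v) | Vec.≡-dec Bool._≟_ (bits v) leafBits
    ...   | yes u | _ = inj₁ (proj₁ u , at 0F A-q , at 1F A-r , at 2F A-c , λ i → uniform-bits u (leafAt i))
      where
      at : ∀ {w} a → A a ≡ w → G v w ≡ proj₁ u
      at a refl = uniform-bits u a
    ...   | no _ | yes e = inj₂ ((subst (λ w → G v w ≡ true) A-c (bit 2F) , subst (λ w → G v w ≡ false) A-q (bit 0F)) ,
          subst (λ w → G v w ≡ false) A-r (bit 1F) , λ { 0F → bit 3F ; 1F → bit 4F ; 2F → bit 5F })
      where
      bit : ∀ a → G v (A a) ≡ Vec.lookup leafBits a
      bit a = trans (sym (Vec.lookup∘tabulate (λ a → G v (A a)) a)) (cong (λ c → Vec.lookup c a) e)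
    ...   | no ¬u | no ¬e = contradiction (star-extension (bits v) ¬u ¬e) (deletable-absurd {H = ext star₆ (bits v)} (extend out))
    anchored-type {v} other | no ¬out with Fin.¬∀⟶∃¬ 6 (λ a → A a ≢ v) (λ a → ¬? (A a ≟ v)) ¬out
    ... | a , ¬¬e = at a (decidable-stable (A a ≟ v) ¬¬e)
      where
      adj : ∀ a b → G (A a) (A b) ≡ star₆ a b
      adj a b = sym (proj₂ (proj₂ anchored) a b)
      leafwise : ∀ i → A (leafAt i) ≡ v → Leafwise v
      leafwise i refl =
          (subst (λ w → G v w ≡ true) A-c (trans (adj (leafAt i) 2F) (star₆-leaf-2 i)) , subst (λ w → G v w ≡ false) A-q (trans (adj (leafAt i) 0F) (star₆-leaf-0 i)))
        , subst (λ w → G v w ≡ false) A-r (trans (adj (leafAt i) 1F) (star₆-leaf-1 i)) , λ j → trans (adj (leafAt i) (leafAt j)) (star₆-leaf-leaf i j)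
      at : ∀ a → A a ≡ v → Uniformly v ⊎ Leafwise v
      at 0F e = contradiction (inj₁ (trans (sym e) A-q)) other
      at 1F e = contradiction (inj₂ (inj₁ (trans (sym e) A-r))) other
      at 2F e = contradiction (inj₂ (inj₂ (trans (sym e) A-c))) other
      at (leafAt i) e = inj₂ (leafwise i e)

    leaf-type : ∀ {v} → Leaf v → Leafwise v
    leaf-type leaf with anchored-type (leaf-other leaf)
    ... | inj₂ leafwise = leafwise
    ... | inj₁ (b , vq , vr , vc , _) = case trans (sym (proj₁ leaf)) (trans vc (trans (sym vq) (proj₂ leaf))) of λ ()

  original : Anchored
  original = record { anchored = copy ; A-q = refl ; A-r = refl ; A-c = refl }

  leaf-r : ∀ {v} → Leaf v → G v r ≡ false
  leaf-r leaf = proj₁ (proj₂ (leaf-type original leaf))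

  -- A leaf `w` not in the original copy relates to it as its own leaves do, so it can take the
  -- place of vertex 3.
  through : ∀ {w} → Leaf w → Σ[ φ ∈ Anchored ] ∃[ i ] Anchored.A φ (leafAt i) ≡ w
  through {w} leaf with Fin.any? (λ i → T (leafAt i) ≟ w)
  ... | yes (i , e) = original , i , e
  ... | no ∄ = record { anchored = A , A-inj , λ a b → sym (A-adj a b) ; A-q = refl ; A-r = refl ; A-c = refl } , 0F , refl
    where
    A : Fin 6 → Fin n
    A 3F = w
    A a = T a
    w≢T : ∀ a → T a ≢ w
    w≢T 0F e = leaf-other leaf (inj₁ (sym e))
    w≢T 1F e = leaf-other leaf (inj₂ (inj₁ (sym e)))
    w≢T 2F e = leaf-other leaf (inj₂ (inj₂ (sym e)))
    w≢T (leafAt i) e = ∄ (i , e)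
    A-T : ∀ a → a ≢ 3F → A a ≡ T a
    A-T 0F _ = refl
    A-T 1F _ = refl
    A-T 2F _ = refl
    A-T 3F ne = contradiction refl ne
    A-T 4F _ = refl
    A-T 5F _ = refl
    A-inj : Injective _≡_ _≡_ A
    A-inj {a} {b} e with a ≟ 3F | b ≟ 3F
    ... | yes refl | yes refl = refl
    ... | yes refl | no b≢ = contradiction (sym (trans e (A-T b b≢))) (w≢T b)
    ... | no a≢ | yes refl = contradiction (trans (sym (A-T a a≢)) e) (w≢T a)
    ... | no a≢ | no b≢ = proj₁ (proj₂ copy) (trans (sym (A-T a a≢)) (trans e (A-T b b≢)))
    w-adj : ∀ b → b ≢ 3F → G w (T b) ≡ star₆ 3F b
    w-adj 0F _ = proj₂ leaf
    w-adj 1F _ = leaf-r leaf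
    w-adj 2F _ = proj₁ leaf
    w-adj 3F ne = contradiction refl ne
    w-adj 4F _ = proj₂ (proj₂ (leaf-type original leaf)) 1F
    w-adj 5F _ = proj₂ (proj₂ (leaf-type original leaf)) 2F
    star-sym : ∀ a b → star₆ a b ≡ star₆ b a
    star-sym = toWitness {a? = Fin.all? (λ a → Fin.all? (λ b → star₆ a b Bool.≟ star₆ b a))} _
    A-adj : ∀ a b → G (A a) (A b) ≡ star₆ a b
    A-adj a b with a ≟ 3F | b ≟ 3F
    ... | yes refl | yes refl = proj₂ simple w
    ... | yes refl | no b≢ = trans (cong (G w) (A-T b b≢)) (w-adj b b≢)
    ... | no a≢ | yes refl = trans (proj₁ simple (A a) w) (trans (cong (G w) (A-T a a≢)) (trans (w-adj a a≢) (star-sym 3F a)))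
    ... | no a≢ | no b≢ = trans (cong₂ G (A-T a a≢) (A-T b b≢)) (T-adj a b)

  -- Once `w` belongs to an anchored copy, `v` is leafwise to that copy and so misses `w`.
  leaf-leaf : ∀ {v w} → Leaf v → Leaf w → G v w ≡ false
  leaf-leaf lv lw with through lw
  ... | φ , i , refl = proj₂ (proj₂ (leaf-type φ lv)) i

  part : Bool → Bool → Fin 3
  part true  false = 2F
  part true  true  = 1F
  part false _     = 0F

  p : Fin n → Fin 3
  p v with core? v
  ... | yes _ = 2F
  ... | no _  = part (G v c) (G v q)

  p-core : ∀ {v} → Core v → p v ≡ 2F
  p-core {v} cv with core? v
  ... | yes _ = refl
  ... | no ¬cv = contradiction cv ¬cv

  p-leaf : ∀ {v} → Leaf v → p v ≡ 2F
  p-leaf {v} leaf with core? v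
  ... | yes _ = refl
  ... | no _ = cong₂ part (proj₁ leaf) (proj₂ leaf)

  p-inside : ∀ v → p v ≡ 2F → Core v ⊎ Leaf v
  p-inside v e with core? v
  ... | yes cv = inj₁ cv
  ... | no _ = inj₂ (is-leaf (G v c) (G v q) e)
    where
    is-leaf : ∀ b b′ → part b b′ ≡ 2F → b ≡ true × b′ ≡ false
    is-leaf true false _ = refl , refl

  -- Relating alike to `c` and `q`, the vertex cannot be leafwise to any anchored copy. It is
  -- therefore uniform to all of them, and every leaf lies in one.
  outer : ∀ b v → p v ≡ side b → Other v × G v q ≡ b × G v r ≡ b × G v c ≡ b × (∀ {w} → Leaf w → G v w ≡ b)
  outer b v e with core? v
  ... | yes _ = contradiction (sym e) (side≢2 b)
  ... | no other with anchored-type original other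
  ...   | inj₂ (leaf , _) = contradiction (trans (sym e) (cong₂ part (proj₁ leaf) (proj₂ leaf))) (side≢2 b)
  ...   | inj₁ (b′ , vq , vr , vc , _) = other , trans vq b′≡b , trans vr b′≡b , trans vc b′≡b , leaves
    where
    same : ∀ b b′ → part b′ b′ ≡ side b → b′ ≡ b
    same true true _ = refl
    same false false _ = refl
    b′≡b : b′ ≡ b
    b′≡b = same b b′ (trans (sym (cong₂ part vc vq)) e)
    leaves : ∀ {w} → Leaf w → G v w ≡ b
    leaves lw with through lw
    ... | φ , i , refl with anchored-type φ other
    ...   | inj₁ (b″ , _ , _ , vc′ , vl) = trans (vl i) (trans (sym vc′) (trans vc b′≡b))
    ...   | inj₂ ((vc′ , vq′) , _) = case trans (sym vc′) (trans vc (trans (sym vq) vq′)) of λ ()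

  -- The component K₂ and one edge at the centre, an induced 2K₂.
  σ : Fin 4 → Fin 6
  σ a = Fin.inject≤ a (s≤s (s≤s (s≤s (s≤s (z≤n {2})))))

  star-check : ∀ b → TwinCheck (λ a b → star₆ (σ a) (σ b)) b
  star-check true  = toWitness {a? = twinCheck? (λ a b → star₆ (σ a) (σ b)) true} _
  star-check false = toWitness {a? = twinCheck? (λ a b → star₆ (σ a) (σ b)) false} _

  homogeneous : ∀ b u v → u ≢ v → p u ≡ side b → p v ≡ side b → G u v ≡ b
  homogeneous b u v u≢v pu pv = twins {H = λ a b → star₆ (σ a) (σ b)}
    (restrict {G = G} {H = star₆} copy σ (λ {a} {b} → Fin.inject≤-injective _ _ a b)) (star-check b) u≢v
    (out u pu) (out v pv) (adj u pu) (adj v pv)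
    where
    module _ (w : Fin n) (pw : p w ≡ side b) where
      w-outer = outer b w pw
      out : ∀ a → T (σ a) ≢ w
      out 0F e = proj₁ w-outer (inj₁ (sym e))
      out 1F e = proj₁ w-outer (inj₂ (inj₁ (sym e)))
      out 2F e = proj₁ w-outer (inj₂ (inj₂ (sym e)))
      out 3F refl = side≢2 b (trans (sym pw) (p-leaf (leaf-T 0F)))
      adj : ∀ a → G w (T (σ a)) ≡ b
      adj 0F = proj₁ (proj₂ w-outer)
      adj 1F = proj₁ (proj₂ (proj₂ w-outer))
      adj 2F = proj₁ (proj₂ (proj₂ (proj₂ w-outer)))
      adj 3F = proj₂ (proj₂ (proj₂ (proj₂ w-outer))) (leaf-T 0F)

  mixed : ∀ b u v → p u ≡ 2F → p v ≡ side b → G u v ≡ b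
  mixed b u v pu pv = trans (proj₁ simple u v) (at (p-inside u pu))
    where
    v-outer = outer b v pv
    at : Core u ⊎ Leaf u → G v u ≡ b
    at (inj₁ (inj₁ refl)) = proj₁ (proj₂ v-outer)
    at (inj₁ (inj₂ (inj₁ refl))) = proj₁ (proj₂ (proj₂ v-outer))
    at (inj₁ (inj₂ (inj₂ refl))) = proj₁ (proj₂ (proj₂ (proj₂ v-outer)))
    at (inj₂ leaf) = proj₂ (proj₂ (proj₂ (proj₂ v-outer))) leaf

  separated : SeparatedBy G p
  separated = separated-by-sides simple homogeneous mixed

  leaves : List (Fin n)
  leaves = filter leaf? (allFin n)

  m : ℕ
  m = length leaves

  3≤m : 3 ℕ.≤ m
  3≤m = Fin.injective⇒≤ {f = index} index-inj
    where
    leaf∈ : ∀ (i : Fin 3) → T (leafAt i) ∈ leaves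
    leaf∈ i = List.∈-filter⁺ leaf? (List.∈-allFin _) (leaf-T i)
    index : Fin 3 → Fin m
    index i = Any.index (leaf∈ i)
    index-inj : Injective _≡_ _≡_ index
    index-inj {i} {j} e = Fin.suc-injective (Fin.suc-injective (Fin.suc-injective (proj₁ (proj₂ copy)
      (trans (Any.lookup-index (leaf∈ i)) (trans (cong (List.lookup leaves) e) (sym (Any.lookup-index (leaf∈ j))))))))

  leaf-vertex : Fin m → Fin n
  leaf-vertex = List.lookup leaves

  leaf-vertex-leaf : ∀ j → Leaf (leaf-vertex j)
  leaf-vertex-leaf j = proj₂ (List.∈-filter⁻ leaf? {xs = allFin n} (List.∈-lookup {xs = leaves} j))

  leaf-vertex-injective : ∀ {i j} → leaf-vertex i ≡ leaf-vertex j → i ≡ j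
  leaf-vertex-injective = unique-lookup-injective (Unique.filter⁺ leaf? (Unique.allFin⁺ n))

  base : Fin 3 → Fin n
  base i = T (Fin.inject≤ i (s≤s (s≤s (s≤s (z≤n {3})))))

  base-core : ∀ i → Core (base i)
  base-core 0F = inj₁ refl
  base-core 1F = inj₂ (inj₁ refl)
  base-core 2F = inj₂ (inj₂ refl)

  starOn : StarOn G (λ v → p v ≡ 2F) m
  starOn = record { vertex = vertex ; injective = λ {s} {t} → injective s t ; member = member ; onto = onto ; adjacency = adjacency }
    where
    vertex : Tag m → Fin n
    vertex = [ base , leaf-vertex ]′
    injective : ∀ s t → vertex s ≡ vertex t → s ≡ t
    injective (inj₁ i) (inj₁ j) e = cong inj₁ (Fin.inject≤-injective _ _ i j (proj₁ (proj₂ copy) e))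
    injective (inj₁ i) (inj₂ j) e = contradiction (subst Core e (base-core i)) (leaf-other (leaf-vertex-leaf j))
    injective (inj₂ i) (inj₁ j) e = contradiction (subst Core (sym e) (base-core j)) (leaf-other (leaf-vertex-leaf i))
    injective (inj₂ i) (inj₂ j) e = cong inj₂ (leaf-vertex-injective e)
    member : ∀ s → p (vertex s) ≡ 2F
    member (inj₁ i) = p-core (base-core i)
    member (inj₂ j) = p-leaf (leaf-vertex-leaf j)
    onto : ∀ v → p v ≡ 2F → ∃[ s ] vertex s ≡ v
    onto v e with p-inside v e
    ... | inj₁ (inj₁ refl) = inj₁ 0F , refl
    ... | inj₁ (inj₂ (inj₁ refl)) = inj₁ 1F , refl
    ... | inj₁ (inj₂ (inj₂ refl)) = inj₁ 2F , refl
    ... | inj₂ leaf = let v∈ = List.∈-filter⁺ leaf? (List.∈-allFin v) leaf in inj₂ (Any.index v∈) , sym (Any.lookup-index v∈)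
    leaf-base : ∀ j i → G (leaf-vertex j) (base i) ≡ tagAdj {m} (inj₂ j) (inj₁ i)
    leaf-base j 0F = proj₂ (leaf-vertex-leaf j)
    leaf-base j 1F = leaf-r (leaf-vertex-leaf j)
    leaf-base j 2F = proj₁ (leaf-vertex-leaf j)
    tagAdj-sym : ∀ i j → tagAdj {m} (inj₂ j) (inj₁ i) ≡ tagAdj (inj₁ i) (inj₂ j)
    tagAdj-sym 0F j = refl
    tagAdj-sym 1F j = refl
    tagAdj-sym 2F j = refl
    adjacency : ∀ s t → G (vertex s) (vertex t) ≡ tagAdj s t
    adjacency (inj₁ i) (inj₁ j) = trans (T-adj _ _) (table i j)
      where
      table : ∀ (i j : Fin 3) → star₆ (Fin.inject≤ i _) (Fin.inject≤ j _) ≡ tagAdj {m} (inj₁ i) (inj₁ j)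
      table 0F 0F = refl
      table 0F 1F = refl
      table 0F 2F = refl
      table 1F 0F = refl
      table 1F 1F = refl
      table 1F 2F = refl
      table 2F 0F = refl
      table 2F 1F = refl
      table 2F 2F = refl
    adjacency (inj₁ i) (inj₂ j) = trans (proj₁ simple (base i) (leaf-vertex j)) (trans (leaf-base j i) (tagAdj-sym i j))
    adjacency (inj₂ j) (inj₁ i) = leaf-base j i
    adjacency (inj₂ i) (inj₂ j) = leaf-leaf (leaf-vertex-leaf i) (leaf-vertex-leaf j)

starTag : ∀ m → Fin (m ℕ.+ 3) → Tag m
starTag m a = Fin.splitAt 3 (Fin.cast (ℕ.+-comm m 3) a)

starTag-onto : ∀ m s → ∃[ a ] starTag m a ≡ s
starTag-onto m s = Fin.cast (ℕ.+-comm 3 m) (Fin.join 3 m s) ,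
  trans (cong (Fin.splitAt 3) (trans (Fin.cast-trans (ℕ.+-comm 3 m) (ℕ.+-comm m 3) (Fin.join 3 m s)) (Fin.cast-is-id _ (Fin.join 3 m s)))) (Fin.splitAt-join 3 m s)

starTag-injective : ∀ m {a b} → starTag m a ≡ starTag m b → a ≡ b
starTag-injective m {a} {b} e = Fin.toℕ-injective (trans (sym (Fin.toℕ-cast (ℕ.+-comm m 3) a)) (trans (cong toℕ
  (trans (sym (Fin.join-splitAt 3 m (Fin.cast (ℕ.+-comm m 3) a))) (trans (cong (Fin.join 3 m) e) (Fin.join-splitAt 3 m (Fin.cast (ℕ.+-comm m 3) b)))))
  (Fin.toℕ-cast (ℕ.+-comm m 3) b)))

starTag-adj : ∀ m a b → K₂+K₁ₘ m a b ≡ tagAdj (starTag m a) (starTag m b)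
starTag-adj m a b = trans (cong₂ starAdj (sym (Fin.toℕ-cast (ℕ.+-comm m 3) a)) (sym (Fin.toℕ-cast (ℕ.+-comm m 3) b)))
  (table (Fin.cast (ℕ.+-comm m 3) a) (Fin.cast (ℕ.+-comm m 3) b))
  where
  table : ∀ (a b : Fin (3 ℕ.+ m)) → starAdj (toℕ a) (toℕ b) ≡ tagAdj (Fin.splitAt 3 a) (Fin.splitAt 3 b)
  table 0F 0F = refl
  table 0F 1F = refl
  table 0F 2F = refl
  table 0F (suc (suc (suc b))) = refl
  table 1F 0F = refl
  table 1F 1F = refl
  table 1F 2F = refl
  table 1F (suc (suc (suc b))) = refl
  table 2F 0F = refl
  table 2F 1F = refl
  table 2F 2F = refl
  table 2F (suc (suc (suc b))) = refl
  table (suc (suc (suc a))) 0F = refl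
  table (suc (suc (suc a))) 1F = refl
  table (suc (suc (suc a))) 2F = refl
  table (suc (suc (suc a))) (suc (suc (suc b))) = Bool.∧-zeroʳ (not (toℕ a ℕ.≡ᵇ toℕ b))

-- In the complement the leaves become the clique, the centre becomes the vertex K₁, and the ends of
-- K₂ become the two nonadjacent vertices.
coTag : ∀ m → Fin m ⊎ Fin 3 → Tag m
coTag m (inj₁ j)  = inj₂ j
coTag m (inj₂ 0F) = inj₁ 2F
coTag m (inj₂ 1F) = inj₁ 0F
coTag m (inj₂ 2F) = inj₁ 1F

coTag⁻¹ : ∀ m → Tag m → Fin m ⊎ Fin 3
coTag⁻¹ m (inj₂ j)  = inj₁ j
coTag⁻¹ m (inj₁ 0F) = inj₂ 1F
coTag⁻¹ m (inj₁ 1F) = inj₂ 2F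
coTag⁻¹ m (inj₁ 2F) = inj₂ 0F

coTag⁻¹-coTag : ∀ m s → coTag⁻¹ m (coTag m s) ≡ s
coTag⁻¹-coTag m (inj₁ j)  = refl
coTag⁻¹-coTag m (inj₂ 0F) = refl
coTag⁻¹-coTag m (inj₂ 1F) = refl
coTag⁻¹-coTag m (inj₂ 2F) = refl

coTag-injective : ∀ m s t → coTag m s ≡ coTag m t → s ≡ t
coTag-injective m s t e = trans (sym (coTag⁻¹-coTag m s)) (trans (cong (coTag⁻¹ m) e) (coTag⁻¹-coTag m t))

coTag-onto : ∀ m s → ∃[ t ] coTag m t ≡ s
coTag-onto m (inj₂ j)  = inj₁ j , refl
coTag-onto m (inj₁ 0F) = inj₂ 1F , refl
coTag-onto m (inj₁ 1F) = inj₂ 2F , refl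
coTag-onto m (inj₁ 2F) = inj₂ 0F , refl

position : ∀ m → Fin m ⊎ Fin 3 → ℕ
position m (inj₁ j)  = toℕ j
position m (inj₂ 0F) = m
position m (inj₂ 1F) = suc m
position m (inj₂ 2F) = suc (suc m)

position-splitAt : ∀ m (a : Fin (m ℕ.+ 3)) → position m (Fin.splitAt m a) ≡ toℕ a
position-splitAt m a = trans (joined (Fin.splitAt m a)) (cong toℕ (Fin.join-splitAt m 3 a))
  where
  joined : ∀ s → position m s ≡ toℕ (Fin.join m 3 s)
  joined (inj₁ j)  = sym (Fin.toℕ-↑ˡ j 3)
  joined (inj₂ 0F) = sym (trans (Fin.toℕ-↑ʳ m 0F) (ℕ.+-comm m 0))
  joined (inj₂ 1F) = sym (trans (Fin.toℕ-↑ʳ m 1F) (ℕ.+-comm m 1))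
  joined (inj₂ 2F) = sym (trans (Fin.toℕ-↑ʳ m 2F) (ℕ.+-comm m 2))

coTag-adj : ∀ m s t → s ≢ t → coAdj m (position m s) (position m t) ≡ not (tagAdj (coTag m s) (coTag m t))
coTag-adj m (inj₁ i)  (inj₁ j)  s≢t = coAdj-clique m (λ e → s≢t (cong inj₁ (Fin.toℕ-injective e))) (Fin.toℕ<n i) (Fin.toℕ<n j)
coTag-adj m (inj₁ i)  (inj₂ 0F) _ = coAdj-centre m (Fin.toℕ<n i)
coTag-adj m (inj₁ i)  (inj₂ 1F) _ = coAdj-far m (ℕ.<⇒≤ (Fin.toℕ<n i)) (ℕ.n<1+n m)
coTag-adj m (inj₁ i)  (inj₂ 2F) _ = coAdj-far m (ℕ.<⇒≤ (Fin.toℕ<n i)) (ℕ.m≤n⇒m≤1+n (ℕ.n<1+n m))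
coTag-adj m (inj₂ 0F) (inj₁ j)  _ = coAdj-centre′ m (Fin.toℕ<n j)
coTag-adj m (inj₂ 1F) (inj₁ j)  _ = coAdj-far′ m (ℕ.n<1+n m) (ℕ.<⇒≤ (Fin.toℕ<n j))
coTag-adj m (inj₂ 2F) (inj₁ j)  _ = coAdj-far′ m (ℕ.m≤n⇒m≤1+n (ℕ.n<1+n m)) (ℕ.<⇒≤ (Fin.toℕ<n j))
coTag-adj m (inj₂ 0F) (inj₂ 1F) _ = coAdj-far m ℕ.≤-refl (ℕ.n<1+n m)
coTag-adj m (inj₂ 0F) (inj₂ 2F) _ = coAdj-far m ℕ.≤-refl (ℕ.m≤n⇒m≤1+n (ℕ.n<1+n m))
coTag-adj m (inj₂ 1F) (inj₂ 0F) _ = coAdj-far′ m (ℕ.n<1+n m) ℕ.≤-refl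
coTag-adj m (inj₂ 2F) (inj₂ 0F) _ = coAdj-far′ m (ℕ.m≤n⇒m≤1+n (ℕ.n<1+n m)) ℕ.≤-refl
coTag-adj m (inj₂ 1F) (inj₂ 2F) _ = coAdj-pair m (ℕ.n<1+n m) (ℕ.m≤n⇒m≤1+n (ℕ.n<1+n m))
coTag-adj m (inj₂ 2F) (inj₂ 1F) _ = coAdj-pair m (ℕ.m≤n⇒m≤1+n (ℕ.n<1+n m)) (ℕ.n<1+n m)
coTag-adj m (inj₂ 0F) (inj₂ 0F) s≢t = contradiction refl s≢t
coTag-adj m (inj₂ 1F) (inj₂ 1F) s≢t = contradiction refl s≢t
coTag-adj m (inj₂ 2F) (inj₂ 2F) s≢t = contradiction refl s≢t

star-iso : ∀ {n} {G : Graph n} {V : Fin n → Set} {m} → StarOn G V m → InducedIso G V (K₂+K₁ₘ m)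
star-iso {m = m} star = vertex ∘ tag , (λ e → starTag-injective m (injective e)) , (λ a → member (tag a))
  , (λ v Vv → let s , vs≡v = onto v Vv ; a , ta≡s = starTag-onto m s in a , trans (cong vertex ta≡s) vs≡v)
  , λ a b → trans (starTag-adj m a b) (sym (adjacency (tag a) (tag b)))
  where
  open StarOn star
  tag = starTag m

co-star-iso : ∀ {n} {G : Graph n} {V : Fin n → Set} {m} → IsSimple G → StarOn (co G) V m → InducedIso G V (Kₘ+K₁∨2K₁ m)
co-star-iso {n} {G} {V} {m} simple star = g , g-inj , (λ a → member (tag a))
  , (λ v Vv → let s , vs≡v = onto v Vv ; t , ct≡s = coTag-onto m s in
       Fin.join m 3 t , trans (cong (vertex ∘ coTag m) (Fin.splitAt-join m 3 t)) (trans (cong vertex ct≡s) vs≡v))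
  , agree
  where
  open StarOn star
  tag : Fin (m ℕ.+ 3) → Tag m
  tag a = coTag m (Fin.splitAt m a)
  g : Fin (m ℕ.+ 3) → Fin n
  g a = vertex (tag a)
  splitAt-injective : ∀ {a b : Fin (m ℕ.+ 3)} → Fin.splitAt m a ≡ Fin.splitAt m b → a ≡ b
  splitAt-injective {a} {b} e = trans (sym (Fin.join-splitAt m 3 a)) (trans (cong (Fin.join m 3) e) (Fin.join-splitAt m 3 b))
  g-inj : Injective _≡_ _≡_ g
  g-inj e = splitAt-injective (coTag-injective m _ _ (injective e))
  coAdj-diag : ∀ i → coAdj m i i ≡ false
  coAdj-diag i rewrite ≡ᵇ-refl i = refl
  agree : ∀ a b → Kₘ+K₁∨2K₁ m a b ≡ G (g a) (g b)
  agree a b with a ≟ b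
  ... | yes refl = trans (coAdj-diag (toℕ a)) (sym (proj₂ simple (g a)))
  ... | no a≢b = begin
    coAdj m (toℕ a) (toℕ b)
      ≡⟨ cong₂ (coAdj m) (sym (position-splitAt m a)) (sym (position-splitAt m b)) ⟩
    coAdj m (position m (Fin.splitAt m a)) (position m (Fin.splitAt m b))
      ≡⟨ coTag-adj m (Fin.splitAt m a) (Fin.splitAt m b) (a≢b ∘ splitAt-injective) ⟩
    not (tagAdj (tag a) (tag b))           ≡⟨ cong not (adjacency (tag a) (tag b)) ⟨
    not (co G (g a) (g b))                 ≡⟨ cong not (co-≢ G (a≢b ∘ g-inj)) ⟩
    not (not (G (g a) (g b)))              ≡⟨ Bool.not-involutive (G (g a) (g b)) ⟩
    G (g a) (g b)                          ∎
    where open ≡-Reasoning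

-- Split graphs

pairs : ∀ k → List (Fin k × Fin k)
pairs k = filter (λ p → proj₁ p Fin.<? proj₂ p) (List.cartesianProduct (allFin k) (allFin k))

-- With `u ≢ v` included, a map respecting all the pairs is injective at no extra cost.
Rel : ∀ {n} → Graph n → Bool → Fin n → Fin n → Set
Rel G b u v = u ≢ v × G u v ≡ b

PairsOf : ∀ {n k} → Graph n → Graph k → (Fin k → Fin n) → Set
PairsOf {k = k} G H g = All (λ p → Rel G (H (proj₁ p) (proj₂ p)) (g (proj₁ p)) (g (proj₂ p))) (pairs k)

copy-from-pairs : ∀ {n k} {G : Graph n} {H : Graph k} → IsSimple G → IsSimple H → (g : Fin k → Fin n) → PairsOf G H g → InducedCopy G H
copy-from-pairs {n} {k} {G} {H} simple H-simple g rels = g , g-inj , agree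
  where
  rel : ∀ {a b} → a Fin.< b → Rel G (H a b) (g a) (g b)
  rel {a} {b} a<b = All.lookup rels
    (List.∈-filter⁺ (λ p → proj₁ p Fin.<? proj₂ p) (List.∈-cartesianProduct⁺ (List.∈-allFin a) (List.∈-allFin b)) a<b)
  g-inj : Injective _≡_ _≡_ g
  g-inj {a} {b} e with Fin.<-cmp a b
  ... | tri< a<b _ _ = contradiction e (proj₁ (rel a<b))
  ... | tri≈ _ a≡b _ = a≡b
  ... | tri> _ _ b<a = contradiction (sym e) (proj₁ (rel b<a))
  agree : ∀ a b → H a b ≡ G (g a) (g b)
  agree a b with Fin.<-cmp a b
  ... | tri< a<b _ _ = sym (proj₂ (rel a<b))
  ... | tri≈ _ refl _ = trans (proj₂ H-simple a) (sym (proj₂ simple (g a)))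
  ... | tri> _ _ b<a = trans (proj₁ H-simple a b) (trans (sym (proj₂ (rel b<a))) (proj₁ simple (g b) (g a)))

2K₂-simple : IsSimple 2K₂
2K₂-simple = toWitness {a? = Fin.all? (λ a → Fin.all? (λ b → 2K₂ a b Bool.≟ 2K₂ b a)) ×-dec Fin.all? (λ a → 2K₂ a a Bool.≟ false)} _

C₅-simple : IsSimple C₅
C₅-simple = toWitness {a? = Fin.all? (λ a → Fin.all? (λ b → C₅ a b Bool.≟ C₅ b a)) ×-dec Fin.all? (λ a → C₅ a a Bool.≟ false)} _

-- The minimal non-split graphs of Földes and Hammer, with C₄ given as the complement of 2K₂.
Obstruction : ∀ {n} → Graph n → Set
Obstruction G = InducedCopy G 2K₂ ⊎ InducedCopy (co G) 2K₂ ⊎ InducedCopy G C₅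

module SplitOrObstruction {n} {G : Graph n} (simple : IsSimple G) where
  open DecMembership (_≟_ {n}) using (_∈?_)

  G-sym : ∀ {u v b} → G u v ≡ b → G v u ≡ b
  G-sym {u} {v} e = trans (proj₁ simple v u) e

  E : Bool → Fin n → Fin n → Set
  E = Rel G

  E-sym : ∀ {b u v} → E b u v → E b v u
  E-sym (u≢v , e) = u≢v ∘ sym , G-sym e

  -- 2K₂ and C₄ are the same pattern with edges and non-edges exchanged. The parameter `b` lets one
  -- argument treat clique and independent set alike.
  two-pairs : ∀ b {u v w z} → E b u v → E b w z → E (not b) u w → E (not b) u z → E (not b) v w → E (not b) v z → Obstruction G
  two-pairs true {u} {v} {w} {z} uv wz uw uz vw vz =
    inj₁ (copy-from-pairs simple 2K₂-simple (Vec.lookup (u ∷ v ∷ w ∷ z ∷ [])) (uv ∷ uw ∷ uz ∷ vw ∷ vz ∷ wz ∷ []))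
  two-pairs false {u} {v} {w} {z} uv wz uw uz vw vz =
    inj₂ (inj₁ (copy-from-pairs (co-simple simple) 2K₂-simple (Vec.lookup (u ∷ v ∷ w ∷ z ∷ []))
      (flip uv ∷ flip uw ∷ flip uz ∷ flip vw ∷ flip vz ∷ flip wz ∷ [])))
    where
    flip : ∀ {b u v} → E b u v → Rel (co G) (not b) u v
    flip (u≢v , e) = u≢v , trans (co-≢ G u≢v) (cong not e)

  five-cycle : ∀ {u v w y z} → E true u v → E true v w → E true w y → E true y z → E true z u →
    E false u w → E false u y → E false v y → E false v z → E false w z → Obstruction G
  five-cycle {u} {v} {w} {y} {z} uv vw wy yz zu uw uy vy vz wz =
    inj₂ (inj₂ (copy-from-pairs simple C₅-simple (Vec.lookup (u ∷ v ∷ w ∷ y ∷ z ∷ []))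
      (uv ∷ uw ∷ uy ∷ E-sym zu ∷ vw ∷ vy ∷ vz ∷ wy ∷ wz ∷ yz ∷ [])))

  -- true marks the clique, false the independent set.
  Splits : (Fin n → Bool) → List (Fin n) → Set
  Splits q vs = ∀ {u v} → u ∈ vs → v ∈ vs → u ≢ v → q u ≡ q v → G u v ≡ q u

  update : (Fin n → Bool) → Fin n → Bool → Fin n → Bool
  update q y b v = if does (v ≟ y) then b else q v

  strip : ∀ {y w : Fin n} {vs} → w ∈ y ∷ vs → w ≢ y → w ∈ vs
  strip (here e) ne = contradiction e ne
  strip (there w∈) _ = w∈

  update-splits : ∀ {q vs} y b → Splits q vs → (∀ {v} → v ∈ vs → v ≢ y → q v ≡ b → G y v ≡ b) → Splits (update q y b) (y ∷ vs)
  update-splits {q} {vs} y b splits y-ok {u} {v} u∈ v∈ u≢v qu≡qv with u ≟ y | v ≟ y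
  ... | yes refl | yes refl = contradiction refl u≢v
  ... | yes refl | no v≢y = y-ok (strip v∈ v≢y) v≢y (sym qu≡qv)
  ... | no u≢y | yes refl = trans (G-sym (y-ok (strip u∈ u≢y) u≢y qu≡qv)) (sym qu≡qv)
  ... | no u≢y | no v≢y = splits (strip u∈ u≢y) (strip v∈ v≢y) u≢v qu≡qv

  weaken : ∀ {q y vs} → Splits q (y ∷ vs) → Splits q vs
  weaken splits u∈ v∈ = splits (there u∈) (there v∈)

  not-≢ : ∀ {b c} → c ≢ b → c ≡ not b
  not-≢ {false} {true} _ = refl
  not-≢ {true} {false} _ = refl
  not-≢ {false} {false} h = contradiction refl h
  not-≢ {true} {true} h = contradiction refl h

  b≢not : ∀ {b} → b ≢ not b
  b≢not {true} ()
  b≢not {false} ()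

  -- A splitting of `vs` is repaired to admit `x` by moving at most one vertex out of each side;
  -- where no such repair works, an obstruction appears.
  module Insert (x : Fin n) (vs : List (Fin n)) (x∉ : ¬ x ∈ vs) (q : Fin n → Bool) (splits : Splits q vs) where

    Outcome : Set
    Outcome = Obstruction G ⊎ ∃[ q′ ] Splits q′ (x ∷ vs)

    Conflict : Bool → Fin n → Set
    Conflict b u = u ∈ vs × q u ≡ b × G x u ≡ not b

    conflict? : ∀ b u → Dec (Conflict b u)
    conflict? b u = (u ∈? vs) ×-dec ((q u Bool.≟ b) ×-dec (G x u Bool.≟ not b))

    x≢ : ∀ {u} → u ∈ vs → x ≢ u
    x≢ u∈ refl = x∉ u∈

    join-side : ∀ b → (∀ u → ¬ Conflict b u) → Outcome
    join-side b none = inj₂ (update q x b , update-splits x b splits ok)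
      where
      ok : ∀ {v} → v ∈ vs → v ≢ x → q v ≡ b → G x v ≡ b
      ok {v} v∈ _ qv with G x v Bool.≟ b
      ... | yes e = e
      ... | no ne = contradiction (v∈ , qv , not-≢ ne) (none v)

    x-conflict : ∀ {b u} → Conflict b u → E (not b) x u
    x-conflict (u∈ , _ , e) = x≢ u∈ , e

    x-conflict-not : ∀ {b u} → Conflict (not b) u → E b x u
    x-conflict-not {b} (u∈ , _ , e) = x≢ u∈ , trans e (Bool.not-involutive b)

    same-side : ∀ {b u v} → u ∈ vs → v ∈ vs → u ≢ v → q u ≡ b → q v ≡ b → E b u v
    same-side u∈ v∈ u≢v qu qv = u≢v , trans (splits u∈ v∈ u≢v (trans qu (sym qv))) qu

    cross : ∀ {b u v} → q u ≡ b → q v ≡ not b → u ≢ v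
    cross qu qv refl = b≢not (trans (sym qu) qv)

    not-not : ∀ {b u v} → E b u v → E (not (not b)) u v
    not-not {b} (ne , e) = ne , trans e (sym (Bool.not-involutive b))

    -- The pairs `x a` and `k k′` have status `b`, and the four pairs between them have the opposite
    -- one.
    two-conflicts : ∀ {b k k′ a} → Conflict b k → Conflict b k′ → k ≢ k′ → Conflict (not b) a → G a k ≡ not b → G a k′ ≡ not b → Obstruction G
    two-conflicts {b} ck ck′ k≢k′ ca ak ak′ = two-pairs b (x-conflict-not ca)
      (same-side (proj₁ ck) (proj₁ ck′) k≢k′ (proj₁ (proj₂ ck)) (proj₁ (proj₂ ck′)))
      (x-conflict ck) (x-conflict ck′)
      (cross (proj₁ (proj₂ ck)) (proj₁ (proj₂ ca)) ∘ sym , ak) (cross (proj₁ (proj₂ ck′)) (proj₁ (proj₂ ca)) ∘ sym , ak′)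

    -- With `k` alone in the way, `x` can join side `b` as soon as `k` can leave it.
    module Unique-conflict (b : Bool) {k} (ck : Conflict b k) (k-only : ∀ u → Conflict b u → u ≡ k) {a} (ca : Conflict (not b) a) where
      c = not b
      k∈ = proj₁ ck
      qk = proj₁ (proj₂ ck)

      x-side-b : ∀ {v} → v ∈ vs → q v ≡ b → v ≢ k → G x v ≡ b
      x-side-b {v} v∈ qv v≢k with G x v Bool.≟ b
      ... | yes e = e
      ... | no ne = contradiction (k-only v (v∈ , qv , not-≢ ne)) v≢k

      swap : (∀ {z} → z ∈ vs → q z ≡ c → G k z ≡ c) → Outcome
      swap k-ok = inj₂ (update q₁ x b , update-splits x b (weaken (update-splits k c splits (λ z∈ _ qz → k-ok z∈ qz))) ok)
        where
        q₁ = update q k c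
        ok : ∀ {v} → v ∈ vs → v ≢ x → q₁ v ≡ b → G x v ≡ b
        ok {v} v∈ _ e with v ≟ k
        ... | yes refl = contradiction (sym e) b≢not
        ... | no v≢k = x-side-b v∈ e v≢k

      -- The vertex `z` keeps `k` from changing sides. But it relates by `b` to both `x` and `k`, so
      -- `z` itself may be able to come over to side `b`.
      module Pivot {z} (cz : Conflict c z) (kz : G z k ≡ b) where
        z∈ = proj₁ cz
        qz = proj₁ (proj₂ cz)

        blocked : ∀ {k′} → k′ ∈ vs → q k′ ≡ b → G z k′ ≡ c → Obstruction G
        blocked {k′} k′∈ qk′ zk′ = two-pairs c
          (x-conflict ck) (cross qk′ qz ∘ sym , zk′)
          (not-not (x-conflict-not cz)) (not-not (x≢ k′∈ , x-side-b k′∈ qk′ k′≢k))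
          (not-not (cross qk qz , G-sym kz)) (not-not (same-side k∈ k′∈ (k′≢k ∘ sym) qk qk′))
          where
          k′≢k : k′ ≢ k
          k′≢k refl = b≢not (trans (sym kz) zk′)

        module _ (z-ok : ∀ {v} → v ∈ vs → q v ≡ b → G z v ≡ b) where
          q₁ = update q z b
          splits₁ : Splits q₁ vs
          splits₁ = weaken (update-splits z b splits (λ v∈ _ qv → z-ok v∈ qv))

          q₁-c : ∀ {v} → q₁ v ≡ c → v ≢ z × q v ≡ c
          q₁-c {v} e with v ≟ z
          ... | yes refl = contradiction e b≢not
          ... | no v≢z = v≢z , e

          absorb : (∀ u → Conflict c u → u ≡ z) → Outcome
          absorb z-only = inj₂ (update q₁ x c , update-splits x c splits₁ ok)
            where
            ok : ∀ {v} → v ∈ vs → v ≢ x → q₁ v ≡ c → G x v ≡ c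
            ok {v} v∈ _ e with G x v Bool.≟ c
            ... | yes xv = xv
            ... | no ne = contradiction (z-only v (v∈ , proj₂ (q₁-c e) , not-≢ ne)) (proj₁ (q₁-c e))

          -- Here `k` and `z` trade places, and `x` joins `z` on side `b`.
          exchange : (∀ {v} → v ∈ vs → v ≢ z → q v ≡ c → G k v ≡ c) → Outcome
          exchange k-ok = inj₂ (update q₂ x b , update-splits x b
              (weaken (update-splits k c splits₁ (λ v∈ _ e → k-ok v∈ (proj₁ (q₁-c e)) (proj₂ (q₁-c e))))) ok)
            where
            q₂ = update q₁ k c
            ok : ∀ {v} → v ∈ vs → v ≢ x → q₂ v ≡ b → G x v ≡ b
            ok {v} v∈ _ e with v ≟ k
            ... | yes refl = contradiction (sym e) b≢not
            ... | no v≢k with v ≟ z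
            ...   | yes refl = proj₂ (x-conflict-not cz)
            ...   | no v≢z = x-side-b v∈ e v≢k

        pivot : Outcome
        pivot with Fin.any? (λ v → (v ∈? vs) ×-dec ((q v Bool.≟ b) ×-dec (G z v Bool.≟ c)))
        ... | yes (k′ , k′∈ , qk′ , zk′) = inj₁ (blocked k′∈ qk′ zk′)
        ... | no ∄ = decide (Fin.any? (λ u → conflict? c u ×-dec ¬? (u ≟ z)))
          where
          z-ok : ∀ {v} → v ∈ vs → q v ≡ b → G z v ≡ b
          z-ok {v} v∈ qv with G z v Bool.≟ b
          ... | yes e = e
          ... | no ne = contradiction (v , v∈ , qv , not-≢ ne) ∄
          decide : Dec (∃[ u ] Conflict c u × u ≢ z) → Outcome
          decide (no alone) = absorb z-ok (λ u cu → decidable-stable (u ≟ z) (λ u≢z → alone (u , cu , u≢z)))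
          -- A second conflict `u` bars `x` from side `c`. If some `v` also bars `k` from replacing
          -- `z`, then `x`, `k` and two of `u`, `v`, `z` form an obstruction.
          decide (yes (u , cu , u≢z)) with Fin.any? (λ v → (v ∈? vs) ×-dec (¬? (v ≟ z) ×-dec ((q v Bool.≟ c) ×-dec (G k v Bool.≟ b))))
          ... | no none = exchange z-ok k-ok
            where
            k-ok : ∀ {v} → v ∈ vs → v ≢ z → q v ≡ c → G k v ≡ c
            k-ok {v} v∈ v≢z qv with G k v Bool.≟ c
            ... | yes e = e
            ... | no ne = contradiction (v , v∈ , v≢z , qv , trans (not-≢ ne) (Bool.not-involutive b)) none
          ... | yes (v , v∈ , v≢z , qv , kv) with conflict? c v
          ...   | yes cv = inj₁ (doubly-hit cv v≢z kv)
            where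
            doubly-hit : ∀ {v} → Conflict c v → v ≢ z → G k v ≡ b → Obstruction G
            doubly-hit cv v≢z kv = two-pairs c (x-conflict ck)
              (same-side (proj₁ cv) z∈ v≢z (proj₁ (proj₂ cv)) qz)
              (not-not (x-conflict-not cv)) (not-not (x-conflict-not cz))
              (not-not (cross qk (proj₁ (proj₂ cv)) , kv)) (not-not (cross qk qz , G-sym kz))
          ...   | no ¬cv with G k u Bool.≟ b
          ...     | yes ku = inj₁ (two-pairs c (x-conflict ck)
                    (same-side (proj₁ cu) z∈ u≢z (proj₁ (proj₂ cu)) qz)
                    (not-not (x-conflict-not cu)) (not-not (x-conflict-not cz))
                    (not-not (cross qk (proj₁ (proj₂ cu)) , ku)) (not-not (cross qk qz , G-sym kz)))
          ...     | no k≁u = inj₁ (two-pairs b (x-conflict-not cu) (cross qk qv , kv)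
                    (x-conflict ck) (x≢ v∈ , x≁v)
                    (cross qk (proj₁ (proj₂ cu)) ∘ sym , G-sym (not-≢ k≁u))
                    (same-side (proj₁ cu) v∈ (λ { refl → ¬cv cu }) (proj₁ (proj₂ cu)) qv))
            where
            x≁v : G x v ≡ c
            x≁v with G x v Bool.≟ c
            ... | yes e = e
            ... | no ne = contradiction (v∈ , qv , not-≢ ne) ¬cv

      -- If the vertex `z` holding back `k` is in conflict with `x`, it serves as pivot. Otherwise
      -- the known conflict `a` does, unless `x a` and `k z` are the two pairs of an obstruction.
      resolve : Outcome
      resolve with Fin.any? (λ z → (z ∈? vs) ×-dec ((q z Bool.≟ c) ×-dec (G k z Bool.≟ b)))
      ... | no none = swap (λ {z} z∈ qz → k-ok z∈ qz)
        where
        k-ok : ∀ {z} → z ∈ vs → q z ≡ c → G k z ≡ c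
        k-ok {z} z∈ qz with G k z Bool.≟ c
        ... | yes e = e
        ... | no ne = contradiction (z , z∈ , qz , trans (not-≢ ne) (Bool.not-involutive b)) none
      ... | yes (z , z∈ , qz , kz) with conflict? c z
      ...   | yes cz = Pivot.pivot cz (G-sym kz)
      ...   | no ¬cz with G a k Bool.≟ b
      ...     | yes ak = Pivot.pivot ca ak
      ...     | no a≁k = inj₁ (two-pairs b (x-conflict-not ca) (cross qk qz , kz)
                  (x-conflict ck) (x≢ z∈ , x≁z)
                  (cross qk (proj₁ (proj₂ ca)) ∘ sym , not-≢ a≁k)
                  (same-side (proj₁ ca) z∈ (λ { refl → ¬cz ca }) (proj₁ (proj₂ ca)) qz))
        where
        x≁z : G x z ≡ c
        x≁z with G x z Bool.≟ c
        ... | yes e = e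
        ... | no ne = contradiction (z∈ , qz , not-≢ ne) ¬cz

    -- Two conflicts on each side leave three patterns between `a`, `a′` and `k`, `k′`. One of `a`,
    -- `a′` missing both of the others gives 2K₂, one of `k`, `k′` adjacent to both gives C₄, and a
    -- perfect matching closes the 5-cycle through `x`.
    crossed : ∀ {k k′ a a′} → Conflict true k → Conflict true k′ → k ≢ k′ → Conflict false a → Conflict false a′ → a ≢ a′ → Obstruction G
    crossed {k} {k′} {a} {a′} ck ck′ k≢k′ ca ca′ a≢a′
      with G a k in ak | G a k′ in ak′ | G a′ k in a′k | G a′ k′ in a′k′
    ... | false | false | _ | _ = two-conflicts ck ck′ k≢k′ ca ak ak′
    ... | _ | _ | false | false = two-conflicts ck ck′ k≢k′ ca′ a′k a′k′
    ... | true | _ | true | _ = two-conflicts ca ca′ a≢a′ ck (G-sym ak) (G-sym a′k)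
    ... | _ | true | _ | true = two-conflicts ca ca′ a≢a′ ck′ (G-sym ak′) (G-sym a′k′)
    ... | true | false | false | true = five-cycle (x-conflict-not ca) (cross (proj₁ (proj₂ ck)) (proj₁ (proj₂ ca)) ∘ sym , ak)
        (same-side (proj₁ ck) (proj₁ ck′) k≢k′ (proj₁ (proj₂ ck)) (proj₁ (proj₂ ck′)))
        (cross (proj₁ (proj₂ ck′)) (proj₁ (proj₂ ca′)) , G-sym a′k′) (E-sym (x-conflict-not ca′))
        (x-conflict ck) (x-conflict ck′) (cross (proj₁ (proj₂ ck′)) (proj₁ (proj₂ ca)) ∘ sym , ak′)
        (same-side (proj₁ ca) (proj₁ ca′) a≢a′ (proj₁ (proj₂ ca)) (proj₁ (proj₂ ca′)))
        (cross (proj₁ (proj₂ ck)) (proj₁ (proj₂ ca′)) , G-sym a′k)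
    ... | false | true | true | false = five-cycle (x-conflict-not ca) (cross (proj₁ (proj₂ ck′)) (proj₁ (proj₂ ca)) ∘ sym , ak′)
        (same-side (proj₁ ck′) (proj₁ ck) (k≢k′ ∘ sym) (proj₁ (proj₂ ck′)) (proj₁ (proj₂ ck)))
        (cross (proj₁ (proj₂ ck)) (proj₁ (proj₂ ca′)) , G-sym a′k) (E-sym (x-conflict-not ca′))
        (x-conflict ck′) (x-conflict ck) (cross (proj₁ (proj₂ ck)) (proj₁ (proj₂ ca)) ∘ sym , ak)
        (same-side (proj₁ ca) (proj₁ ca′) a≢a′ (proj₁ (proj₂ ca)) (proj₁ (proj₂ ca′)))
        (cross (proj₁ (proj₂ ck′)) (proj₁ (proj₂ ca′)) , G-sym a′k′)

    only? : ∀ b k → (∀ u → Conflict b u → u ≡ k) ⊎ (∃[ u ] Conflict b u × k ≢ u)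
    only? b k with Fin.any? (λ u → conflict? b u ×-dec ¬? (k ≟ u))
    ... | yes r = inj₂ r
    ... | no ∄ = inj₁ (λ u cu → sym (decidable-stable (k ≟ u) (λ k≢u → ∄ (u , cu , k≢u))))

    insert : Outcome
    insert with Fin.any? (conflict? true) | Fin.any? (conflict? false)
    ... | no none | _ = join-side true (λ u cu → none (u , cu))
    ... | _ | no none = join-side false (λ u cu → none (u , cu))
    ... | yes (k , ck) | yes (a , ca) with only? true k | only? false a
    ...   | inj₁ k-only | _ = Unique-conflict.resolve true ck k-only ca
    ...   | _ | inj₁ a-only = Unique-conflict.resolve false ca a-only ck
    ...   | inj₂ (k′ , ck′ , k≢k′) | inj₂ (a′ , ca′ , a≢a′) = inj₁ (crossed ck ck′ k≢k′ ca ca′ a≢a′)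

  split-or-obstruction : ∀ {vs} → Unique vs → Obstruction G ⊎ ∃[ q ] Splits q vs
  split-or-obstruction [] = inj₂ ((λ _ → true) , λ ())
  split-or-obstruction {x ∷ vs} (x∉ ∷ vs!) with split-or-obstruction vs!
  ... | inj₁ obstruction = inj₁ obstruction
  ... | inj₂ (q , splits) = Insert.insert x vs (λ x∈ → All.lookup x∉ x∈ refl) q (λ {u} {v} → splits {u} {v})

-- From an induced obstruction to a partition

Outcome : ∀ {n} → Graph n → Set
Outcome {n} G = Σ[ p ∈ (Fin n → Fin 3) ] SeparatedBy G p ×
  (length (filter (λ v → p v ≟ 2F) (allFin n)) ℕ.< 6
   ⊎ InducedIso G (λ v → p v ≡ 2F) U
   ⊎ InducedIso G (λ v → p v ≡ 2F) Ū
   ⊎ (∃[ m ] 3 ℕ.≤ m × StarOn G (λ v → p v ≡ 2F) m))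

firstFour : ∀ {k} → Fin 4 → Fin (4 ℕ.+ k)
firstFour a = Fin.inject≤ a (s≤s (s≤s (s≤s (s≤s z≤n))))

firstFour-injective : ∀ {k} → Injective _≡_ _≡_ (firstFour {k})
firstFour-injective {x = a} {b} = Fin.inject≤-injective _ _ a b

-- In U the edges 12 and 34 induce 2K₂, and in Ū they are the diagonals of an induced C₄.
middleFour : Fin 4 → Fin 6
middleFour a = suc (firstFour a)

middleFour-injective : Injective _≡_ _≡_ middleFour
middleFour-injective e = firstFour-injective (Fin.suc-injective e)

twin-checks? : ∀ H → Dec (TwinCheck H true × TwinCheck H false)
twin-checks? H = twinCheck? H true ×-dec twinCheck? H false

from-checks : ∀ H → TwinCheck H true × TwinCheck H false → ∀ b → TwinCheck H b
from-checks H (t , f) true  = t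
from-checks H (t , f) false = f

2K₂-twin : ∀ b → TwinCheck 2K₂ b
2K₂-twin = from-checks 2K₂ (toWitness {a? = twin-checks? 2K₂} _)

C₅-twin : ∀ b → TwinCheck (λ i j → C₅ (firstFour i) (firstFour j)) b
C₅-twin = from-checks (λ i j → C₅ (firstFour i) (firstFour j)) (toWitness {a? = twin-checks? (λ i j → C₅ (firstFour i) (firstFour j))} _)

U-twin : ∀ b → TwinCheck (λ i j → U (middleFour i) (middleFour j)) b
U-twin = from-checks (λ i j → U (middleFour i) (middleFour j)) (toWitness {a? = twin-checks? (λ i j → U (middleFour i) (middleFour j))} _)

Ū-twin : ∀ b → TwinCheck (λ i j → Ū (middleFour i) (middleFour j)) b
Ū-twin = from-checks (λ i j → Ū (middleFour i) (middleFour j)) (toWitness {a? = twin-checks? (λ i j → Ū (middleFour i) (middleFour j))} _)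

module Outcomes {n} {G : Graph n} (simple : IsSimple G) (free : Free G) where
  open Copies simple free

  Mixed : ∀ {k} {H : Graph k} → InducedCopy G H → Fin n → Set
  Mixed copy w = Extension.Outside simple copy w × ¬ Uniform (Extension.bits simple copy w)

  unmixed-or-mixed : ∀ {k} {H : Graph k} (copy : InducedCopy G H) →
    (∀ w → Extension.Outside simple copy w → Uniform (Extension.bits simple copy w)) ⊎ ∃[ w ] Mixed copy w
  unmixed-or-mixed copy with Fin.any? (λ w → Extension.outside? simple copy w ×-dec ¬? (uniform? (Extension.bits simple copy w)))
  ... | yes r = inj₂ r
  ... | no ∄ = inj₁ (λ w out → decidable-stable (uniform? (Extension.bits simple copy w)) (λ ¬u → ∄ (w , out , ¬u)))

  small-outcome : ∀ {k} {H : Graph k} (copy : InducedCopy G H) (σ : Fin 4 → Fin k) → Injective _≡_ _≡_ σ →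
    (∀ b → TwinCheck (λ i j → H (σ i) (σ j)) b) → (∀ w → Extension.Outside simple copy w → Uniform (Extension.bits simple copy w)) →
    k ℕ.< 6 → Outcome G
  small-outcome copy σ σ-inj check unmixed k<6 = p , separated , inj₁ (subst (ℕ._< 6) (sym hull-size) k<6)
    where open Hull copy σ σ-inj check unmixed

  rigid-unmixed : ∀ {H : Graph 6} (copy : InducedCopy G H) → (∀ c → ¬ Uniform c → Deletable (ext H c)) →
    ∀ w → Extension.Outside simple copy w → Uniform (Extension.bits simple copy w)
  rigid-unmixed {H} copy deletable w out = decidable-stable (uniform? (bits w))
    (λ ¬u → deletable-absurd {H = ext H (bits w)} (extend out) (deletable (bits w) ¬u))
    where open Extension simple copy

  U-outcome : InducedCopy G U → Outcome G
  U-outcome copy = p , separated , inj₂ (inj₁ hull-iso)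
    where open Hull copy middleFour middleFour-injective U-twin (rigid-unmixed copy U-extension)

  Ū-outcome : InducedCopy G Ū → Outcome G
  Ū-outcome copy = p , separated , inj₂ (inj₂ (inj₁ hull-iso))
    where open Hull copy middleFour middleFour-injective Ū-twin (rigid-unmixed copy Ū-extension)

  star-outcome : InducedCopy G star₆ → Outcome G
  star-outcome copy = p , separated , inj₂ (inj₂ (inj₂ (m , 3≤m , starOn)))
    where open StarPartition simple free copy

  shape-outcome : ∀ s → InducedCopy G (shapeGraph s) → Outcome G
  shape-outcome shape-U    = U-outcome
  shape-outcome shape-Ū    = Ū-outcome
  shape-outcome shape-star = star-outcome

  C₅-outcome : InducedCopy G C₅ → Outcome G
  C₅-outcome copy = small-outcome copy firstFour firstFour-injective C₅-twin unmixed (ℕ.n<1+n 5)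
    where
    open Extension simple copy
    unmixed : ∀ w → Outside w → Uniform (bits w)
    unmixed w out = decidable-stable (uniform? (bits w)) (λ ¬u → free (extend out) (C₅-extension (bits w) ¬u))

  2K₂-outcome : InducedCopy G 2K₂ → Outcome G
  2K₂-outcome copy with unmixed-or-mixed copy
  ... | inj₁ unmixed = small-outcome copy id id 2K₂-twin unmixed (ℕ.m≤n⇒m≤1+n (ℕ.n<1+n 4))
  ... | inj₂ (v , v-out , v-mixed) = five-vertices (Extension.extend simple copy v-out)
    where
    c = Extension.bits simple copy v
    five-vertices : InducedCopy G (ext 2K₂ c) → Outcome G
    five-vertices copy₅ with unmixed-or-mixed copy₅
    -- `suc` skips the added vertex and recovers the original 2K₂ for the twin check.
    ... | inj₁ unmixed = small-outcome copy₅ suc Fin.suc-injective 2K₂-twin unmixed (ℕ.n<1+n 5)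
    ... | inj₂ (w , w-out , w-mixed) = six-vertices (Extension.extend simple copy₅ w-out)
      (2K₂-extension c v-mixed (Extension.bits simple copy₅ w) w-mixed)
      where
      six-vertices : ∀ {H} → InducedCopy G H → 𝓑-degrees H ⊎ Any.Any (Placement H) placements → Outcome G
      six-vertices copy₆ (inj₁ ∈𝓑) = contradiction ∈𝓑 (free copy₆)
      six-vertices {H} copy₆ (inj₂ placed) with Any.satisfied placed
      ... | (s , π) , π-inj , π-adj = shape-outcome s
        (copy-≗ {G = G} π-adj (restrict {G = G} {H = H} copy₆ (Vec.lookup π) (λ {a} {b} → π-inj a b)))

iso-≐ : ∀ {n k} {G : Graph n} {H : Graph k} {V V′ : Fin n → Set} → (∀ v → V v → V′ v) → (∀ v → V′ v → V v) → InducedIso G V H → InducedIso G V′ H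
iso-≐ V⊆ ⊆V (g , g-inj , g-V , onto , adj) = g , g-inj , (λ a → V⊆ (g a) (g-V a)) , (λ v Vv → onto v (⊆V v Vv)) , adj

co-iso : ∀ {n k} {G : Graph n} {H K : Graph k} {V : Fin n → Set} → IsSimple G → (∀ a b → K a b ≡ co H a b) → InducedIso (co G) V H → InducedIso G V K
co-iso {G = G} {H} simple K≡ (g , g-inj , g-V , onto , adj) = g , g-inj , g-V , onto ,
  λ a b → trans (K≡ a b) (trans (proj₂ (proj₂ (co-copy {G = co G} {H = H} (g , g-inj , adj))) a b) (co-involutive simple (g a) (g b)))

Ū≡co-U : ∀ a b → Ū a b ≡ co U a b
Ū≡co-U = toWitness {a? = Fin.all? (λ a → Fin.all? (λ b → Ū a b Bool.≟ co U a b))} _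

U≡co-Ū : ∀ a b → U a b ≡ co Ū a b
U≡co-Ū = toWitness {a? = Fin.all? (λ a → Fin.all? (λ b → U a b Bool.≟ co Ū a b))} _

outcome⇒good : ∀ {n} {G : Graph n} → Outcome G → HasGoodPartition G
outcome⇒good (p , (indep , clique , joined , disjoint) , outcome) = p , indep , clique , joined , disjoint , inj₂ (types outcome)
  where
  types : _ → _
  types (inj₁ small) = inj₁ small
  types (inj₂ (inj₁ iso)) = inj₂ (inj₁ iso)
  types (inj₂ (inj₂ (inj₁ iso))) = inj₂ (inj₂ (inj₁ iso))
  types (inj₂ (inj₂ (inj₂ (m , 3≤m , star)))) = inj₂ (inj₂ (inj₂ (inj₁ (m , 3≤m , star-iso star))))

swap₁₂ : Fin 3 → Fin 3
swap₁₂ 0F = 1F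
swap₁₂ 1F = 0F
swap₁₂ 2F = 2F

swap₁₂-involutive : ∀ i → swap₁₂ (swap₁₂ i) ≡ i
swap₁₂-involutive 0F = refl
swap₁₂-involutive 1F = refl
swap₁₂-involutive 2F = refl

-- Complementation exchanges V₁ with V₂ and U with Ū, while V₃ keeps its vertices.
co-outcome⇒good : ∀ {n} {G : Graph n} → IsSimple G → Outcome (co G) → HasGoodPartition G
co-outcome⇒good {n} {G} simple (p , (indep , clique , joined , disjoint) , outcome) =
  p′ , indep′ , clique′ , (λ u v pu pv → edge (apart pu pv (λ ())) (disjoint u v (back pu) (back pv)))
    , (λ u v pu pv → nonedge (apart pu pv (λ ())) (joined u v (back pu) (back pv))) , inj₂ (types outcome)
  where
  p′ : Fin n → Fin 3
  p′ v = swap₁₂ (p v)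
  back : ∀ {v i} → p′ v ≡ i → p v ≡ swap₁₂ i
  back {v} e = trans (sym (swap₁₂-involutive (p v))) (cong swap₁₂ e)
  edge : ∀ {u v} → u ≢ v → co G u v ≡ false → G u v ≡ true
  edge {u} {v} u≢v e = trans (sym (Bool.not-involutive (G u v))) (cong not (trans (sym (co-≢ G u≢v)) e))
  nonedge : ∀ {u v} → u ≢ v → co G u v ≡ true → G u v ≡ false
  nonedge {u} {v} u≢v e = trans (sym (Bool.not-involutive (G u v))) (cong not (trans (sym (co-≢ G u≢v)) e))
  apart : ∀ {u v i j} → p′ u ≡ i → p′ v ≡ j → i ≢ j → u ≢ v
  apart pu pv i≢j refl = i≢j (trans (sym pu) pv)
  indep′ : ∀ u v → p′ u ≡ 0F → p′ v ≡ 0F → G u v ≡ false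
  indep′ u v pu pv with u ≟ v
  ... | yes refl = proj₂ simple u
  ... | no u≢v = nonedge u≢v (clique u v u≢v (back pu) (back pv))
  clique′ : ∀ u v → u ≢ v → p′ u ≡ 1F → p′ v ≡ 1F → G u v ≡ true
  clique′ u v u≢v pu pv = edge u≢v (indep u v (back pu) (back pv))
  V⊆ : ∀ v → p v ≡ 2F → p′ v ≡ 2F
  V⊆ v e = cong swap₁₂ e
  ⊆V : ∀ v → p′ v ≡ 2F → p v ≡ 2F
  ⊆V v = back
  same-filter : filter (λ v → p′ v ≟ 2F) (allFin n) ≡ filter (λ v → p v ≟ 2F) (allFin n)
  same-filter = List.filter-≐ (λ v → p′ v ≟ 2F) (λ v → p v ≟ 2F) ((λ {v} → ⊆V v) , λ {v} → V⊆ v) (allFin n)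
  types : _ → _
  types (inj₁ small) = inj₁ (subst (λ vs → length vs ℕ.< 6) (sym same-filter) small)
  types (inj₂ (inj₁ iso)) = inj₂ (inj₂ (inj₁ (iso-≐ {G = G} V⊆ ⊆V (co-iso {G = G} {H = U} simple Ū≡co-U iso))))
  types (inj₂ (inj₂ (inj₁ iso))) = inj₂ (inj₁ (iso-≐ {G = G} V⊆ ⊆V (co-iso {G = G} {H = Ū} simple U≡co-Ū iso)))
  types (inj₂ (inj₂ (inj₂ (m , 3≤m , star)))) = inj₂ (inj₂ (inj₂ (inj₂ (m , 3≤m , iso-≐ {G = G} V⊆ ⊆V (co-star-iso {G = G} simple star)))))

𝓑-free⇒good : ∀ {n} {G : Graph n} → IsSimple G → 𝓑-free G → HasGoodPartition G
𝓑-free⇒good {n} {G} simple free with SplitOrObstruction.split-or-obstruction simple (Unique.allFin⁺ n)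
... | inj₁ (inj₁ copy) = outcome⇒good (Outcomes.2K₂-outcome simple (𝓑-free⇒free simple free) copy)
... | inj₁ (inj₂ (inj₁ copy)) = co-outcome⇒good simple
  (Outcomes.2K₂-outcome (co-simple simple) (𝓑-free⇒free (co-simple simple) (free-co simple free)) copy)
... | inj₁ (inj₂ (inj₂ copy)) = outcome⇒good (Outcomes.C₅-outcome simple (𝓑-free⇒free simple free) copy)
-- A split graph is taken as V₃ in its entirety, so that the conditions on V₁ and V₂ hold vacuously.
... | inj₂ (q , splits) = (λ _ → 2F) , (λ _ _ ()) , (λ _ _ _ ()) , (λ _ _ _ ()) , (λ _ _ _ ()) ,
  inj₁ (q , λ u v _ _ u≢v → (λ qu qv → uniform qu qv u≢v) , (λ qu qv → uniform qu qv u≢v))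
  where
  uniform : ∀ {u v b} → q u ≡ b → q v ≡ b → u ≢ v → G u v ≡ b
  uniform {u} {v} qu qv u≢v = trans (splits (List.∈-allFin u) (List.∈-allFin v) u≢v (trans qu (sym qv))) qu

-- The equivalences

theorem5 : ∀ (n : ℕ) (d : Fin n → ℕ) → Graphic d →
    ((∀ G → Realization d G → ¬ HasBlossom G) ⇔ Decisive d) ×
    ((∀ G → Realization d G → 𝓑-free G) ⇔ Decisive d) ×
    ((∃[ G ] Realization d G × 𝓑-free G) ⇔ Decisive d) ×
    ((∃[ G ] Realization d G × HasGoodPartition G) ⇔ Decisive d) ×
    ((∀ G → Realization d G → HasGoodPartition G) ⇔ Decisive d)
theorem5 n d (G₀ , real₀) =
    mk⇔ (2⇒D ∘ 1⇒2) D⇒1 , mk⇔ 2⇒D (1⇒2 ∘ D⇒1) , mk⇔ 3⇒D (λ D → G₀ , real₀ , 1⇒2 (D⇒1 D) G₀ real₀)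
  , mk⇔ 4⇒D (λ D → G₀ , real₀ , D⇒5 D G₀ real₀) , mk⇔ (λ good → 4⇒D (G₀ , real₀ , good G₀ real₀)) D⇒5
  where
  D⇒1 : Decisive d → ∀ G → Realization d G → ¬ HasBlossom G
  D⇒1 = decisive⇒blossom-free
  1⇒2 : (∀ G → Realization d G → ¬ HasBlossom G) → ∀ G → Realization d G → 𝓑-free G
  1⇒2 = blossom-free⇒𝓑-free (All.lookup witnesses)
  4⇒D : (∃[ G ] Realization d G × HasGoodPartition G) → Decisive d
  4⇒D (G , real , good) x vertex = good-vertex-integral {G = G} real good vertex
  3⇒D : (∃[ G ] Realization d G × 𝓑-free G) → Decisive d
  3⇒D (G , real , free) = 4⇒D (G , real , 𝓑-free⇒good (proj₁ real) free)
  2⇒D : (∀ G → Realization d G → 𝓑-free G) → Decisive d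
  2⇒D free = 3⇒D (G₀ , real₀ , free G₀ real₀)
  D⇒5 : Decisive d → ∀ G → Realization d G → HasGoodPartition G
  D⇒5 D G real = 𝓑-free⇒good (proj₁ real) (1⇒2 (D⇒1 D) G real)
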